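{- Let $S_{n,r}^2$ be any graph obtained from $S_n \times K_2$ by deleting $r$ edges of $E'=\{ii' \mid i=1,2,\dots,n\}$, where $0 \leq r \leq n-1$. Then (1) $Kf(S_{n,r}^2) = \begin{cases} \frac{8n^3 -(4r+17)n^2 -(4r^2 -26r -6)n -6r}{3(n-r)}, &\text{if}~11' \notin E(S_{n,r}^2) \\ \frac{8n^3 -(4r-3)n^2 -(4r^2 -30r +14)n +12 -6r}{3(n-r-2)}, &\text{if}~11' \in E(S_{n,r}^2) \end{cases}$; (2) $\tau(S_{n,r}^2) = \begin{cases} (n-r) \cdot 3^{n-r-1}, &\text{if}~11' \notin E(S_{n,r}^2) \\ (n-r+2) \cdot 3^{n-r+2}, &\text{if}~11' \in E(S_{n,r}^2) \end{cases}$; (3) $\lim\limits_{n \rightarrow +\infty} \frac{Kf(S_{n,r}^2)}{W(S_{n,r}^2)} = \frac{8}{15}$.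
   Context: $S_n$ is the star of order $n$ and $K_2$ the complete graph on two vertices. $S_n \times K_2$ is their Cartesian product: its vertices are labelled $1,2,\dots,n$ (a copy of $S_n$ with center $1$ and leaves $2,\dots,n$) and $1',2',\dots,n'$ (the second copy, with center $1'$), with $i$ adjacent to $i'$ for each $i$; it has $2n$ vertices and $3n-2$ edges. $E'=\{ii' \mid i=1,\dots,n\}$ is the set of these "vertical" edges. For a connected graph $G$, $Kf(G)=\sum_{i<j} r_{ij}$ is the Kirchhoff index (sum of resistance distances over unordered vertex pairs, each edge a unit resistor), $\tau(G)$ is the number of spanning trees, and $W(G)=\sum_{i<j} d_{ij}$ is the Wiener index (sum of shortest-path distances).
   Formalization: In the case 11' ∈ E the printed formulas fail (for n=2, r=0, a 4-cycle, the Kf denominator is 0 and τ would be 324, not 4); proved instead: Kf has denominator 3(n-r+2), and τ = (n-r+2)·3^{n-r-2}. -}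

module Defs where

open import Data.Nat as ℕ using (ℕ; zero; suc)
open import Data.Integer as ℤ using (ℤ; +_)
open import Data.Rational as ℚ using (ℚ; 0ℚ; 1ℚ; _/_)
open import Data.Rational.Properties as ℚP using ()
open import Data.Fin as Fin using (Fin; _↑ˡ_; _↑ʳ_)
open import Data.Fin.Properties as FinP using ()
open import Data.Fin.Subset using (Subset; ∣_∣; _∈_)
open import Data.Vec as Vec using ()
open import Data.Bool using (Bool; true; false; if_then_else_)
open import Data.List as List using (List; []; _∷_; _++_; allFin; length; concatMap; foldr)
open import Data.List.Relation.Unary.Unique.Propositional using (Unique)
open import Data.List.Membership.Propositional as Mem using ()
open import Data.Product using (Σ; ∃; _×_; _,_)
open import Data.Sum using (_⊎_)
open import Function.Bundles using (_⇔_)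
import Relation.Nullary
open import Relation.Nullary using (does)
open import Relation.Binary.PropositionalEquality using (_≡_)

-- Finite (simple, loopless) graphs on vertex set Fin N, given by an
-- edge list; an edge (a , b) joins a and b (undirected).

record Graph : Set where
  field
    N     : ℕ
    edges : List (Fin N × Fin N)
open Graph public

∣E∣ : Graph → ℕ
∣E∣ G = length (edges G)

edge : (G : Graph) → Fin (∣E∣ G) → Fin (N G) × Fin (N G)
edge G e = List.lookup (edges G) e

AdjIn : (G : Graph) → Subset (∣E∣ G) → Fin (N G) → Fin (N G) → Set
AdjIn G S u v = ∃ λ e → e ∈ S × (edge G e ≡ (u , v) ⊎ edge G e ≡ (v , u))

Adj : (G : Graph) → Fin (N G) → Fin (N G) → Set
Adj G u v = ∃ λ e → edge G e ≡ (u , v) ⊎ edge G e ≡ (v , u)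

data Walk {V : Set} (R : V → V → Set) : V → V → ℕ → Set where
  here : ∀ {u} → Walk R u u 0
  step : ∀ {u w v ℓ} → R u w → Walk R w v ℓ → Walk R u v (suc ℓ)

-- A spanning tree: a set S of edges of G forming a connected spanning
-- subgraph with |V(G)| - 1 edges (equivalently: connected and acyclic).
IsSpanningTree : (G : Graph) → Subset (∣E∣ G) → Set
IsSpanningTree G S =
  ∣ S ∣ ≡ N G ℕ.∸ 1 × (∀ u v → ∃ λ ℓ → Walk (AdjIn G S) u v ℓ)

SpanningTreeCount : Graph → ℕ → Set
SpanningTreeCount G t =
  ∃ λ (ts : List (Subset (∣E∣ G))) →
    Unique ts × (∀ S → (S Mem.∈ ts) ⇔ IsSpanningTree G S) × length ts ≡ t

sumFin : ∀ {N} → (Fin N → ℚ) → ℚ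
sumFin {N} f = foldr (λ i acc → f i ℚ.+ acc) 0ℚ (allFin N)

sumPairs : ∀ {N} → (Fin N → Fin N → ℚ) → ℚ
sumPairs f = sumFin λ i → sumFin λ j → if does (i FinP.<? j) then f i j else 0ℚ

sumFinℕ : ∀ {N} → (Fin N → ℕ) → ℕ
sumFinℕ {N} f = foldr (λ i acc → f i ℕ.+ acc) 0 (allFin N)

sumPairsℕ : ∀ {N} → (Fin N → Fin N → ℕ) → ℕ
sumPairsℕ f = sumFinℕ λ i → sumFinℕ λ j → if does (i FinP.<? j) then f i j else 0

ℕ→ℚ : ℕ → ℚ
ℕ→ℚ n = + n / 1

lap : (G : Graph) → (Fin (N G) → ℚ) → Fin (N G) → ℚ
lap G x v = foldr contrib 0ℚ (edges G)
  where
  contrib : Fin (N G) × Fin (N G) → ℚ → ℚ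
  contrib (a , b) acc =
    (if does (a FinP.≟ v) then x a ℚ.- x b else 0ℚ) ℚ.+
    ((if does (b FinP.≟ v) then x b ℚ.- x a else 0ℚ) ℚ.+ acc)

δ : ∀ {N} → Fin N → Fin N → ℚ
δ i v = if does (i FinP.≟ v) then 1ℚ else 0ℚ

-- x is a vector of node potentials when a unit current enters at i and
-- leaves at j: L x = e_i - e_j
IsPotential : (G : Graph) → Fin (N G) → Fin (N G) → (Fin (N G) → ℚ) → Set
IsPotential G i j x = ∀ v → lap G x v ≡ δ i v ℚ.- δ j v

IsResistance : (G : Graph) → Fin (N G) → Fin (N G) → ℚ → Set
IsResistance G i j ρ =
  (∃ λ x → IsPotential G i j x) ×
  (∀ x → IsPotential G i j x → x i ℚ.- x j ≡ ρ)

HasKf : Graph → ℚ → Set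
HasKf G k = ∃ λ (r : Fin (N G) → Fin (N G) → ℚ) →
  (∀ i j → IsResistance G i j (r i j)) × sumPairs r ≡ k

IsDist : (G : Graph) → Fin (N G) → Fin (N G) → ℕ → Set
IsDist G u v d = Walk (Adj G) u v d × (∀ ℓ → Walk (Adj G) u v ℓ → d ℕ.≤ ℓ)

HasWiener : Graph → ℕ → Set
HasWiener G w = ∃ λ (d : Fin (N G) → Fin (N G) → ℕ) →
  (∀ u v → IsDist G u v (d u v)) × sumPairsℕ d ≡ w

-- The graphs S_{n,r}^2, n = suc m.
-- Vertex i (top copy, i : Fin n, center = zero) is  i ↑ˡ n,
-- vertex i' (bottom copy) is  n ↑ʳ i.  D ⊆ {1..n} (as Fin n) is the set of
-- indices i whose vertical edge ii' is deleted.

starPrismMinus : (m : ℕ) → Subset (suc m) → Graph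
starPrismMinus m D = record { N = suc m ℕ.+ suc m ; edges = es }
  where
  n = suc m
  top : Fin n → Fin (n ℕ.+ n)
  top i = i ↑ˡ n
  bot : Fin n → Fin (n ℕ.+ n)
  bot i = n ↑ʳ i
  es : List (Fin (n ℕ.+ n) × Fin (n ℕ.+ n))
  es = concatMap (λ j → (top Fin.zero , top (Fin.suc j)) ∷ []) (allFin m)
    ++ concatMap (λ j → (bot Fin.zero , bot (Fin.suc j)) ∷ []) (allFin m)
    ++ concatMap (λ i → if Vec.lookup D i then [] else (top i , bot i) ∷ []) (allFin n)

-- Division p / q in ℚ (only ever used with q ≠ 0; returns 0 when q = 0)

_÷'_ : ℚ → ℚ → ℚ
p ÷' q with q ℚP.≟ 0ℚ
... | Relation.Nullary.yes _ = 0ℚ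
... | Relation.Nullary.no q≢0 = ℚ._÷_ p q {{ℚ.≢-nonZero q≢0}}

-- A leaf i is live if its rung ii' survives and dead otherwise; k is the number of live leaves.
--
-- Resistances.  Ground the graph at the centre 1.  Between the centres 1 and 1' the k live paths
-- 1 - i - i' - 1' act as k parallel resistors of size 3, so the effective conductance is C = k/3,
-- plus 1 if 11' is present.  If h is the harmonic function with h(1) = 0 and h(1') = 1, the Green
-- function is g(u,v) = h(u) h(v) / C + γ(u,v), where γ is the Green function of the graph grounded at
-- both centres: γ is 1 on a dead leaf and (1/3) [[2,1],[1,2]] on a live pair i, i'.  In weak form this
-- says energy(y, g(u,-)) = y(u) - y(1) for all y; by symmetry of the energy form it gives existence and
-- uniqueness of r(u,v) = g(u,u) - 2 g(u,v) + g(v,v) at once, and Kf = |V| tr g - Σ g.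
--
-- Spanning trees.  A connected spanning subgraph keeps both rim edges of a dead leaf and at least two
-- of the three edges of a live path; counting edges, it is a tree iff exactly one of the live paths
-- and the edge 11' is kept entirely.
--
-- Limit.  With k live and d dead leaves, 45 C Kf - 24 C W is a quadratic polynomial in k, while C W
-- grows like k³.
module Submission where

open import Defs
open import Data.Nat using (ℕ; zero; suc; _≤_; _∸_; _^_)
open import Data.Nat as ℕ using (s≤s; z≤n)
open import Data.Rational using (ℚ; 0ℚ; _<_; _+_; _-_; _*_)
open import Data.Rational as ℚ using (1ℚ; -_; _/_; mkℚ)
open import Data.Fin as Fin using (Fin; zero; suc; _↑ˡ_; _↑ʳ_; splitAt)
open import Data.Fin.Subset using (Subset; ∣_∣; _∈_; _∉_)
open import Data.Product using (∃; ∃₂; _×_; _,_; proj₁; proj₂)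
open import Relation.Binary.PropositionalEquality

open import Agda.Builtin.Int using (pos; negsuc)
open import Algebra.Bundles using (CommutativeRing)
open import Data.Bool using (Bool; true; false; if_then_else_; _∧_)
import Data.Bool.Properties as BoolP
open import Data.Empty using (⊥; ⊥-elim)
import Data.Fin.Properties as FinP
import Data.Fin.Subset.Properties as SubP
open import Data.Integer as ℤ using ()
import Data.Integer.Properties as ℤP
open import Data.List as List using (List; []; _∷_; _++_; length; concatMap; foldr; allFin; cartesianProductWith)
import Data.List.Properties as ListP
open import Data.List.Membership.Propositional using (find) renaming (_∈_ to _∈ˡ_)
open import Data.List.Membership.Propositional.Properties
open import Data.List.Relation.Unary.All as All using (All; []; _∷_)
import Data.List.Relation.Unary.All.Properties as AllP
open import Data.List.Relation.Unary.AllPairs using ([]; _∷_)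
open import Data.List.Relation.Unary.Any using (here; there; index)
import Data.List.Relation.Unary.Any.Properties as AnyP
open import Data.List.Relation.Unary.Unique.Propositional using (Unique)
import Data.List.Relation.Unary.Unique.Propositional.Properties as UniqueP
import Data.Nat.Properties as ℕP
open import Data.Nat.Tactic.RingSolver renaming (solve-∀ to solveℕ-∀)
import Data.Rational.Properties as ℚP
import Data.Rational.Unnormalised as ℚᵘ
import Data.Rational.Unnormalised.Properties as ℚᵘP
open import Data.Sum using (_⊎_; inj₁; inj₂; [_,_]′)
open import Data.Vec using (Vec; []; _∷_; here; lookup; tabulate)
import Data.Vec.Properties as VecP
open import Function using (_∘_; id)
open import Function.Bundles using (mk⇔)
open import Relation.Binary using (tri<; tri≈; tri>)
open import Relation.Nullary using (Dec; yes; no; does)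
open import Relation.Nullary.Decidable using (True; toWitness; dec⇒maybe; dec-true; dec-false)
open import Tactic.RingSolver using (solve-∀)
open import Tactic.RingSolver.Core.AlmostCommutativeRing using (AlmostCommutativeRing; fromCommutativeRing)
open import Algebra.Properties.Semiring.Sum (CommutativeRing.semiring ℚP.+-*-commutativeRing)
  using (sum; sum-cong-≗; ∑-distrib-+; ∑-comm; *-distribˡ-sum; *-distribʳ-sum; sum-replicate-zero)

-- Rational arithmetic and finite sums

-- The value 8/15: when nearly every leaf is live, C grows and the term h(u) h(v) / C fades, so
-- leaves of different pairs have resistance close to γ(u,u) + γ(v,v) = 4/3, while their distance is
-- 2 within a copy and 3 across, on average 5/2. The edge 11' conducts as much as three live paths
-- but counts once in n - r. So 3C is n - r without it and n - r + 2 with it, and the denominator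
-- with it is 9C = 3(n - r + 2). The tree count with it is k·3^(k-1) + 3^k for k = n - r - 1, that
-- is (n - r + 2)·3^(n-r-2). For n = 1, r = 0 the graph is K_2 and both formulas give 1, which
-- confirms the signs of the 2's; the exponent is then -1, hence the form with a quotient by 9.
-- Division is kept out of the calculations: Kf is handled through Kf·C, tree counts are multiplied
-- by 3 or 9, and sums over pairs are doubled. What remains are polynomial identities for the ring
-- solver, and a nonzero factor is cancelled at the end.

ℚ-ring : AlmostCommutativeRing _ _
ℚ-ring = fromCommutativeRing ℚP.+-*-commutativeRing (λ x → dec⇒maybe (0ℚ ℚP.≟ x))

-- `_/_` on `ℚ` normalises by a gcd that does not reduce for a variable numerator. The laws of `ℕ→ℚ`
-- are therefore checked on unnormalised fractions and pulled back along the injective,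
-- order-reflecting `toℚᵘ`.
ℕ→ℚᵘ : ∀ n → ℚ.toℚᵘ (ℕ→ℚ n) ℚᵘ.≃ (pos n ℚᵘ./ 1)
ℕ→ℚᵘ n = ℚP.toℚᵘ-fromℚᵘ (pos n ℚᵘ./ 1)

ℕ→ℚ-+ : ∀ a b → ℕ→ℚ (a ℕ.+ b) ≡ ℕ→ℚ a + ℕ→ℚ b
ℕ→ℚ-+ a b = ℚP.toℚᵘ-injective (begin
  ℚ.toℚᵘ (ℕ→ℚ (a ℕ.+ b))                   ≈⟨ ℕ→ℚᵘ (a ℕ.+ b) ⟩
  pos (a ℕ.+ b) ℚᵘ./ 1                        ≈⟨ ℚᵘ.*≡*
      (cong (ℤ._* pos 1) (cong₂ ℤ._+_ (sym (ℤP.*-identityʳ (pos a))) (sym (ℤP.*-identityʳ (pos b))))) ⟩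
  (pos a ℚᵘ./ 1) ℚᵘ.+ (pos b ℚᵘ./ 1)            ≈⟨ ℚᵘP.+-cong (ℕ→ℚᵘ a) (ℕ→ℚᵘ b) ⟨
  ℚ.toℚᵘ (ℕ→ℚ a) ℚᵘ.+ ℚ.toℚᵘ (ℕ→ℚ b)      ≈⟨ ℚP.toℚᵘ-homo-+ (ℕ→ℚ a) (ℕ→ℚ b) ⟨
  ℚ.toℚᵘ (ℕ→ℚ a + ℕ→ℚ b)                   ∎)
  where open ℚᵘP.≃-Reasoning

ℕ→ℚ-* : ∀ a b → ℕ→ℚ (a ℕ.* b) ≡ ℕ→ℚ a * ℕ→ℚ b
ℕ→ℚ-* a b = ℚP.toℚᵘ-injective (begin
  ℚ.toℚᵘ (ℕ→ℚ (a ℕ.* b))                   ≈⟨ ℕ→ℚᵘ (a ℕ.* b) ⟩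
  pos (a ℕ.* b) ℚᵘ./ 1                        ≈⟨ ℚᵘ.*≡* (cong (ℤ._* pos 1) (ℤP.pos-* a b)) ⟩
  (pos a ℚᵘ./ 1) ℚᵘ.* (pos b ℚᵘ./ 1)            ≈⟨ ℚᵘP.*-cong (ℕ→ℚᵘ a) (ℕ→ℚᵘ b) ⟨
  ℚ.toℚᵘ (ℕ→ℚ a) ℚᵘ.* ℚ.toℚᵘ (ℕ→ℚ b)      ≈⟨ ℚP.toℚᵘ-homo-* (ℕ→ℚ a) (ℕ→ℚ b) ⟨
  ℚ.toℚᵘ (ℕ→ℚ a * ℕ→ℚ b)                   ∎)
  where open ℚᵘP.≃-Reasoning

ℕ→ℚ-mono-≤ : ∀ {a b} → a ℕ.≤ b → ℕ→ℚ a ℚ.≤ ℕ→ℚ b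
ℕ→ℚ-mono-≤ {a} {b} a≤b = ℚP.toℚᵘ-cancel-≤ (ℚᵘP.≤-respˡ-≃ (ℚᵘP.≃-sym (ℕ→ℚᵘ a)) (ℚᵘP.≤-respʳ-≃ (ℚᵘP.≃-sym (ℕ→ℚᵘ b))
  (ℚᵘ.*≤* (ℤP.*-monoʳ-≤-nonNeg (pos 1) (ℤ.+≤+ a≤b)))))

ℕ→ℚ-mono-< : ∀ {a b} → a ℕ.< b → ℕ→ℚ a ℚ.< ℕ→ℚ b
ℕ→ℚ-mono-< {a} {b} a<b = ℚP.toℚᵘ-cancel-< (ℚᵘP.<-respˡ-≃ (ℚᵘP.≃-sym (ℕ→ℚᵘ a)) (ℚᵘP.<-respʳ-≃ (ℚᵘP.≃-sym (ℕ→ℚᵘ b))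
  (ℚᵘ.*<* (ℤP.*-monoʳ-<-pos (pos 1) (ℤ.+<+ a<b)))))

ℕ→ℚ-∸ : ∀ {a b} → b ℕ.≤ a → ℕ→ℚ (a ℕ.∸ b) ≡ ℕ→ℚ a - ℕ→ℚ b
ℕ→ℚ-∸ {a} {b} b≤a = begin
  ℕ→ℚ (a ℕ.∸ b)                     ≡⟨ cancel _ _ ⟩
  (ℕ→ℚ (a ℕ.∸ b) + ℕ→ℚ b) - ℕ→ℚ b ≡⟨ cong (_- ℕ→ℚ b) (ℕ→ℚ-+ (a ℕ.∸ b) b) ⟨
  ℕ→ℚ (a ℕ.∸ b ℕ.+ b) - ℕ→ℚ b      ≡⟨ cong (λ z → ℕ→ℚ z - ℕ→ℚ b) (ℕP.m∸n+n≡m b≤a) ⟩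
  ℕ→ℚ a - ℕ→ℚ b                    ∎
  where
  open ≡-Reasoning
  cancel : ∀ x y → x ≡ (x + y) - y
  cancel = solve-∀ ℚ-ring

÷'-* : ∀ p q → q ≢ 0ℚ → (p ÷' q) * q ≡ p
÷'-* p q q≢0 with q ℚP.≟ 0ℚ
... | yes q≡0 = ⊥-elim (q≢0 q≡0)
... | no q≢0′ = begin
  p * ℚ.1/ q * q   ≡⟨ ℚP.*-assoc p _ q ⟩
  p * (ℚ.1/ q * q) ≡⟨ cong (p *_) (ℚP.*-inverseˡ q) ⟩
  p * 1ℚ           ≡⟨ ℚP.*-identityʳ p ⟩
  p                ∎
  where
  open ≡-Reasoning
  instance _ = ℚ.≢-nonZero q≢0′

*-cancelʳ : ∀ {x y} q → q ≢ 0ℚ → x * q ≡ y * q → x ≡ y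
*-cancelʳ {x} {y} q q≢0 xq≡yq = begin
  x              ≡⟨ ℚP.*-identityʳ x ⟨
  x * 1ℚ         ≡⟨ cong (x *_) q/q ⟨
  x * (q * r)    ≡⟨ ℚP.*-assoc x q r ⟨
  x * q * r      ≡⟨ cong (_* r) xq≡yq ⟩
  y * q * r      ≡⟨ ℚP.*-assoc y q r ⟩
  y * (q * r)    ≡⟨ cong (y *_) q/q ⟩
  y * 1ℚ         ≡⟨ ℚP.*-identityʳ y ⟩
  y              ∎
  where
  open ≡-Reasoning
  r = 1ℚ ÷' q
  q/q : q * r ≡ 1ℚ
  q/q = trans (ℚP.*-comm q r) (÷'-* 1ℚ q q≢0)

2*-cancel : ∀ x y → ℕ→ℚ 2 * x ≡ ℕ→ℚ 2 * y → x ≡ y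
2*-cancel x y 2x≡2y =
  *-cancelʳ (ℕ→ℚ 2) (λ ()) (trans (ℚP.*-comm x (ℕ→ℚ 2)) (trans 2x≡2y (ℚP.*-comm (ℕ→ℚ 2) y)))

÷'-unique : ∀ x p q → q ≢ 0ℚ → x * q ≡ p → x ≡ p ÷' q
÷'-unique x p q q≢0 xq≡p = *-cancelʳ q q≢0 (trans xq≡p (sym (÷'-* p q q≢0)))

-- The folds of `lap` and `sumFin` run over lists, the algebra of finite sums over `Fin`. `lsum` has
-- the shape of the fold in `sumFin` and bridges the two.
lsum : ∀ {A : Set} → (A → ℚ) → List A → ℚ
lsum φ = foldr (λ e acc → φ e + acc) 0ℚ

lsum-++ : ∀ {A : Set} (φ : A → ℚ) xs ys → lsum φ (xs ++ ys) ≡ lsum φ xs + lsum φ ys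
lsum-++ φ []       ys = sym (ℚP.+-identityˡ _)
lsum-++ φ (x ∷ xs) ys = trans (cong (φ x +_) (lsum-++ φ xs ys)) (sym (ℚP.+-assoc (φ x) (lsum φ xs) (lsum φ ys)))

lsum-tabulate : ∀ {A : Set} (φ : A → ℚ) {n} (g : Fin n → A) → lsum φ (List.tabulate g) ≡ sum (φ ∘ g)
lsum-tabulate φ {zero}  g = refl
lsum-tabulate φ {suc n} g = cong (φ (g zero) +_) (lsum-tabulate φ (g ∘ suc))

lsum-concatMap : ∀ {A B : Set} (φ : B → ℚ) (f : A → List B) {n} (g : Fin n → A) →
                 lsum φ (concatMap f (List.tabulate g)) ≡ sum (λ i → lsum φ (f (g i)))
lsum-concatMap φ f {zero}  g = refl
lsum-concatMap φ f {suc n} g = trans (lsum-++ φ (f (g zero)) (concatMap f (List.tabulate (g ∘ suc))))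
  (cong (lsum φ (f (g zero)) +_) (lsum-concatMap φ f (g ∘ suc)))

∑-↑ : ∀ m {n} (f : Fin (m ℕ.+ n) → ℚ) → sum f ≡ sum (λ i → f (i ↑ˡ n)) + sum (λ i → f (m ↑ʳ i))
∑-↑ zero    f = sym (ℚP.+-identityˡ _)
∑-↑ (suc m) {n} f = trans (cong (f zero +_) (∑-↑ m (f ∘ suc)))
  (sym (ℚP.+-assoc (f zero) (sum (λ i → f (suc i ↑ˡ n))) (sum (λ i → f (suc m ↑ʳ i)))))

sumFin≡∑ : ∀ {n} (f : Fin n → ℚ) → sumFin f ≡ sum f
sumFin≡∑ f = lsum-tabulate f id

∑-zero : ∀ {n} (f : Fin n → ℚ) → (∀ i → f i ≡ 0ℚ) → sum f ≡ 0ℚ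
∑-zero {n} f f≡0 = trans (sum-cong-≗ f≡0) (sum-replicate-zero n)

∑-const : ∀ n c → sum {n} (λ _ → c) ≡ ℕ→ℚ n * c
∑-const zero    c = sym (ℚP.*-zeroˡ c)
∑-const (suc n) c = trans (cong (c +_) (∑-const n c)) (trans (one (ℕ→ℚ n) c) (cong (_* c) (sym (ℕ→ℚ-+ 1 n))))
  where
  one : ∀ x c → c + x * c ≡ (1ℚ + x) * c
  one = solve-∀ ℚ-ring

δ-refl : ∀ {n} (i : Fin n) → δ i i ≡ 1ℚ
δ-refl i rewrite dec-true (i FinP.≟ i) refl = refl

δ-≢ : ∀ {n} {i j : Fin n} → i ≢ j → δ i j ≡ 0ℚ
δ-≢ {i = i} {j} i≢j rewrite dec-false (i FinP.≟ j) i≢j = refl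

δ-swap : ∀ {n} (w : Fin n → ℚ) i j → δ i j * w j ≡ δ j i * w i
δ-swap w i j with i FinP.≟ j
... | yes refl = cong (_* w i) (sym (δ-refl i))
... | no i≢j  = trans (ℚP.*-zeroˡ (w j)) (sym (trans (cong (_* w i) (δ-≢ (i≢j ∘ sym))) (ℚP.*-zeroˡ (w i))))

∑-δ : ∀ {n} (i : Fin n) (f : Fin n → ℚ) → sum (λ j → δ i j * f j) ≡ f i
∑-δ {suc n} zero f = begin
  1ℚ * f zero + sum (λ j → δ {suc n} zero (suc j) * f (suc j))
    ≡⟨ cong (1ℚ * f zero +_) (∑-zero _ λ j → ℚP.*-zeroˡ (f (suc j))) ⟩
  1ℚ * f zero + 0ℚ ≡⟨ ℚP.+-identityʳ _ ⟩
  1ℚ * f zero      ≡⟨ ℚP.*-identityˡ _ ⟩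
  f zero           ∎
  where open ≡-Reasoning
∑-δ {suc n} (suc i) f = begin
  0ℚ * f zero + sum (λ j → δ i j * f (suc j)) ≡⟨ cong (_+ sum (λ j → δ i j * f (suc j))) (ℚP.*-zeroˡ (f zero)) ⟩
  0ℚ + sum (λ j → δ i j * f (suc j)) ≡⟨ ℚP.+-identityˡ _ ⟩
  sum (λ j → δ i j * f (suc j)) ≡⟨ ∑-δ i (f ∘ suc) ⟩
  f (suc i) ∎
  where open ≡-Reasoning

-- Resistances from a Green function

-- Stated for any step function `c`, because the one in `lap` is local to it and is reached only by
-- unification.
foldr≡lsum : ∀ {A : Set} (c : A → ℚ → ℚ) (φ : A → ℚ) → (∀ e acc → c e acc ≡ φ e + acc) →
             ∀ es → foldr c 0ℚ es ≡ lsum φ es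
foldr≡lsum c φ c≡φ+ []       = refl
foldr≡lsum c φ c≡φ+ (e ∷ es) = trans (c≡φ+ e _) (cong (φ e +_) (foldr≡lsum c φ c≡φ+ es))

module _ {n : ℕ} where
  private V = Fin n

  dropProduct : (V → ℚ) → (V → ℚ) → V × V → ℚ
  dropProduct y x (a , b) = (y a - y b) * (x a - x b)

  -- The Dirichlet form yᵀLx, written edge by edge so that its symmetry is visible.
  energy : (V → ℚ) → (V → ℚ) → List (V × V) → ℚ
  energy y x = lsum (dropProduct y x)

  energy-sym : ∀ y x es → energy y x es ≡ energy x y es
  energy-sym y x []             = refl
  energy-sym y x ((a , b) ∷ es) = cong₂ _+_ (ℚP.*-comm (y a - y b) (x a - x b)) (energy-sym y x es)

  energy-minus : ∀ y x z es → energy y (λ v → x v - z v) es ≡ energy y x es - energy y z es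
  energy-minus y x z []             = refl
  energy-minus y x z ((a , b) ∷ es) =
    trans (cong (dropProduct y (λ v → x v - z v) (a , b) +_) (energy-minus y x z es))
        (rearrange (y a) (y b) (x a) (x b) (z a) (z b) _ _)
    where
    rearrange : ∀ ya yb xa xb za zb s t →
      (ya - yb) * ((xa - za) - (xb - zb)) + (s - t) ≡
      ((ya - yb) * (xa - xb) + s) - ((ya - yb) * (za - zb) + t)
    rearrange = solve-∀ ℚ-ring

  if-δ : ∀ (a v : V) t → (if does (a FinP.≟ v) then t else 0ℚ) ≡ δ a v * t
  if-δ a v t with does (a FinP.≟ v)
  ... | true  = sym (ℚP.*-identityˡ t)
  ... | false = sym (ℚP.*-zeroˡ t)

  -- Summation by parts: the form is linear in its first argument, and y is the combination of the
  -- point masses at v with coefficients `y v`. Each edge only picks out its two ends.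
  ∑-y*energy-δ : ∀ y x es → sum (λ v → y v * energy (λ a → δ a v) x es) ≡ energy y x es
  ∑-y*energy-δ y x [] = ∑-zero _ λ v → ℚP.*-zeroʳ (y v)
  ∑-y*energy-δ y x ((a , b) ∷ es) = begin
    sum (λ v → y v * ((δ a v - δ b v) * (x a - x b) + energy (λ a → δ a v) x es))
      ≡⟨ sum-cong-≗ (λ v → rearrange (y v) (δ a v) (δ b v) (x a) (x b) _) ⟩
    sum (λ v → (δ a v * y v * (x a - x b) + δ b v * y v * (x b - x a)) + y v * energy (λ a → δ a v) x es)
      ≡⟨ ∑-distrib-+ (λ v → δ a v * y v * (x a - x b) + δ b v * y v * (x b - x a)) _ ⟩
    sum (λ v → δ a v * y v * (x a - x b) + δ b v * y v * (x b - x a)) + rest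
      ≡⟨ cong (_+ rest) (∑-distrib-+ (λ v → δ a v * y v * (x a - x b)) _) ⟩
    (sum (λ v → δ a v * y v * (x a - x b)) + sum (λ v → δ b v * y v * (x b - x a))) + rest
      ≡⟨ cong (_+ rest) (cong₂ _+_ (pick a (x a - x b)) (pick b (x b - x a))) ⟩
    (y a * (x a - x b) + y b * (x b - x a)) + rest
      ≡⟨ cong₂ _+_ (collect (y a) (y b) (x a) (x b)) (∑-y*energy-δ y x es) ⟩
    (y a - y b) * (x a - x b) + energy y x es ∎
    where
    open ≡-Reasoning
    rest = sum (λ v → y v * energy (λ a → δ a v) x es)
    pick : ∀ a t → sum (λ v → δ a v * y v * t) ≡ y a * t
    pick a t = trans (sym (*-distribʳ-sum t (λ v → δ a v * y v))) (cong (_* t) (∑-δ a y))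
    rearrange : ∀ y da db xa xb s → y * ((da - db) * (xa - xb) + s) ≡ (da * y * (xa - xb) + db * y * (xb - xa)) + y * s
    rearrange = solve-∀ ℚ-ring
    collect : ∀ ya yb xa xb → ya * (xa - xb) + yb * (xb - xa) ≡ (ya - yb) * (xa - xb)
    collect = solve-∀ ℚ-ring

lap≡energy : ∀ G x v → lap G x v ≡ energy (λ a → δ a v) x (edges G)
lap≡energy G x v = foldr≡lsum _ (dropProduct (λ a → δ a v) x) (λ (a , b) acc → trans
  (cong₂ (λ p q → p + (q + acc)) (if-δ a v (x a - x b)) (if-δ b v (x b - x a)))
  (collect (δ a v) (δ b v) (x a) (x b) acc)) (edges G)
  where
  collect : ∀ da db xa xb acc → da * (xa - xb) + (db * (xb - xa) + acc) ≡ (da - db) * (xa - xb) + acc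
  collect = solve-∀ ℚ-ring

module Green (G : Graph) (o : Fin (N G)) (g : Fin (N G) → Fin (N G) → ℚ)
  (g-green : ∀ u y → energy y (g u) (edges G) ≡ y u - y o) where

  private V = Fin (N G)

  potential : V → V → V → ℚ
  potential i j v = g i v - g j v

  energy-potential : ∀ i j y → energy y (potential i j) (edges G) ≡ y i - y j
  energy-potential i j y = begin
    energy y (potential i j) (edges G)                     ≡⟨ energy-minus y (g i) (g j) (edges G) ⟩
    energy y (g i) (edges G) - energy y (g j) (edges G)    ≡⟨ cong₂ _-_ (g-green i y) (g-green j y) ⟩
    (y i - y o) - (y j - y o)                              ≡⟨ cancel (y i) (y j) (y o) ⟩
    y i - y j                                              ∎
    where
    open ≡-Reasoning
    cancel : ∀ a b c → (a - c) - (b - c) ≡ a - b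
    cancel = solve-∀ ℚ-ring

  resistance : V → V → ℚ
  resistance i j = potential i j i - potential i j j

  isResistance : ∀ i j → IsResistance G i j (resistance i j)
  isResistance i j = (p , λ v → trans (lap≡energy G p v) (energy-potential i j (λ a → δ a v))) , unique
    where
    p = potential i j
    pick : ∀ k → sum (λ v → p v * δ k v) ≡ p k
    pick k = trans (sum-cong-≗ λ v → ℚP.*-comm (p v) (δ k v)) (∑-δ k p)
    distrib : ∀ p a b → p * (a - b) ≡ p * a + (- 1ℚ) * (p * b)
    distrib = solve-∀ ℚ-ring
    minus : ∀ a b → a + (- 1ℚ) * b ≡ a - b
    minus = solve-∀ ℚ-ring
    -- The energy of x and p is evaluated twice: the weak form of p tested on x gives x i - x j, and
    -- after exchanging the arguments the equation Lx = e_i - e_j gives p i - p j.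
    unique : ∀ x → IsPotential G i j x → x i - x j ≡ resistance i j
    unique x x-pot = begin
      x i - x j                                   ≡⟨ energy-potential i j x ⟨
      energy x p (edges G)                        ≡⟨ energy-sym x p (edges G) ⟩
      energy p x (edges G)                        ≡⟨ ∑-y*energy-δ p x (edges G) ⟨
      sum (λ v → p v * energy (λ a → δ a v) x (edges G))
        ≡⟨ sum-cong-≗ (λ v → cong (p v *_) (trans (sym (lap≡energy G x v)) (x-pot v))) ⟩
      sum (λ v → p v * (δ i v - δ j v))           ≡⟨ sum-cong-≗ (λ v → distrib (p v) (δ i v) (δ j v)) ⟩
      sum (λ v → p v * δ i v + (- 1ℚ) * (p v * δ j v)) ≡⟨ ∑-distrib-+ (λ v → p v * δ i v) _ ⟩
      sum (λ v → p v * δ i v) + sum (λ v → (- 1ℚ) * (p v * δ j v))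
        ≡⟨ cong₂ _+_ (pick i) (sym (*-distribˡ-sum (- 1ℚ) (λ v → p v * δ j v))) ⟩
      p i + (- 1ℚ) * sum (λ v → p v * δ j v)    ≡⟨ cong (λ t → p i + (- 1ℚ) * t) (pick j) ⟩
      p i + (- 1ℚ) * p j                          ≡⟨ minus (p i) (p j) ⟩
      p i - p j                                   ∎
      where open ≡-Reasoning

upper : ∀ {n} → (Fin n → Fin n → ℚ) → Fin n → Fin n → ℚ
upper f i j = if does (i FinP.<? j) then f i j else 0ℚ

sumPairs≡∑∑ : ∀ {n} (f : Fin n → Fin n → ℚ) → sumPairs f ≡ sum (λ i → sum (upper f i))
sumPairs≡∑∑ f = trans (sumFin≡∑ (λ i → sumFin (upper f i))) (sum-cong-≗ λ i → sumFin≡∑ (upper f i))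

-- Each unordered pair occurs once in `upper f` and once in its transpose. Doubling thus removes the
-- order on the vertices and lets the sum be split into blocks.
double-sumPairs : ∀ {n} (f : Fin n → Fin n → ℚ) → (∀ i → f i i ≡ 0ℚ) → (∀ i j → f i j ≡ f j i) →
  ℕ→ℚ 2 * sumPairs f ≡ sum λ i → sum λ j → f i j
double-sumPairs {n} f f-diag f-sym = begin
  ℕ→ℚ 2 * sumPairs f           ≡⟨ two (sumPairs f) ⟩
  sumPairs f + sumPairs f       ≡⟨ cong₂ _+_ (sumPairs≡∑∑ f) (trans (sumPairs≡∑∑ f) (∑-comm up)) ⟩
  sum (λ i → sum (up i)) + sum (λ i → sum λ j → up j i)
    ≡⟨ ∑-distrib-+ (λ i → sum (up i)) _ ⟨
  sum (λ i → sum (up i) + sum (λ j → up j i))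
    ≡⟨ sum-cong-≗ (λ i → ∑-distrib-+ (up i) _) ⟨
  sum (λ i → sum λ j → up i j + up j i)
    ≡⟨ sum-cong-≗ (λ i → sum-cong-≗ λ j → up+up i j) ⟩
  sum (λ i → sum λ j → f i j) ∎
  where
  open ≡-Reasoning
  up = upper f
  two : ∀ x → ℕ→ℚ 2 * x ≡ x + x
  two = solve-∀ ℚ-ring
  up+up : ∀ i j → up i j + up j i ≡ f i j
  up+up i j with FinP.<-cmp i j
  ... | tri< i<j _ j≮i rewrite dec-true (i FinP.<? j) i<j | dec-false (j FinP.<? i) j≮i = ℚP.+-identityʳ _
  ... | tri≈ i≮j refl _ rewrite dec-false (i FinP.<? j) i≮j = sym (f-diag i)
  ... | tri> i≮j _ j<i rewrite dec-false (i FinP.<? j) i≮j | dec-true (j FinP.<? i) j<i =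
    trans (ℚP.+-identityˡ _) (f-sym j i)

module GreenKf (G : Graph) (o : Fin (N G)) (g : Fin (N G) → Fin (N G) → ℚ)
  (g-green : ∀ u y → energy y (g u) (edges G) ≡ y u - y o)
  (g-sym : ∀ u v → g u v ≡ g v u) where
  open Green G o g g-green

  private
    T = sum λ i → g i i
    A = sum λ i → sum λ j → g i j
    c = ℕ→ℚ

  ∑-resistance : ∀ i → sum (resistance i) ≡ (c (N G) * g i i + T) + (- c 2) * sum (g i)
  ∑-resistance i = begin
    sum (resistance i)                                  ≡⟨ sum-cong-≗ expand ⟩
    sum (λ j → (g i i + g j j) + (- c 2) * g i j)       ≡⟨ ∑-distrib-+ (λ j → g i i + g j j) _ ⟩
    sum (λ j → g i i + g j j) + sum (λ j → (- c 2) * g i j)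
      ≡⟨ cong₂ _+_ (∑-distrib-+ (λ _ → g i i) (λ j → g j j)) (sym (*-distribˡ-sum (- c 2) (g i))) ⟩
    (sum {N G} (λ _ → g i i) + T) + (- c 2) * sum (g i)
      ≡⟨ cong (λ t → (t + T) + (- c 2) * sum (g i)) (∑-const (N G) (g i i)) ⟩
    (c (N G) * g i i + T) + (- c 2) * sum (g i)         ∎
    where
    open ≡-Reasoning
    rearrange : ∀ a b d → (a - b) - (b - d) ≡ (a + d) + (- c 2) * b
    rearrange = solve-∀ ℚ-ring
    expand : ∀ j → resistance i j ≡ (g i i + g j j) + (- c 2) * g i j
    expand j = trans (cong (λ t → (g i i - t) - (g i j - g j j)) (g-sym j i)) (rearrange (g i i) (g i j) (g j j))

  hasKf : HasKf G (c (N G) * T - A)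
  hasKf = resistance , isResistance , 2*-cancel (sumPairs resistance) (c (N G) * T - A) (begin
    c 2 * sumPairs resistance       ≡⟨ double-sumPairs resistance r-diag r-sym ⟩
    sum (λ i → sum (resistance i))  ≡⟨ sum-cong-≗ ∑-resistance ⟩
    sum (λ i → (c (N G) * g i i + T) + (- c 2) * sum (g i))
      ≡⟨ ∑-distrib-+ (λ i → c (N G) * g i i + T) _ ⟩
    sum (λ i → c (N G) * g i i + T) + sum (λ i → (- c 2) * sum (g i))
      ≡⟨ cong₂ _+_ (∑-distrib-+ (λ i → c (N G) * g i i) _) (sym (*-distribˡ-sum (- c 2) (λ i → sum (g i)))) ⟩
    (sum (λ i → c (N G) * g i i) + sum {N G} (λ _ → T)) + (- c 2) * A
      ≡⟨ cong (_+ (- c 2) * A) (cong₂ _+_ (sym (*-distribˡ-sum (c (N G)) (λ i → g i i))) (∑-const (N G) T)) ⟩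
    (c (N G) * T + c (N G) * T) + (- c 2) * A ≡⟨ collect (c (N G) * T) A ⟩
    c 2 * (c (N G) * T - A) ∎)
    where
    open ≡-Reasoning
    collect : ∀ x a → (x + x) + (- c 2) * a ≡ c 2 * (x - a)
    collect = solve-∀ ℚ-ring
    zero-diag : ∀ a → (a - a) - (a - a) ≡ 0ℚ
    zero-diag = solve-∀ ℚ-ring
    r-diag : ∀ i → resistance i i ≡ 0ℚ
    r-diag i = zero-diag (g i i)
    swap : ∀ a b d e → (a - b) - (d - e) ≡ (e - d) - (b - a)
    swap = solve-∀ ℚ-ring
    r-sym : ∀ i j → resistance i j ≡ resistance j i
    r-sym i j = swap (g i i) (g j i) (g i j) (g j j)

-- The Green function of the star prism

module TwoCopies (n : ℕ) where
  top bot : Fin n → Fin (n ℕ.+ n)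
  top i = i ↑ˡ n
  bot i = n ↑ʳ i

  ⟨_∣_⟩ : ∀ {a} {A : Set a} → (Fin n → A) → (Fin n → A) → Fin (n ℕ.+ n) → A
  ⟨ f ∣ g ⟩ v = [ f , g ]′ (splitAt n v)

  at-top : ∀ {a} {A : Set a} (f g : Fin n → A) i → ⟨ f ∣ g ⟩ (top i) ≡ f i
  at-top f g i = cong [ f , g ]′ (FinP.splitAt-↑ˡ n i n)

  at-bot : ∀ {a} {A : Set a} (f g : Fin n → A) i → ⟨ f ∣ g ⟩ (bot i) ≡ g i
  at-bot f g i = cong [ f , g ]′ (FinP.splitAt-↑ʳ n n i)

  vertex-elim : ∀ {p} (P : Fin (n ℕ.+ n) → Set p) → (∀ i → P (top i)) → (∀ i → P (bot i)) → ∀ v → P v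
  vertex-elim P P-top P-bot v with splitAt n v in eq
  ... | inj₁ i = subst P (FinP.splitAt⁻¹-↑ˡ eq) (P-top i)
  ... | inj₂ i = subst P (FinP.splitAt⁻¹-↑ʳ eq) (P-bot i)

  -- A matrix on both copies given by its four blocks. It serves for the Green function, the
  -- distances, the indicator of chosen edges and the tags of edge kinds.
  module Blocks {a} {A : Set a} (TT TB BT BB : Fin n → Fin n → A) where
    rowT rowB : Fin n → Fin (n ℕ.+ n) → A
    rowT i = ⟨ TT i ∣ TB i ⟩
    rowB i = ⟨ BT i ∣ BB i ⟩

    block : Fin (n ℕ.+ n) → Fin (n ℕ.+ n) → A
    block = ⟨ rowT ∣ rowB ⟩

    block-TT : ∀ i j → block (top i) (top j) ≡ TT i j
    block-TT i j = trans (cong (λ r → r (top j)) (at-top rowT rowB i)) (at-top (TT i) (TB i) j)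

    block-TB : ∀ i j → block (top i) (bot j) ≡ TB i j
    block-TB i j = trans (cong (λ r → r (bot j)) (at-top rowT rowB i)) (at-bot (TT i) (TB i) j)

    block-BT : ∀ i j → block (bot i) (top j) ≡ BT i j
    block-BT i j = trans (cong (λ r → r (top j)) (at-bot rowT rowB i)) (at-top (BT i) (BB i) j)

    block-BB : ∀ i j → block (bot i) (bot j) ≡ BB i j
    block-BB i j = trans (cong (λ r → r (bot j)) (at-bot rowT rowB i)) (at-bot (BT i) (BB i) j)

-- Conductances, with `true` for a deleted rung: `wt` of a single rung, `third` of the path through
-- a leaf pair. `third` is also the value of h at the upper leaf and the entry of γ between the two
-- leaves.
wt third : Bool → ℚ
wt d    = if d then 0ℚ else 1ℚ
third d = if d then 0ℚ else pos 1 / 3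

∣∣+∑wt : ∀ {n} (D : Subset n) → ℕ→ℚ ∣ D ∣ + sum (λ i → wt (lookup D i)) ≡ ℕ→ℚ n
∣∣+∑wt [] = refl
∣∣+∑wt {suc n} (true ∷ D) = begin
  ℕ→ℚ (suc ∣ D ∣) + (0ℚ + W)  ≡⟨ cong (_+ (0ℚ + W)) (ℕ→ℚ-+ 1 ∣ D ∣) ⟩
  (1ℚ + ℕ→ℚ ∣ D ∣) + (0ℚ + W) ≡⟨ rearrange (ℕ→ℚ ∣ D ∣) W ⟩
  1ℚ + (ℕ→ℚ ∣ D ∣ + W)        ≡⟨ cong (1ℚ +_) (∣∣+∑wt D) ⟩
  1ℚ + ℕ→ℚ n                  ≡⟨ ℕ→ℚ-+ 1 n ⟨
  ℕ→ℚ (suc n)                 ∎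
  where
  open ≡-Reasoning
  W = sum (λ i → wt (lookup D i))
  rearrange : ∀ x y → (1ℚ + x) + (0ℚ + y) ≡ 1ℚ + (x + y)
  rearrange = solve-∀ ℚ-ring
∣∣+∑wt {suc n} (false ∷ D) = begin
  ℕ→ℚ ∣ D ∣ + (1ℚ + W)        ≡⟨ rearrange (ℕ→ℚ ∣ D ∣) W ⟩
  1ℚ + (ℕ→ℚ ∣ D ∣ + W)        ≡⟨ cong (1ℚ +_) (∣∣+∑wt D) ⟩
  1ℚ + ℕ→ℚ n                  ≡⟨ ℕ→ℚ-+ 1 n ⟨
  ℕ→ℚ (suc n)                 ∎
  where
  open ≡-Reasoning
  W = sum (λ i → wt (lookup D i))
  rearrange : ∀ x y → x + (1ℚ + y) ≡ 1ℚ + (x + y)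
  rearrange = solve-∀ ℚ-ring

leafEnergy : Bool → (y₀ y y₀′ y′ x₀ x x₀′ x′ : ℚ) → ℚ
leafEnergy d y₀ y y₀′ y′ x₀ x x₀′ x′ =
  (y₀ - y) * (x₀ - x) + ((y₀′ - y′) * (x₀′ - x′) + (if d then 0ℚ else (y - y′) * (x - x′)))

-- x is ρh plus e times the row of γ at the upper leaf. The first part carries the current ρs
-- between the centres; the second has a unit source at the leaf, drained to the two centres in the
-- shares 1 - s and s. Two cases, because the identity needs the value of s that fits the rung.
leaf-top : ∀ d ρ e y₀ y y₀′ y′ → let s = third d in
  leafEnergy d y₀ y y₀′ y′ 0ℚ (ρ * s + e * (1ℚ - s)) ρ (ρ * (1ℚ - s) + e * s)
  ≡ ρ * (y₀′ - y₀) * s + e * ((y - y₀) - s * (y₀′ - y₀))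
leaf-top true = eq
  where
  eq : ∀ ρ e y₀ y y₀′ y′ →
    (y₀ - y) * (0ℚ - (ρ * 0ℚ + e * (1ℚ - 0ℚ))) + ((y₀′ - y′) * (ρ - (ρ * (1ℚ - 0ℚ) + e * 0ℚ)) + 0ℚ)
    ≡ ρ * (y₀′ - y₀) * 0ℚ + e * ((y - y₀) - 0ℚ * (y₀′ - y₀))
  eq = solve-∀ ℚ-ring
leaf-top false = eq
  where
  eq : ∀ ρ e y₀ y y₀′ y′ →
    (y₀ - y) * (0ℚ - (ρ * (pos 1 / 3) + e * (1ℚ - (pos 1 / 3)))) +
        ((y₀′ - y′) * (ρ - (ρ * (1ℚ - (pos 1 / 3)) + e * (pos 1 / 3))) + (y - y′) *
            ((ρ * (pos 1 / 3) + e * (1ℚ - (pos 1 / 3))) - (ρ * (1ℚ - (pos 1 / 3)) + e * (pos 1 / 3))))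
    ≡ ρ * (y₀′ - y₀) * (pos 1 / 3) + e * ((y - y₀) - (pos 1 / 3) * (y₀′ - y₀))
  eq = solve-∀ ℚ-ring

leaf-bot : ∀ d ρ e y₀ y y₀′ y′ → let s = third d in
  leafEnergy d y₀ y y₀′ y′ 0ℚ (ρ * s + e * s) ρ (ρ * (1ℚ - s) + e * (1ℚ - s))
  ≡ ρ * (y₀′ - y₀) * s + e * ((y′ - y₀′) + s * (y₀′ - y₀))
leaf-bot true = eq
  where
  eq : ∀ ρ e y₀ y y₀′ y′ →
    (y₀ - y) * (0ℚ - (ρ * 0ℚ + e * 0ℚ)) + ((y₀′ - y′) * (ρ - (ρ * (1ℚ - 0ℚ) + e * (1ℚ - 0ℚ))) + 0ℚ)
    ≡ ρ * (y₀′ - y₀) * 0ℚ + e * ((y′ - y₀′) + 0ℚ * (y₀′ - y₀))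
  eq = solve-∀ ℚ-ring
leaf-bot false = eq
  where
  eq : ∀ ρ e y₀ y y₀′ y′ →
    (y₀ - y) * (0ℚ - (ρ * (pos 1 / 3) + e * (pos 1 / 3))) +
        ((y₀′ - y′) * (ρ - (ρ * (1ℚ - (pos 1 / 3)) + e * (1ℚ - (pos 1 / 3)))) + (y - y′) *
            ((ρ * (pos 1 / 3) + e * (pos 1 / 3)) - (ρ * (1ℚ - (pos 1 / 3)) + e * (1ℚ - (pos 1 / 3)))))
    ≡ ρ * (y₀′ - y₀) * (pos 1 / 3) + e * ((y′ - y₀′) + (pos 1 / 3) * (y₀′ - y₀))
  eq = solve-∀ ℚ-ring

-- s is 0 or 1/3, so s² = s/3 and the quadratic R(1 - 2s + 2s²) becomes R - (4/3)Rs. Hence the trace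
-- depends on the deleted leaf rungs through S alone.
leaf-trace : ∀ d R → let s = third d in
  (R * s * s + 1ℚ * (1ℚ - s)) + (R * (1ℚ - s) * (1ℚ - s) + 1ℚ * (1ℚ - s))
  ≡ (R + ℕ→ℚ 2) + (- (R * (pos 4 / 3) + ℕ→ℚ 2)) * s
leaf-trace true = eq
  where
  eq : ∀ R →
    (R * 0ℚ * 0ℚ + 1ℚ * (1ℚ - 0ℚ)) + (R * (1ℚ - 0ℚ) * (1ℚ - 0ℚ) + 1ℚ * (1ℚ - 0ℚ))
    ≡ (R + ℕ→ℚ 2) + (- (R * (pos 4 / 3) + ℕ→ℚ 2)) * 0ℚ
  eq = solve-∀ ℚ-ring
leaf-trace false = eq
  where
  eq : ∀ R →
    (R * (pos 1 / 3) * (pos 1 / 3) + 1ℚ * (1ℚ - (pos 1 / 3))) +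
        (R * (1ℚ - (pos 1 / 3)) * (1ℚ - (pos 1 / 3)) + 1ℚ * (1ℚ - (pos 1 / 3)))
    ≡ (R + ℕ→ℚ 2) + (- (R * (pos 4 / 3) + ℕ→ℚ 2)) * (pos 1 / 3)
  eq = solve-∀ ℚ-ring

module Prism {m : ℕ} (D : Subset (suc m)) where
  n = suc m
  G = starPrismMinus m D
  open TwoCopies n public
  D₀ = lookup D zero
  dead : Fin m → Bool
  dead j = lookup D (suc j)

  V : Set
  V = Fin (n ℕ.+ n)

  rimT rimB : Fin m → List (V × V)
  rimT j = (top zero , top (suc j)) ∷ []
  rimB j = (bot zero , bot (suc j)) ∷ []

  rung : Fin n → List (V × V)
  rung i = if lookup D i then [] else (top i , bot i) ∷ []

  es₁ es₂ es₃ : List (V × V)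
  es₁ = concatMap rimT (allFin m)
  es₂ = concatMap rimB (allFin m)
  es₃ = concatMap rung (allFin n)

  -- The edge list is ordered by kind; regrouped by leaf pair it meets the identities for a single
  -- leaf. It is used for energies and again for counting the edges of a tree.
  lsum-edges : ∀ (φ : Fin (n ℕ.+ n) × Fin (n ℕ.+ n) → ℚ) → lsum φ (edges G) ≡
    (if D₀ then 0ℚ else φ (top zero , bot zero)) +
    sum (λ j → φ (top zero , top (suc j)) + (φ (bot zero , bot (suc j)) +
               (if dead j then 0ℚ else φ (top (suc j) , bot (suc j)))))
  lsum-edges φ = begin
    lsum φ (edges G) ≡⟨ lsum-++ φ es₁ (es₂ ++ es₃) ⟩
    lsum φ es₁ + lsum φ (es₂ ++ es₃) ≡⟨ cong (lsum φ es₁ +_) (lsum-++ φ es₂ es₃) ⟩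
    lsum φ es₁ + (lsum φ es₂ + lsum φ es₃)
      ≡⟨ cong₂ _+_ (lsum-concatMap φ rimT id)
           (cong₂ _+_ (lsum-concatMap φ rimB id) (lsum-concatMap φ rung id)) ⟩
    sum (λ j → A j + 0ℚ) + (sum (λ j → B j + 0ℚ) + sum (λ i → lsum φ (rung i)))
      ≡⟨ cong₂ _+_ (sum-cong-≗ (ℚP.+-identityʳ ∘ A)) (cong₂ _+_ (sum-cong-≗ (ℚP.+-identityʳ ∘ B))
          (sum-cong-≗ (λ i → vertical (lookup D i) (top i , bot i)))) ⟩
    sum A + (sum B + (C₀ + sum C))   ≡⟨ rearrange (sum A) (sum B) C₀ (sum C) ⟩
    C₀ + (sum A + (sum B + sum C))   ≡⟨ cong (λ t → C₀ + (sum A + t)) (∑-distrib-+ B C) ⟨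
    C₀ + (sum A + sum (λ j → B j + C j)) ≡⟨ cong (C₀ +_) (∑-distrib-+ A (λ j → B j + C j)) ⟨
    C₀ + sum (λ j → A j + (B j + C j)) ∎
    where
    open ≡-Reasoning
    A B C : Fin m → ℚ
    A j = φ (top zero , top (suc j))
    B j = φ (bot zero , bot (suc j))
    C j = if dead j then 0ℚ else φ (top (suc j) , bot (suc j))
    C₀ = if D₀ then 0ℚ else φ (top zero , bot zero)
    vertical : ∀ d e → lsum φ (if d then [] else e ∷ []) ≡ (if d then 0ℚ else φ e)
    vertical true  e = refl
    vertical false e = ℚP.+-identityʳ (φ e)
    rearrange : ∀ a b c₀ c → a + (b + (c₀ + c)) ≡ c₀ + (a + (b + c))
    rearrange = solve-∀ ℚ-ring

  s : Fin m → ℚ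
  s j = third (dead j)

  S C : ℚ
  S = sum s
  C = wt D₀ + S

  -- hT, hB are h on the two copies; p, q are the diagonal and off-diagonal entries of γ.
  hT hB p q : Fin n → ℚ
  hT zero    = 0ℚ
  hT (suc j) = s j
  hB zero    = 1ℚ
  hB (suc j) = 1ℚ - s j
  p zero     = 0ℚ
  p (suc j)  = 1ℚ - s j
  q zero     = 0ℚ
  q (suc j)  = s j

  -- R stands for 1/C. Symmetry, trace and total are identities in a free R; the Green property is
  -- where RC = 1 enters.
  module _ (R : ℚ) where
    open Blocks (λ i j → R * hT i * hT j + δ i j * p j) (λ i j → R * hT i * hB j + δ i j * q j)
                (λ i j → R * hB i * hT j + δ i j * q j) (λ i j → R * hB i * hB j + δ i j * p j)
      renaming (block to green; block-TT to gTT; block-TB to gTB; block-BT to gBT; block-BB to gBB)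
      hiding (rowT; rowB) public

    green-sym : ∀ u v → green u v ≡ green v u
    green-sym = vertex-elim _
      (λ i → vertex-elim _
        (λ j → trans (gTT i j) (trans (cong₂ _+_ (swap (hT i) (hT j)) (δ-swap p i j)) (sym (gTT j i))))
        (λ j → trans (gTB i j) (trans (cong₂ _+_ (swap (hT i) (hB j)) (δ-swap q i j)) (sym (gBT j i)))))
      (λ i → vertex-elim _
        (λ j → trans (gBT i j) (trans (cong₂ _+_ (swap (hB i) (hT j)) (δ-swap q i j)) (sym (gTB j i))))
        (λ j → trans (gBB i j) (trans (cong₂ _+_ (swap (hB i) (hB j)) (δ-swap p i j)) (sym (gBB j i)))))
      where
      comm : ∀ r a b → r * a * b ≡ r * b * a
      comm = solve-∀ ℚ-ring
      swap : ∀ a b → R * a * b ≡ R * b * a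
      swap = comm R

    module _ (RC≡1 : R * C ≡ 1ℚ) where
      -- x is a multiple of h plus a correction supported on the i-th leaf pair, whose energy against y is Y i.
      energy-row : ∀ (x y : Fin (n ℕ.+ n) → ℚ) (i : Fin n) (a : ℚ) (Y : Fin n → ℚ) → Y zero ≡ 0ℚ →
        x (top zero) ≡ 0ℚ → x (bot zero) ≡ R * a →
        (∀ j → leafEnergy (dead j) (y (top zero)) (y (top (suc j))) (y (bot zero)) (y (bot (suc j)))
                          0ℚ (x (top (suc j))) (R * a) (x (bot (suc j)))
               ≡ R * a * (y (bot zero) - y (top zero)) * s j + δ i (suc j) * Y (suc j)) →
        energy y x (edges G) ≡ a * (y (bot zero) - y (top zero)) + Y i
      energy-row x y i a Y Y₀ x₀ x₀′ leaf = begin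
        energy y x (edges G) ≡⟨ lsum-edges (dropProduct y x) ⟩
        (if D₀ then 0ℚ else (y₀ - y₀′) * (x (top zero) - x (bot zero))) +
          sum (λ j → leafEnergy (dead j) y₀ (y (top (suc j))) y₀′ (y (bot (suc j)))
                          (x (top zero)) (x (top (suc j))) (x (bot zero)) (x (bot (suc j))))
          ≡⟨ cong₂ (λ u v → (if D₀ then 0ℚ else (y₀ - y₀′) * (u - v)) + sum
              (λ j → leafEnergy (dead j) y₀ (y (top (suc j))) y₀′ (y (bot (suc j)))
                          u (x (top (suc j))) v (x (bot (suc j))))) x₀ x₀′ ⟩
        _ ≡⟨ cong₂ _+_ (centre D₀ y₀ y₀′ (R * a)) (sum-cong-≗ leaf) ⟩
        wt D₀ * (R * a * Δ) + sum (λ j → R * a * Δ * s j + δ i (suc j) * Y (suc j))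
          ≡⟨ cong (wt D₀ * (R * a * Δ) +_) (∑-distrib-+ (λ j → R * a * Δ * s j) _) ⟩
        wt D₀ * (R * a * Δ) + (sum (λ j → R * a * Δ * s j) + sum (λ j → δ i (suc j) * Y (suc j)))
          ≡⟨ cong₂ (λ u v → wt D₀ * (R * a * Δ) + (u + v)) (sym (*-distribˡ-sum (R * a * Δ) s)) pick ⟩
        wt D₀ * (R * a * Δ) + (R * a * Δ * S + Y i) ≡⟨ collect (wt D₀) S R a Δ (Y i) ⟩
        -- All connections between the centres together carry the current R a C, which the choice of
        -- R makes equal to a.
        R * C * (a * Δ) + Y i ≡⟨ cong (λ t → t * (a * Δ) + Y i) RC≡1 ⟩
        1ℚ * (a * Δ) + Y i    ≡⟨ cong (_+ Y i) (ℚP.*-identityˡ (a * Δ)) ⟩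
        a * Δ + Y i           ∎
        where
        open ≡-Reasoning
        y₀ = y (top zero)
        y₀′ = y (bot zero)
        Δ = y₀′ - y₀
        flip-signs : ∀ a b ρ → (a - b) * (0ℚ - ρ) ≡ 1ℚ * (ρ * (b - a))
        flip-signs = solve-∀ ℚ-ring
        centre : ∀ d y₀ y₀′ ρ → (if d then 0ℚ else (y₀ - y₀′) * (0ℚ - ρ)) ≡ wt d * (ρ * (y₀′ - y₀))
        centre true  y₀ y₀′ ρ = sym (ℚP.*-zeroˡ (ρ * (y₀′ - y₀)))
        centre false y₀ y₀′ ρ = flip-signs y₀ y₀′ ρ
        collect : ∀ w S R a Δ t → w * (R * a * Δ) + (R * a * Δ * S + t) ≡ R * (w + S) * (a * Δ) + t
        collect = solve-∀ ℚ-ring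
        -- The leaves miss the index `zero`. Because Y vanishes there the sum may be completed, and
        -- the rows of the centres are covered too.
        pick : sum (λ j → δ i (suc j) * Y (suc j)) ≡ Y i
        pick = begin
          sum (λ j → δ i (suc j) * Y (suc j)) ≡⟨ ℚP.+-identityˡ _ ⟨
          0ℚ + sum (λ j → δ i (suc j) * Y (suc j)) ≡⟨ cong (_+ sum (λ j → δ i (suc j) * Y (suc j)))
              (trans (cong (δ i zero *_) Y₀) (ℚP.*-zeroʳ (δ i zero))) ⟨
          sum (λ j → δ i j * Y j) ≡⟨ ∑-δ i Y ⟩
          Y i ∎

      green-top : ∀ i y → energy y (green (top i)) (edges G) ≡ y (top i) - y (top zero)
      green-top i y = trans
        (energy-row (green (top i)) y i (hT i) Y refl
          (trans (gTT i zero) (at0 (R * hT i) (δ i zero))) (trans (gTB i zero) (at0′ (R * hT i) (δ i zero)))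
          (λ j → trans (cong₂ (λ u v → leafEnergy (dead j) y₀ (y (top (suc j))) y₀′ (y (bot (suc j))) 0ℚ u (R * hT i)
              v) (gTT i (suc j)) (gTB i (suc j)))
                       (leaf-top (dead j) (R * hT i) (δ i (suc j)) y₀ (y (top (suc j))) y₀′ (y (bot (suc j))))))
        (finish i)
        where
        y₀ = y (top zero)
        y₀′ = y (bot zero)
        -- The weak form of the row of γ: y at the leaf minus the average of y at the centres with
        -- weights 1 - s and s. As h(leaf) = s, adding h(leaf) times the difference of the centre
        -- values leaves y(leaf) - y(1).
        Y : Fin n → ℚ
        Y zero    = 0ℚ
        Y (suc j) = (y (top (suc j)) - y₀) - s j * (y₀′ - y₀)
        at0 : ∀ ρ d → ρ * 0ℚ + d * 0ℚ ≡ 0ℚ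
        at0 = solve-∀ ℚ-ring
        at0′ : ∀ ρ d → ρ * 1ℚ + d * 0ℚ ≡ ρ
        at0′ = solve-∀ ℚ-ring
        f0 : ∀ a b → 0ℚ * (b - a) + 0ℚ ≡ a - a
        f0 = solve-∀ ℚ-ring
        fs : ∀ s a b c → s * (b - a) + ((c - a) - s * (b - a)) ≡ c - a
        fs = solve-∀ ℚ-ring
        finish : ∀ i → hT i * (y₀′ - y₀) + Y i ≡ y (top i) - y₀
        finish zero    = f0 y₀ y₀′
        finish (suc j) = fs (s j) y₀ y₀′ (y (top (suc j)))

      green-bot : ∀ i y → energy y (green (bot i)) (edges G) ≡ y (bot i) - y (top zero)
      green-bot i y = trans
        (energy-row (green (bot i)) y i (hB i) Y refl
          (trans (gBT i zero) (at0 (R * hB i) (δ i zero))) (trans (gBB i zero) (at0′ (R * hB i) (δ i zero)))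
          (λ j → trans (cong₂ (λ u v → leafEnergy (dead j) y₀ (y (top (suc j))) y₀′ (y (bot (suc j))) 0ℚ u (R * hB i)
              v) (gBT i (suc j)) (gBB i (suc j)))
                       (leaf-bot (dead j) (R * hB i) (δ i (suc j)) y₀ (y (top (suc j))) y₀′ (y (bot (suc j))))))
        (finish i)
        where
        y₀ = y (top zero)
        y₀′ = y (bot zero)
        Y : Fin n → ℚ
        Y zero    = 0ℚ
        Y (suc j) = (y (bot (suc j)) - y₀′) + s j * (y₀′ - y₀)
        at0 : ∀ ρ d → ρ * 0ℚ + d * 0ℚ ≡ 0ℚ
        at0 = solve-∀ ℚ-ring
        at0′ : ∀ ρ d → ρ * 1ℚ + d * 0ℚ ≡ ρ
        at0′ = solve-∀ ℚ-ring
        f0 : ∀ a b → 1ℚ * (b - a) + 0ℚ ≡ b - a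
        f0 = solve-∀ ℚ-ring
        fs : ∀ s a b c → (1ℚ - s) * (b - a) + ((c - b) + s * (b - a)) ≡ c - a
        fs = solve-∀ ℚ-ring
        finish : ∀ i → hB i * (y₀′ - y₀) + Y i ≡ y (bot i) - y₀
        finish zero    = f0 y₀ y₀′
        finish (suc j) = fs (s j) y₀ y₀′ (y (bot (suc j)))

      green-green : ∀ u y → energy y (green u) (edges G) ≡ y u - y (top zero)
      green-green = vertex-elim _ green-top green-bot

    green-trace : sum (λ u → green u u) ≡
      R + ((R + ℕ→ℚ 2) * ℕ→ℚ m + (- (R * (pos 4 / 3) + ℕ→ℚ 2)) * S)
    green-trace = begin
      sum (λ u → green u u) ≡⟨ ∑-↑ n (λ u → green u u) ⟩
      sum (λ i → green (top i) (top i)) + sum (λ i → green (bot i) (bot i))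
        ≡⟨ cong₂ _+_ (sum-cong-≗ λ i → trans (gTT i i) (diag (R * hT i * hT i) (p i) i))
            (sum-cong-≗ λ i → trans (gBB i i) (diag (R * hB i * hB i) (p i) i)) ⟩
      sum a + sum b                                      ≡⟨ ∑-distrib-+ a b ⟨
      (a zero + b zero) + sum (λ j → a (suc j) + b (suc j)) ≡⟨ cong₂ _+_ (c0 R) (sum-cong-≗ λ j → leaf-trace (dead j) R) ⟩
      R + sum (λ j → (R + ℕ→ℚ 2) + K * s j)           ≡⟨ cong (R +_) (∑-distrib-+ (λ _ → R + ℕ→ℚ 2) (λ j → K * s j)) ⟩
      R + (sum {m} (λ _ → R + ℕ→ℚ 2) + sum (λ j → K * s j))
        ≡⟨ cong₂ (λ u v → R + (u + v)) (∑-const m (R + ℕ→ℚ 2)) (sym (*-distribˡ-sum K s)) ⟩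
      R + (ℕ→ℚ m * (R + ℕ→ℚ 2) + K * S)               ≡⟨ cong (λ t → R + (t + K * S)) (ℚP.*-comm (ℕ→ℚ m) (R + ℕ→ℚ 2)) ⟩
      R + ((R + ℕ→ℚ 2) * ℕ→ℚ m + K * S)               ∎
      where
      open ≡-Reasoning
      K = - (R * (pos 4 / 3) + ℕ→ℚ 2)
      a b : Fin n → ℚ
      a i = R * hT i * hT i + 1ℚ * p i
      b i = R * hB i * hB i + 1ℚ * p i
      diag : ∀ x w (i : Fin n) → x + δ i i * w ≡ x + 1ℚ * w
      diag x w i = cong (λ t → x + t * w) (δ-refl i)
      c0 : ∀ R → (R * 0ℚ * 0ℚ + 1ℚ * 0ℚ) + (R * 1ℚ * 1ℚ + 1ℚ * 0ℚ) ≡ R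
      c0 = solve-∀ ℚ-ring

    -- Exchanging the copies takes h to 1 - h, so h(j) + h(j') = 1, and h sums to n whichever leaves
    -- are dead.
    row-sum : ∀ a (w w′ : Fin n → ℚ) i →
      sum (λ j → a * hT j + δ i j * w j) + sum (λ j → a * hB j + δ i j * w′ j) ≡ ℕ→ℚ n * a + (w i + w′ i)
    row-sum a w w′ i = begin
      sum (λ j → a * hT j + δ i j * w j) + sum (λ j → a * hB j + δ i j * w′ j)
        ≡⟨ cong₂ _+_ (∑-distrib-+ (λ j → a * hT j) (λ j → δ i j * w j)) (∑-distrib-+ (λ j → a * hB j) (λ j → δ i j * w′ j)) ⟩
      (sum (λ j → a * hT j) + sum (λ j → δ i j * w j)) + (sum (λ j → a * hB j) + sum (λ j → δ i j * w′ j))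
        ≡⟨ cong₂ (λ u v → (sum (λ j → a * hT j) + u) + (sum (λ j → a * hB j) + v)) (∑-δ i w) (∑-δ i w′) ⟩
      (sum (λ j → a * hT j) + w i) + (sum (λ j → a * hB j) + w′ i)
        ≡⟨ shuffle (sum (λ j → a * hT j)) (sum (λ j → a * hB j)) (w i) (w′ i) ⟩
      (sum (λ j → a * hT j) + sum (λ j → a * hB j)) + (w i + w′ i)
        ≡⟨ cong (_+ (w i + w′ i)) (∑-distrib-+ (λ j → a * hT j) (λ j → a * hB j)) ⟨
      sum (λ j → a * hT j + a * hB j) + (w i + w′ i) ≡⟨ cong (_+ (w i + w′ i)) (sum-cong-≗ ones) ⟩
      sum {n} (λ _ → a) + (w i + w′ i) ≡⟨ cong (_+ (w i + w′ i)) (∑-const n a) ⟩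
      ℕ→ℚ n * a + (w i + w′ i) ∎
      where
      open ≡-Reasoning
      shuffle : ∀ a b c d → (a + c) + (b + d) ≡ (a + b) + (c + d)
      shuffle = solve-∀ ℚ-ring
      o0 : ∀ a → a * 0ℚ + a * 1ℚ ≡ a
      o0 = solve-∀ ℚ-ring
      os : ∀ a s → a * s + a * (1ℚ - s) ≡ a
      os = solve-∀ ℚ-ring
      ones : ∀ j → a * hT j + a * hB j ≡ a
      ones zero    = o0 a
      ones (suc j) = os a (s j)

    -- The part R h hᵀ contributes R n², since h sums to n. Each of the 2m leaves adds 1, its row of
    -- γ consisting of 1 - s and s.
    green-total : sum (λ u → sum (green u)) ≡ R * ℕ→ℚ n * ℕ→ℚ n + ℕ→ℚ 2 * ℕ→ℚ m
    green-total = begin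
      sum (λ u → sum (green u)) ≡⟨ ∑-↑ n (λ u → sum (green u)) ⟩
      sum (λ i → sum (green (top i))) + sum (λ i → sum (green (bot i)))
        ≡⟨ cong₂ _+_ (sum-cong-≗ rT) (sum-cong-≗ rB) ⟩
      sum a + sum b ≡⟨ ∑-distrib-+ a b ⟨
      (a zero + b zero) + sum (λ j → a (suc j) + b (suc j))
        ≡⟨ cong₂ _+_ (c0 c R) (sum-cong-≗ (λ j → cs c R (s j))) ⟩
      R * c + sum {m} (λ j → R * c + ℕ→ℚ 2) ≡⟨ cong (R * c +_) (∑-const m (R * c + ℕ→ℚ 2)) ⟩
      R * c + ℕ→ℚ m * (R * c + ℕ→ℚ 2) ≡⟨ collect R c (ℕ→ℚ m) ⟩
      R * c * (1ℚ + ℕ→ℚ m) + ℕ→ℚ 2 * ℕ→ℚ m ≡⟨ cong (λ t → R * c * t + ℕ→ℚ 2 * ℕ→ℚ m) (ℕ→ℚ-+ 1 m) ⟨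
      R * c * c + ℕ→ℚ 2 * ℕ→ℚ m ∎
      where
      open ≡-Reasoning
      c = ℕ→ℚ n
      a b : Fin n → ℚ
      a i = c * (R * hT i) + (p i + q i)
      b i = c * (R * hB i) + (q i + p i)
      rT : ∀ i → sum (green (top i)) ≡ a i
      rT i = trans (∑-↑ n (green (top i))) (trans (cong₂ _+_ (sum-cong-≗ (gTT i)) (sum-cong-≗ (gTB i)))
          (row-sum (R * hT i) p q i))
      rB : ∀ i → sum (green (bot i)) ≡ b i
      rB i = trans (∑-↑ n (green (bot i))) (trans (cong₂ _+_ (sum-cong-≗ (gBT i)) (sum-cong-≗ (gBB i)))
          (row-sum (R * hB i) q p i))
      c0 : ∀ c R → (c * (R * 0ℚ) + (0ℚ + 0ℚ)) + (c * (R * 1ℚ) + (0ℚ + 0ℚ)) ≡ R * c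
      c0 = solve-∀ ℚ-ring
      cs : ∀ c R s → (c * (R * s) + ((1ℚ - s) + s)) + (c * (R * (1ℚ - s)) + (s + (1ℚ - s))) ≡ R * c + ℕ→ℚ 2
      cs = solve-∀ ℚ-ring
      collect : ∀ R c m → R * c + m * (R * c + ℕ→ℚ 2) ≡ R * c * (1ℚ + m) + ℕ→ℚ 2 * m
      collect = solve-∀ ℚ-ring

  private c = ℕ→ℚ

  -- Trace and total are affine in R, so multiplication by C clears R through RC = 1. Later
  -- arguments know K only by this equation.
  hasKf-C : C ≢ 0ℚ → ∃ λ K → HasKf G K ×
    K * C ≡ (c 2 * c n * ((c n - (pos 4 / 3) * S) + c 2 * C * (c m - S)) - c n * c n) - c 2 * c m * C
  hasKf-C C≢0 = _ , GreenKf.hasKf G (top zero) (green R) (green-green R RC≡1) (green-sym R) , (begin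
    (c (n ℕ.+ n) * sum (λ u → green R u u) - sum (λ u → sum (green R u))) * C
      ≡⟨ cong₂ (λ u v → (c (n ℕ.+ n) * u - v) * C) (green-trace R) (green-total R) ⟩
    (c (n ℕ.+ n) * (R + ((R + c 2) * c m + (- (R * (pos 4 / 3) + c 2)) * S)) - (R * c n * c n + c 2 * c m)) * C
      ≡⟨ cong (λ t → (t * (R + ((R + c 2) * c m + (- (R * (pos 4 / 3) + c 2)) * S)) - (R * c n * c n + c 2 * c m)) *
          C) (ℕ→ℚ-+ n n) ⟩
    ((c n + c n) * (R + ((R + c 2) * c m + (- (R * (pos 4 / 3) + c 2)) * S)) - (R * c n * c n + c 2 * c m)) * C
      ≡⟨ collect (c n) (c m) R S C ⟩
    (c 2 * c n * (R * C * ((1ℚ + c m) - (pos 4 / 3) * S) + c 2 * C * (c m - S)) - R * C * (c n * c n)) - c 2 * c m * C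
      ≡⟨ cong (λ t → (c 2 * c n * (t * ((1ℚ + c m) - (pos 4 / 3) * S) + c 2 * C * (c m - S)) - t * (c n * c n)) - c 2
          * c m * C) RC≡1 ⟩
    (c 2 * c n * (1ℚ * ((1ℚ + c m) - (pos 4 / 3) * S) + c 2 * C * (c m - S)) - 1ℚ * (c n * c n)) - c 2 * c m * C
      ≡⟨ cong₂ (λ u v → (c 2 * c n * (u + c 2 * C * (c m - S)) - v) - c 2 * c m * C)
           (trans (ℚP.*-identityˡ _) (cong (_- (pos 4 / 3) * S) (sym (ℕ→ℚ-+ 1 m)))) (ℚP.*-identityˡ (c n * c n)) ⟩
    (c 2 * c n * ((c n - (pos 4 / 3) * S) + c 2 * C * (c m - S)) - c n * c n) - c 2 * c m * C ∎)
    where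
    open ≡-Reasoning
    R = 1ℚ ÷' C
    RC≡1 : R * C ≡ 1ℚ
    RC≡1 = ÷'-* 1ℚ C C≢0
    collect : ∀ n m R S C →
      ((n + n) * (R + ((R + c 2) * m + (- (R * (pos 4 / 3) + c 2)) * S)) - (R * n * n + c 2 * m)) * C ≡
      (c 2 * n * (R * C * ((1ℚ + m) - (pos 4 / 3) * S) + c 2 * C * (m - S)) - R * C * (n * n)) - c 2 * m * C
    collect = solve-∀ ℚ-ring

-- The Kirchhoff index in terms of n and r

third≡wt : ∀ d → ℕ→ℚ 3 * third d ≡ wt d
third≡wt true  = refl
third≡wt false = refl

pos≢0 : ∀ k → 0 ℕ.< k → ℕ→ℚ k ≢ 0ℚ
pos≢0 k 0<k k≡0 = ℚP.<-irrefl (sym k≡0) (ℕ→ℚ-mono-< 0<k)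

module KfPrism {m : ℕ} (D : Subset (suc m)) (∣D∣≤m : ∣ D ∣ ℕ.≤ m) where
  open Prism D
  private
    c = ℕ→ℚ
    ρ = c ∣ D ∣

  3S≡∑wt : c 3 * S ≡ sum (wt ∘ dead)
  3S≡∑wt = trans (*-distribˡ-sum (c 3) s) (sum-cong-≗ (third≡wt ∘ dead))

  n-ρ : c n - ρ ≡ wt D₀ + c 3 * S
  n-ρ = begin
    c n - ρ                                   ≡⟨ cong (_- ρ) (∣∣+∑wt D) ⟨
    (ρ + (wt D₀ + sum (wt ∘ dead))) - ρ       ≡⟨ cancel ρ _ ⟩
    wt D₀ + sum (wt ∘ dead)                   ≡⟨ cong (wt D₀ +_) 3S≡∑wt ⟨
    wt D₀ + c 3 * S                           ∎
    where
    open ≡-Reasoning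
    cancel : ∀ x y → (x + y) - x ≡ y
    cancel = solve-∀ ℚ-ring

  n-ρ≡∸ : c (n ℕ.∸ ∣ D ∣) ≡ c n - ρ
  n-ρ≡∸ = ℕ→ℚ-∸ (ℕP.m≤n⇒m≤1+n ∣D∣≤m)

  -- The number n - r of surviving rungs, 11' included. It is positive by r ≤ n - 1, and this makes
  -- C nonzero.
  live-count : ℕ
  live-count = n ℕ.∸ ∣ D ∣

  0<live-count : 0 ℕ.< live-count
  0<live-count = ℕP.m<n⇒0<n∸m (ℕ.s≤s ∣D∣≤m)

  ρ≡ : ρ ≡ c n - (wt D₀ + c 3 * S)
  ρ≡ = trans (flip (c n) ρ) (cong (λ t → c n - t) n-ρ)
    where
    flip : ∀ x y → y ≡ x - (x - y)
    flip = solve-∀ ℚ-ring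

  m≡ : c m ≡ c n - 1ℚ
  m≡ = trans (cancel (c m)) (cong (_- 1ℚ) (sym (ℕ→ℚ-+ 1 m)))
    where
    cancel : ∀ x → x ≡ (1ℚ + x) - 1ℚ
    cancel = solve-∀ ℚ-ring

  KC-value : ℚ
  KC-value = (c 2 * c n * ((c n - (pos 4 / 3) * S) + c 2 * C * (c m - S)) - c n * c n) - c 2 * c m * C

  module Absent (D₀≡true : D₀ ≡ true) where

    C≡S : C ≡ S
    C≡S = trans (cong (λ d → wt d + S) D₀≡true) (ℚP.+-identityˡ S)

    n-ρ≡3S : c n - ρ ≡ c 3 * S
    n-ρ≡3S = trans n-ρ (trans (cong (λ d → wt d + c 3 * S) D₀≡true) (ℚP.+-identityˡ (c 3 * S)))

    C≢0 : C ≢ 0ℚ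
    C≢0 C≡0 = pos≢0 live-count 0<live-count (begin
      c live-count ≡⟨ n-ρ≡∸ ⟩
      c n - ρ      ≡⟨ n-ρ≡3S ⟩
      c 3 * S      ≡⟨ cong (c 3 *_) (trans (sym C≡S) C≡0) ⟩
      0ℚ           ∎)
      where open ≡-Reasoning

    numerator : ℚ
    numerator = (c 8 * (c n * c n * c n) - (c 4 * ρ + c 17) * (c n * c n))
                   - ((c 4 * (ρ * ρ) - c 26 * ρ) - c 6) * c n - c 6 * ρ

    denominator≢0 : c 3 * (c n - ρ) ≢ 0ℚ
    denominator≢0 eq = pos≢0 (3 ℕ.* live-count) (ℕP.*-mono-≤ {1} {3} (ℕ.s≤s ℕ.z≤n) 0<live-count)
      (trans (ℕ→ℚ-* 3 live-count) (trans (cong (c 3 *_) n-ρ≡∸) eq))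

    hasKf : HasKf G (numerator ÷' (c 3 * (c n - ρ)))
    hasKf = subst (HasKf G) (÷'-unique K numerator _ denominator≢0 K*) (proj₁ (proj₂ (hasKf-C C≢0)))
      where
      open ≡-Reasoning
      K = proj₁ (hasKf-C C≢0)
      -- With r = n - 3S substituted, n and S are free variables of a polynomial identity. The 9
      -- comes from 3(n - r) = 9S = 9C.
      poly : ∀ n S → let ρ = n - c 3 * S in
        c 9 * ((c 2 * n * ((n - (pos 4 / 3) * S) + c 2 * S * ((n - 1ℚ) - S)) - n * n) - c 2 * (n - 1ℚ) * S)
        ≡ (c 8 * (n * n * n) - (c 4 * ρ + c 17) * (n * n)) - ((c 4 * (ρ * ρ) - c 26 * ρ) - c 6) * n - c 6 * ρ
      poly = solve-∀ ℚ-ring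
      regroup : ∀ K x → K * (c 3 * (c 3 * x)) ≡ c 9 * (K * x)
      regroup = solve-∀ ℚ-ring
      ρ≡′ : ρ ≡ c n - c 3 * S
      ρ≡′ = trans ρ≡ (cong (λ t → c n - t) (trans (sym n-ρ) n-ρ≡3S))
      K* : K * (c 3 * (c n - ρ)) ≡ numerator
      K* = begin
        K * (c 3 * (c n - ρ))       ≡⟨ cong (λ t → K * (c 3 * t)) (trans n-ρ≡3S (cong (c 3 *_) (sym C≡S))) ⟩
        K * (c 3 * (c 3 * C))       ≡⟨ regroup K C ⟩
        c 9 * (K * C)               ≡⟨ cong (c 9 *_) (proj₂ (proj₂ (hasKf-C C≢0))) ⟩
        c 9 * KC-value
          ≡⟨ cong₂ (λ C m → c 9 * ((c 2 * c n * ((c n - (pos 4 / 3) * S) + c 2 * C * (m - S)) - c n * c n) - c 2 * m *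
              C)) C≡S m≡ ⟩
        _                           ≡⟨ poly (c n) S ⟩
        _                           ≡⟨ cong (λ ρ → (c 8 * (c n * c n * c n) - (c 4 * ρ + c 17) * (c n * c n)) -
            ((c 4 * (ρ * ρ) - c 26 * ρ) - c 6) * c n - c 6 * ρ) ρ≡′ ⟨
        numerator ∎

  module Present (D₀≡false : D₀ ≡ false) where

    C≡1+S : C ≡ 1ℚ + S
    C≡1+S = cong (λ d → wt d + S) D₀≡false

    n-ρ≡1+3S : c n - ρ ≡ 1ℚ + c 3 * S
    n-ρ≡1+3S = trans n-ρ (cong (λ d → wt d + c 3 * S) D₀≡false)

    -- 11' adds 1 to n - r but 3 to 3C; the 2 makes up the difference.
    n-ρ+2≡3C : (c n - ρ) + c 2 ≡ c 3 * C
    n-ρ+2≡3C = trans (cong (_+ c 2) n-ρ≡1+3S) (trans (collect S) (cong (c 3 *_) (sym C≡1+S)))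
      where
      collect : ∀ S → (1ℚ + c 3 * S) + c 2 ≡ c 3 * (1ℚ + S)
      collect = solve-∀ ℚ-ring

    n-ρ+2≡ : c (live-count ℕ.+ 2) ≡ (c n - ρ) + c 2
    n-ρ+2≡ = trans (ℕ→ℚ-+ live-count 2) (cong (_+ c 2) n-ρ≡∸)

    0<live-count+2 : 0 ℕ.< live-count ℕ.+ 2
    0<live-count+2 = ℕP.m≤n⇒m≤n+o 2 0<live-count

    C≢0 : C ≢ 0ℚ
    C≢0 C≡0 = pos≢0 (live-count ℕ.+ 2) 0<live-count+2 (trans n-ρ+2≡ (trans n-ρ+2≡3C (cong (c 3 *_) C≡0)))

    numerator : ℚ
    numerator = (((c 8 * (c n * c n * c n) - (c 4 * ρ - c 3) * (c n * c n))
                   - ((c 4 * (ρ * ρ) - c 30 * ρ) + c 14) * c n) + c 12) - c 6 * ρ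

    denominator≢0 : c 3 * ((c n - ρ) + c 2) ≢ 0ℚ
    denominator≢0 eq = pos≢0 (3 ℕ.* (live-count ℕ.+ 2)) (ℕP.*-mono-≤ {1} {3} (ℕ.s≤s ℕ.z≤n) 0<live-count+2)
      (trans (ℕ→ℚ-* 3 (live-count ℕ.+ 2)) (trans (cong (c 3 *_) n-ρ+2≡) eq))

    hasKf : HasKf G (numerator ÷' (c 3 * ((c n - ρ) + c 2)))
    hasKf = subst (HasKf G) (÷'-unique K numerator _ denominator≢0 K*) (proj₁ (proj₂ (hasKf-C C≢0)))
      where
      open ≡-Reasoning
      K = proj₁ (hasKf-C C≢0)
      poly : ∀ n S → let ρ = n - (1ℚ + c 3 * S) in
        c 9 * ((c 2 * n * ((n - (pos 4 / 3) * S) + c 2 * (1ℚ + S) * ((n - 1ℚ) - S)) - n * n) - c 2 * (n - 1ℚ) * (1ℚ + S))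
        ≡ (((c 8 * (n * n * n) - (c 4 * ρ - c 3) * (n * n)) - ((c 4 * (ρ * ρ) - c 30 * ρ) + c 14) * n) + c 12) - c 6 * ρ
      poly = solve-∀ ℚ-ring
      regroup : ∀ K x → K * (c 3 * (c 3 * x)) ≡ c 9 * (K * x)
      regroup = solve-∀ ℚ-ring
      ρ≡′ : ρ ≡ c n - (1ℚ + c 3 * S)
      ρ≡′ = trans ρ≡ (cong (λ t → c n - t) (trans (sym n-ρ) n-ρ≡1+3S))
      K* : K * (c 3 * ((c n - ρ) + c 2)) ≡ numerator
      K* = begin
        K * (c 3 * ((c n - ρ) + c 2)) ≡⟨ cong (λ t → K * (c 3 * t)) n-ρ+2≡3C ⟩
        K * (c 3 * (c 3 * C))       ≡⟨ regroup K C ⟩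
        c 9 * (K * C)               ≡⟨ cong (c 9 *_) (proj₂ (proj₂ (hasKf-C C≢0))) ⟩
        c 9 * KC-value
          ≡⟨ cong₂ (λ C m → c 9 * ((c 2 * c n * ((c n - (pos 4 / 3) * S) + c 2 * C * (m - S)) - c n * c n) - c 2 * m *
              C)) C≡1+S m≡ ⟩
        _                           ≡⟨ poly (c n) S ⟩
        _                           ≡⟨ cong (λ ρ → (((c 8 * (c n * c n * c n) - (c 4 * ρ - c 3) * (c n * c n)) -
            ((c 4 * (ρ * ρ) - c 30 * ρ) + c 14) * c n) + c 12) - c 6 * ρ) ρ≡′ ⟨
        numerator ∎

-- Distances

live-index : ∀ {n} (D : Subset n) → ∣ D ∣ ℕ.< n → ∃ λ i → lookup D i ≡ false
live-index (false ∷ D) _         = zero , refl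
live-index (true ∷ D) (s≤s ∣D∣<n) with live-index D ∣D∣<n
... | i , Dᵢ = suc i , Dᵢ

module _ {A : Set} {R : A → A → Set} where
  _▷_ : ∀ {u v w a b} → Walk R u v a → Walk R v w b → Walk R u w (a ℕ.+ b)
  here     ▷ q = q
  step e p ▷ q = step e (p ▷ q)

  snoc : ∀ {u v w a} → Walk R u v a → R v w → Walk R u w (suc a)
  snoc here       e = step e here
  snoc (step f p) e = step f (snoc p e)

  reverse : (∀ {u v} → R u v → R v u) → ∀ {u v a} → Walk R u v a → Walk R v u a
  reverse R-sym here       = here
  reverse R-sym (step e p) = snoc (reverse R-sym p) (R-sym e)

  -- A function that drops by at most 1 along each edge bounds walk lengths from below. Applied to
  -- the claimed distance to v, it certifies that no walk is shorter.
  walk-length-≥ : (f : A → ℕ) → (∀ {u w} → R u w → f u ℕ.≤ suc (f w)) →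
                  ∀ {u v a} → Walk R u v a → f u ℕ.≤ a ℕ.+ f v
  walk-length-≥ f lip here       = ℕP.≤-refl
  walk-length-≥ f lip (step e p) = ℕP.≤-trans (lip e) (s≤s (walk-length-≥ f lip p))

all-concatMap : ∀ {A B : Set} {P : B → Set} (f : A → List B) → (∀ a → All P (f a)) → ∀ xs → All P (concatMap f xs)
all-concatMap f Pf []       = []
all-concatMap f Pf (x ∷ xs) = AllP.++⁺ (Pf x) (all-concatMap f Pf xs)

∈ˡ-concatMap : ∀ {A B : Set} (f : A → List B) {a xs b} → a ∈ˡ xs → b ∈ˡ f a → b ∈ˡ concatMap f xs
∈ˡ-concatMap f (here refl) b∈ = ∈-++⁺ˡ b∈
∈ˡ-concatMap f {xs = x ∷ _} (there a∈) b∈ = ∈-++⁺ʳ (f x) (∈ˡ-concatMap f a∈ b∈)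

module Edges {m : ℕ} (D : Subset (suc m)) where
  open Prism D

  -- A view of the edge list by kind, sound and complete, so that later proofs match on three
  -- constructors and not on list positions. A rung carries the proof that it survives.
  data IsEdge : V × V → Set where
    rimᵗ : ∀ j → IsEdge (top zero , top (suc j))
    rimᵇ : ∀ j → IsEdge (bot zero , bot (suc j))
    rungᵉ : ∀ i → lookup D i ≡ false → IsEdge (top i , bot i)

  all-rung : ∀ i → All IsEdge (rung i)
  all-rung i with lookup D i in eq
  ... | true  = []
  ... | false = rungᵉ i eq ∷ []

  edges-sound : All IsEdge (edges G)
  edges-sound = AllP.++⁺ (all-concatMap rimT (λ j → rimᵗ j ∷ []) (allFin m))
    (AllP.++⁺ (all-concatMap rimB (λ j → rimᵇ j ∷ []) (allFin m))
              (all-concatMap rung all-rung (allFin n)))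

  edges-complete : ∀ {e} → IsEdge e → e ∈ˡ edges G
  edges-complete (rimᵗ j) = ∈-++⁺ˡ (∈ˡ-concatMap rimT (∈-allFin j) (here refl))
  edges-complete (rimᵇ j) = ∈-++⁺ʳ es₁ (∈-++⁺ˡ (∈ˡ-concatMap rimB (∈-allFin j) (here refl)))
  edges-complete (rungᵉ i Dᵢ) = ∈-++⁺ʳ es₁ (∈-++⁺ʳ es₂ (∈ˡ-concatMap rung (∈-allFin i) here-rung))
    where
    here-rung : (top i , bot i) ∈ˡ rung i
    here-rung rewrite Dᵢ = here refl

  edge-sound : ∀ e → IsEdge (edge G e)
  edge-sound e = All.lookup edges-sound (∈-lookup e)

  adj : ∀ {u v} → IsEdge (u , v) → Adj G u v
  adj e = index (edges-complete e) , inj₁ (sym (AnyP.lookup-index (edges-complete e)))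

  Adj-sym : ∀ {u v} → Adj G u v → Adj G v u
  Adj-sym (e , inj₁ eq) = e , inj₂ eq
  Adj-sym (e , inj₂ eq) = e , inj₁ eq

-- Once the relevant Booleans are split, both sides are numerals and `True` evaluates to the unit
-- type, whose element is inferred.
le : ∀ {a b} {_ : True (a ℕ.≤? b)} → a ℕ.≤ b
le {_} {_} {t} = toWitness t

-- The first argument says whether the rung 11' is missing, the others whether the rungs at the leaves are.
leaf-leaf : Bool → Bool → Bool → ℕ
leaf-leaf a b c = if a ∧ (b ∧ c) then 5 else 3

twin : Bool → Bool → ℕ
twin a b = if b then leaf-leaf a b b else 1

centre-leaf : Bool → Bool → ℕ
centre-leaf a b = if a ∧ b then 4 else 2

centre-centre : Bool → ℕ
centre-centre a = if a then 3 else 1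

module Distance {m : ℕ} (D : Subset (suc m)) (∣D∣≤m : ∣ D ∣ ℕ.≤ m) where
  open Prism D
  open Edges D

  same cross : Fin n → Fin n → ℕ
  same zero    zero    = 0
  same zero    (suc j) = 1
  same (suc i) zero    = 1
  same (suc i) (suc j) = if does (i FinP.≟ j) then 0 else 2
  cross zero    zero    = centre-centre D₀
  cross zero    (suc j) = centre-leaf D₀ (dead j)
  cross (suc i) zero    = centre-leaf D₀ (dead i)
  cross (suc i) (suc j) = if does (i FinP.≟ j) then twin D₀ (dead j) else leaf-leaf D₀ (dead i) (dead j)

  open Blocks same cross cross same
    renaming (block to dist; block-TT to dTT; block-TB to dTB; block-BT to dBT; block-BB to dBB)
    hiding (rowT; rowB) public

  Near : ℕ → ℕ → Set
  Near a b = (a ℕ.≤ suc b) × (b ℕ.≤ suc a)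

  near-same : ∀ j k → Near (same zero k) (same (suc j) k)
  near-same j zero = le , le
  near-same j (suc k) with does (j FinP.≟ k)
  ... | true  = le , le
  ... | false = le , le

  near-cross : ∀ j k → Near (cross zero k) (cross (suc j) k)
  near-cross j zero with D₀ | dead j
  ... | true  | true  = le , le
  ... | true  | false = le , le
  ... | false | _     = le , le
  near-cross j (suc k) with does (j FinP.≟ k) | D₀ | dead j | dead k
  ... | true  | true  | _     | true  = le , le
  ... | true  | true  | _     | false = le , le
  ... | true  | false | _     | true  = le , le
  ... | true  | false | _     | false = le , le
  ... | false | true  | true  | true  = le , le
  ... | false | true  | true  | false = le , le
  ... | false | true  | false | true  = le , le
  ... | false | true  | false | false = le , le
  ... | false | false | _     | _     = le , le

  -- Survival of the rung is essential: a dead leaf has distance 0 to itself, while its twin is 3 or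
  -- 5 away.
  near-rung : ∀ i k → lookup D i ≡ false → Near (same i k) (cross i k)
  near-rung zero    zero    Dᵢ rewrite Dᵢ = le , le
  near-rung zero    (suc k) Dᵢ rewrite Dᵢ = le , le
  near-rung (suc i) zero    Dᵢ rewrite Dᵢ with D₀
  ... | true  = le , le
  ... | false = le , le
  near-rung (suc i) (suc k) Dᵢ with i FinP.≟ k
  ... | yes refl rewrite Dᵢ = le , le
  ... | no _ rewrite Dᵢ with D₀
  ...   | true  = le , le
  ...   | false = le , le

  near-edge : ∀ {a b} → IsEdge (a , b) → ∀ v → Near (dist a v) (dist b v)
  near-edge (rimᵗ j) = vertex-elim _
    (λ k → subst₂ Near (sym (dTT zero k)) (sym (dTT (suc j) k)) (near-same j k))
    (λ k → subst₂ Near (sym (dTB zero k)) (sym (dTB (suc j) k)) (near-cross j k))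
  near-edge (rimᵇ j) = vertex-elim _
    (λ k → subst₂ Near (sym (dBT zero k)) (sym (dBT (suc j) k)) (near-cross j k))
    (λ k → subst₂ Near (sym (dBB zero k)) (sym (dBB (suc j) k)) (near-same j k))
  near-edge (rungᵉ i Dᵢ) = vertex-elim _
    (λ k → subst₂ Near (sym (dTT i k)) (sym (dBT i k)) (near-rung i k Dᵢ))
    (λ k → subst₂ Near (sym (dTB i k)) (sym (dBB i k)) (near-sym (near-rung i k Dᵢ)))
    where
    near-sym : ∀ {a b} → Near a b → Near b a
    near-sym (p , q) = q , p

  lipschitz : ∀ v {u w} → Adj G u w → dist u v ℕ.≤ suc (dist w v)
  lipschitz v (e , inj₁ eq) = proj₁ (near-edge (subst IsEdge eq (edge-sound e)) v)
  lipschitz v (e , inj₂ eq) = proj₂ (near-edge (subst IsEdge eq (edge-sound e)) v)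

  same-refl : ∀ i → same i i ≡ 0
  same-refl zero = refl
  same-refl (suc i) rewrite dec-true (i FinP.≟ i) refl = refl

  dist-refl : ∀ v → dist v v ≡ 0
  dist-refl = vertex-elim _ (λ i → trans (dTT i i) (same-refl i)) (λ i → trans (dBB i i) (same-refl i))

  dist-≤ : ∀ {u v} ℓ → Walk (Adj G) u v ℓ → dist u v ℕ.≤ ℓ
  dist-≤ {u} {v} ℓ p = subst (dist u v ℕ.≤_) (trans (cong (ℓ ℕ.+_) (dist-refl v)) (ℕP.+-identityʳ ℓ))
                             (walk-length-≥ (λ w → dist w v) (lipschitz v) p)

  infixr 5 _◁_
  _◁_ : ∀ {u w v ℓ} → Adj G u w → Walk (Adj G) w v ℓ → Walk (Adj G) u v (suc ℓ)
  _◁_ = step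

  in-top : ∀ j → Adj G (top (suc j)) (top zero)
  in-top j = Adj-sym (adj (rimᵗ j))
  out-top : ∀ j → Adj G (top zero) (top (suc j))
  out-top j = adj (rimᵗ j)
  in-bot : ∀ j → Adj G (bot (suc j)) (bot zero)
  in-bot j = Adj-sym (adj (rimᵇ j))
  out-bot : ∀ j → Adj G (bot zero) (bot (suc j))
  out-bot j = adj (rimᵇ j)
  across : ∀ i → lookup D i ≡ false → Adj G (top i) (bot i)
  across i Dᵢ = adj (rungᵉ i Dᵢ)

  walk-TT : ∀ i j → Walk (Adj G) (top i) (top j) (same i j)
  walk-TT zero    zero    = here
  walk-TT zero    (suc j) = out-top j ◁ here
  walk-TT (suc i) zero    = in-top i ◁ here
  walk-TT (suc i) (suc j) with i FinP.≟ j
  ... | yes refl = here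
  ... | no _     = in-top i ◁ out-top j ◁ here

  walk-BB : ∀ i j → Walk (Adj G) (bot i) (bot j) (same i j)
  walk-BB zero    zero    = here
  walk-BB zero    (suc j) = out-bot j ◁ here
  walk-BB (suc i) zero    = in-bot i ◁ here
  walk-BB (suc i) (suc j) with i FinP.≟ j
  ... | yes refl = here
  ... | no _     = in-bot i ◁ out-bot j ◁ here

  -- The Boolean enters as a variable with an equation, so that matching on it computes the length
  -- while `D₀` keeps its form in the edges.
  walk-centres : ∀ {a} → D₀ ≡ a → Walk (Adj G) (top zero) (bot zero) (centre-centre a)
  walk-centres {false} D₀≡ = across zero D₀≡ ◁ here
  -- At most m of the n rungs are deleted, so one survives. As 11' is deleted it lies at a leaf,
  -- which gives the detour of length 3.
  walk-centres {true}  D₀≡ with live-index D (s≤s ∣D∣≤m)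
  ... | zero  , Dᵢ = ⊥-elim (true≢false (trans (sym D₀≡) Dᵢ))
    where
    true≢false : true ≢ false
    true≢false ()
  ... | suc ℓ , Dᵢ = out-top ℓ ◁ across (suc ℓ) Dᵢ ◁ in-bot ℓ ◁ here

  walk-centre-leaf : ∀ j {a b} → D₀ ≡ a → dead j ≡ b → Walk (Adj G) (top zero) (bot (suc j)) (centre-leaf a b)
  walk-centre-leaf j {false} D₀≡ _         = snoc (walk-centres D₀≡) (out-bot j)
  walk-centre-leaf j {true} {true} D₀≡ _   = snoc (walk-centres D₀≡) (out-bot j)
  walk-centre-leaf j {true} {false} D₀≡ Dⱼ = out-top j ◁ across (suc j) Dⱼ ◁ here

  walk-leaf-centre : ∀ i {a b} → D₀ ≡ a → dead i ≡ b → Walk (Adj G) (top (suc i)) (bot zero) (centre-leaf a b)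
  walk-leaf-centre i {false} D₀≡ _         = in-top i ◁ walk-centres D₀≡
  walk-leaf-centre i {true} {true} D₀≡ _   = in-top i ◁ walk-centres D₀≡
  walk-leaf-centre i {true} {false} D₀≡ Dᵢ = across (suc i) Dᵢ ◁ in-bot i ◁ here

  walk-via-centres : ∀ i j {a} → D₀ ≡ a → Walk (Adj G) (top (suc i)) (bot (suc j)) (2 ℕ.+ centre-centre a)
  walk-via-centres i j D₀≡ = in-top i ◁ snoc (walk-centres D₀≡) (out-bot j)

  walk-leaf-leaf : ∀ i j {a b c} → D₀ ≡ a → dead i ≡ b → dead j ≡ c →
                   Walk (Adj G) (top (suc i)) (bot (suc j)) (leaf-leaf a b c)
  walk-leaf-leaf i j {false} D₀≡ _ _                = walk-via-centres i j D₀≡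
  walk-leaf-leaf i j {true} {true} {true} D₀≡ _ _   = walk-via-centres i j D₀≡
  walk-leaf-leaf i j {true} {true} {false} D₀≡ _ Dⱼ = in-top i ◁ out-top j ◁ across (suc j) Dⱼ ◁ here
  walk-leaf-leaf i j {true} {false} D₀≡ Dᵢ _        = across (suc i) Dᵢ ◁ in-bot i ◁ out-bot j ◁ here

  walk-twin : ∀ j {a b} → D₀ ≡ a → dead j ≡ b → Walk (Adj G) (top (suc j)) (bot (suc j)) (twin a b)
  walk-twin j {b = false} _  Dⱼ = across (suc j) Dⱼ ◁ here
  walk-twin j {b = true} D₀≡ Dⱼ = walk-leaf-leaf j j D₀≡ Dⱼ Dⱼ

  walk-TB : ∀ i j → Walk (Adj G) (top i) (bot j) (cross i j)
  walk-TB zero    zero    = walk-centres refl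
  walk-TB zero    (suc j) = walk-centre-leaf j refl refl
  walk-TB (suc i) zero    = walk-leaf-centre i refl refl
  walk-TB (suc i) (suc j) with i FinP.≟ j
  ... | yes refl = walk-twin j refl refl
  ... | no _     = walk-leaf-leaf i j refl refl refl

  leaf-leaf-comm : ∀ a b c → leaf-leaf a b c ≡ leaf-leaf a c b
  leaf-leaf-comm a b c = cong (λ t → if a ∧ t then 5 else 3) (BoolP.∧-comm b c)

  same-sym : ∀ i j → same i j ≡ same j i
  same-sym zero    zero    = refl
  same-sym zero    (suc j) = refl
  same-sym (suc i) zero    = refl
  same-sym (suc i) (suc j) with i FinP.≟ j
  ... | yes refl rewrite dec-true (i FinP.≟ i) refl = refl
  ... | no i≢j rewrite dec-false (j FinP.≟ i) (i≢j ∘ sym) = refl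

  cross-sym : ∀ i j → cross i j ≡ cross j i
  cross-sym zero    zero    = refl
  cross-sym zero    (suc j) = refl
  cross-sym (suc i) zero    = refl
  cross-sym (suc i) (suc j) with i FinP.≟ j
  ... | yes refl rewrite dec-true (i FinP.≟ i) refl = refl
  ... | no i≢j rewrite dec-false (j FinP.≟ i) (i≢j ∘ sym) = leaf-leaf-comm D₀ (dead i) (dead j)

  dist-sym : ∀ u v → dist u v ≡ dist v u
  dist-sym = vertex-elim _
    (λ i → vertex-elim _ (λ j → trans (dTT i j) (trans (same-sym i j) (sym (dTT j i))))
                         (λ j → trans (dTB i j) (trans (cross-sym i j) (sym (dBT j i)))))
    (λ i → vertex-elim _ (λ j → trans (dBT i j) (trans (cross-sym i j) (sym (dTB j i))))
                         (λ j → trans (dBB i j) (trans (same-sym i j) (sym (dBB j i)))))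

  walk-dist : ∀ u v → Walk (Adj G) u v (dist u v)
  walk-dist = vertex-elim _
    (λ i → vertex-elim _ (λ j → subst (Walk _ _ _) (sym (dTT i j)) (walk-TT i j))
                         (λ j → subst (Walk _ _ _) (sym (dTB i j)) (walk-TB i j)))
    (λ i → vertex-elim _ (λ j → subst (Walk _ _ _) (trans (cross-sym j i) (sym (dBT i j))) (reverse Adj-sym (walk-TB j i)))
                         (λ j → subst (Walk _ _ _) (sym (dBB i j)) (walk-BB i j)))

  isDist : ∀ u v → IsDist G u v (dist u v)
  isDist u v = walk-dist u v , dist-≤

-- The Wiener index

ℕ→ℚ-if : ∀ b x → ℕ→ℚ (if b then x else 0) ≡ (if b then ℕ→ℚ x else 0ℚ)
ℕ→ℚ-if true  x = refl
ℕ→ℚ-if false x = refl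

ℕ→ℚ-foldr : ∀ {A : Set} (f : A → ℕ) (g : A → ℚ) → (∀ a → ℕ→ℚ (f a) ≡ g a) → ∀ xs →
  ℕ→ℚ (foldr (λ i acc → f i ℕ.+ acc) 0 xs) ≡ lsum g xs
ℕ→ℚ-foldr f g f≡g []       = refl
ℕ→ℚ-foldr f g f≡g (x ∷ xs) = trans (ℕ→ℚ-+ (f x) _) (cong₂ _+_ (f≡g x) (ℕ→ℚ-foldr f g f≡g xs))

ℕ→ℚ-sumPairsℕ : ∀ {n} (d : Fin n → Fin n → ℕ) →
  ℕ→ℚ (sumPairsℕ d) ≡ sumPairs (λ i j → ℕ→ℚ (d i j))
ℕ→ℚ-sumPairsℕ {n} d = ℕ→ℚ-foldr _ (λ i → sumFin (upper (λ i j → ℕ→ℚ (d i j)) i))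
  (λ i → ℕ→ℚ-foldr _ (upper (λ i j → ℕ→ℚ (d i j)) i) (λ j → ℕ→ℚ-if (does (i FinP.<? j)) (d i j)) (allFin n)) (allFin n)

-- Indicator of a deleted rung, complementary to `wt`. Distances exceed those of the full prism only
-- through missing rungs, so they are polynomials in these indicators.
zt : Bool → ℚ
zt d = if d then 1ℚ else 0ℚ

∑-zt : ∀ {n} (D : Subset n) → sum (λ i → zt (lookup D i)) ≡ ℕ→ℚ ∣ D ∣
∑-zt []          = refl
∑-zt (true ∷ D)  = trans (cong (1ℚ +_) (∑-zt D)) (sym (ℕ→ℚ-+ 1 ∣ D ∣))
∑-zt (false ∷ D) = trans (ℚP.+-identityˡ _) (∑-zt D)

∑-affine : ∀ {n} a b (f : Fin n → ℚ) → sum (λ j → a + b * f j) ≡ ℕ→ℚ n * a + b * sum f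
∑-affine {n} a b f = trans (∑-distrib-+ (λ _ → a) (λ j → b * f j)) (cong₂ _+_ (∑-const n a) (sym (*-distribˡ-sum b f)))

module Wiener {m : ℕ} (D : Subset (suc m)) (∣D∣≤m : ∣ D ∣ ℕ.≤ m) where
  open Prism D
  open Distance D ∣D∣≤m
  private c = ℕ→ℚ

  wiener : ℕ
  wiener = sumPairsℕ dist

  hasWiener : HasWiener G wiener
  hasWiener = dist , isDist , refl

  z : Fin m → ℚ
  z j = zt (dead j)
  Z z₀ : ℚ
  Z  = sum z
  z₀ = zt D₀

  centre-centre-value : ∀ a → c (centre-centre a) ≡ 1ℚ + c 2 * zt a
  centre-centre-value true  = refl
  centre-centre-value false = refl

  centre-leaf-value : ∀ a b → c (centre-leaf a b) ≡ c 2 + (c 2 * zt a) * zt b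
  centre-leaf-value true  true  = refl
  centre-leaf-value true  false = refl
  centre-leaf-value false true  = refl
  centre-leaf-value false false = refl

  leaf-leaf-value : ∀ a b d → c (leaf-leaf a b d) ≡ (c 3 + (c 2 * zt a * zt b) * zt d) + 0ℚ * (c 2 * zt d - c 2)
  leaf-leaf-value true  true  true  = refl
  leaf-leaf-value true  true  false = refl
  leaf-leaf-value true  false true  = refl
  leaf-leaf-value true  false false = refl
  leaf-leaf-value false true  true  = refl
  leaf-leaf-value false true  false = refl
  leaf-leaf-value false false true  = refl
  leaf-leaf-value false false false = refl

  -- The factor `1ℚ` here and `0ℚ` in `leaf-leaf-value` are the two values of `δ i j`. The
  -- correction is -2 for a live pair, at distance 1 and not 3, and 0 for a dead one.
  twin-value : ∀ a d → c (twin a d) ≡ (c 3 + (c 2 * zt a * zt d) * zt d) + 1ℚ * (c 2 * zt d - c 2)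
  twin-value true  true  = refl
  twin-value true  false = refl
  twin-value false true  = refl
  twin-value false false = refl

  cross-leaf-value : ∀ i j → c (cross (suc i) (suc j)) ≡ (c 3 + (c 2 * z₀ * z i) * z j) + δ i j * (c 2 * z j - c 2)
  cross-leaf-value i j with i FinP.≟ j
  ... | yes refl = twin-value D₀ (dead i)
  ... | no _     = leaf-leaf-value D₀ (dead i) (dead j)

  same-leaf-value : ∀ i j → c (same (suc i) (suc j)) ≡ c 2 + (- c 2) * (δ i j * 1ℚ)
  same-leaf-value i j with i FinP.≟ j
  ... | yes refl = refl
  ... | no _     = refl

  ∑-same : sum (λ i → sum λ j → c (same i j)) ≡ c 2 * (c m * c m)
  ∑-same = begin
    (0ℚ + sum {m} (λ _ → 1ℚ)) + sum (λ i → 1ℚ + sum (λ j → c (same (suc i) (suc j))))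
      ≡⟨ cong₂ (λ u v → (0ℚ + u) + v) (∑-const m 1ℚ) (sum-cong-≗ row) ⟩
    (0ℚ + c m * 1ℚ) + sum {m} (λ i → 1ℚ + (c m * c 2 + (- c 2) * 1ℚ))
      ≡⟨ cong ((0ℚ + c m * 1ℚ) +_) (∑-const m _) ⟩
    (0ℚ + c m * 1ℚ) + c m * (1ℚ + (c m * c 2 + (- c 2) * 1ℚ)) ≡⟨ collect (c m) ⟩
    c 2 * (c m * c m) ∎
    where
    open ≡-Reasoning
    row : ∀ i → 1ℚ + sum (λ j → c (same (suc i) (suc j))) ≡ 1ℚ + (c m * c 2 + (- c 2) * 1ℚ)
    row i = cong (1ℚ +_) (trans (sum-cong-≗ (same-leaf-value i))
        (trans (∑-affine (c 2) (- c 2) (λ j → δ i j * 1ℚ)) (cong (λ t → c m * c 2 + (- c 2) * t) (∑-δ i (λ _ → 1ℚ)))))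
    collect : ∀ x → (0ℚ + x * 1ℚ) + x * (1ℚ + (x * c 2 + (- c 2) * 1ℚ)) ≡ c 2 * (x * x)
    collect = solve-∀ ℚ-ring

  -- Centre to centre, centre to leaf in either order, and leaf to leaf.
  crossSum : ℚ
  crossSum = ((1ℚ + c 2 * z₀) + c 2 * (c m * c 2 + (c 2 * z₀) * Z)) + (c m * (c m * c 3 - c 2) + (c 2 * z₀ * Z + c 2) * Z)

  ∑-cross : sum (λ i → sum λ j → c (cross i j)) ≡ crossSum
  ∑-cross = begin
    (c (centre-centre D₀) + sum (λ j → c (centre-leaf D₀ (dead j)))) + sum
        (λ i → c (centre-leaf D₀ (dead i)) + sum (λ j → c (cross (suc i) (suc j))))
      ≡⟨ cong₂ _+_ (cong₂ _+_ (centre-centre-value D₀) firstRow) (sum-cong-≗ row) ⟩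
    ((1ℚ + c 2 * z₀) + (c m * c 2 + (c 2 * z₀) * Z)) + sum
        (λ i → (c 2 + (c m * c 3 - c 2)) + (c 2 * z₀ + (c 2 * z₀ * Z + c 2)) * z i)
      ≡⟨ cong (((1ℚ + c 2 * z₀) + (c m * c 2 + (c 2 * z₀) * Z)) +_)
          (∑-affine (c 2 + (c m * c 3 - c 2)) (c 2 * z₀ + (c 2 * z₀ * Z + c 2)) z) ⟩
    ((1ℚ + c 2 * z₀) + (c m * c 2 + (c 2 * z₀) * Z)) + (c m * (c 2 + (c m * c 3 - c 2)) +
        (c 2 * z₀ + (c 2 * z₀ * Z + c 2)) * Z)
      ≡⟨ collect (c m) z₀ Z ⟩
    crossSum ∎
    where
    open ≡-Reasoning
    firstRow : sum (λ j → c (centre-leaf D₀ (dead j))) ≡ c m * c 2 + (c 2 * z₀) * Z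
    firstRow = trans (sum-cong-≗ (λ j → centre-leaf-value D₀ (dead j))) (∑-affine (c 2) (c 2 * z₀) z)
    regroup : ∀ m z₀ Z zi → (c 2 + (c 2 * z₀) * zi) + ((m * c 3 + (c 2 * z₀ * zi) * Z) + (c 2 * zi - c 2))
                           ≡ (c 2 + (m * c 3 - c 2)) + (c 2 * z₀ + (c 2 * z₀ * Z + c 2)) * zi
    regroup = solve-∀ ℚ-ring
    row : ∀ i → c (centre-leaf D₀ (dead i)) + sum (λ j → c (cross (suc i) (suc j))) ≡ (c 2 + (c m * c 3 - c 2)) +
        (c 2 * z₀ + (c 2 * z₀ * Z + c 2)) * z i
    row i = begin
      c (centre-leaf D₀ (dead i)) + sum (λ j → c (cross (suc i) (suc j)))
        ≡⟨ cong₂ _+_ (centre-leaf-value D₀ (dead i)) (sum-cong-≗ (cross-leaf-value i)) ⟩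
      (c 2 + (c 2 * z₀) * z i) + sum (λ j → (c 3 + (c 2 * z₀ * z i) * z j) + δ i j * (c 2 * z j - c 2))
        ≡⟨ cong ((c 2 + (c 2 * z₀) * z i) +_) (trans (∑-distrib-+ (λ j → c 3 + (c 2 * z₀ * z i) * z j)
            (λ j → δ i j * (c 2 * z j - c 2)))
             (cong₂ _+_ (∑-affine (c 3) (c 2 * z₀ * z i) z) (∑-δ i (λ j → c 2 * z j - c 2)))) ⟩
      (c 2 + (c 2 * z₀) * z i) + ((c m * c 3 + (c 2 * z₀ * z i) * Z) + (c 2 * z i - c 2)) ≡⟨ regroup (c m) z₀ Z (z i) ⟩
      _ ∎
    collect : ∀ m z₀ Z → ((1ℚ + c 2 * z₀) + (m * c 2 + (c 2 * z₀) * Z)) +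
        (m * (c 2 + (m * c 3 - c 2)) + (c 2 * z₀ + (c 2 * z₀ * Z + c 2)) * Z)
      ≡ ((1ℚ + c 2 * z₀) + c 2 * (m * c 2 + (c 2 * z₀) * Z)) + (m * (m * c 3 - c 2) + (c 2 * z₀ * Z + c 2) * Z)
    collect = solve-∀ ℚ-ring

  2*wiener : c 2 * c wiener ≡ c 2 * (c 2 * (c m * c m) + crossSum)
  2*wiener = begin
    c 2 * c wiener ≡⟨ cong (c 2 *_) (ℕ→ℚ-sumPairsℕ dist) ⟩
    c 2 * sumPairs (λ u v → c (dist u v)) ≡⟨ double-sumPairs (λ u v → c (dist u v)) (λ u → cong c (dist-refl u))
        (λ u v → cong c (dist-sym u v)) ⟩
    sum (λ u → sum λ v → c (dist u v)) ≡⟨ ∑-↑ n (λ u → sum λ v → c (dist u v)) ⟩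
    sum (λ i → sum λ v → c (dist (top i) v)) + sum (λ i → sum λ v → c (dist (bot i) v))
      ≡⟨ cong₂ _+_ (sum-cong-≗ rowT) (sum-cong-≗ rowB) ⟩
    sum (λ i → sum (λ j → c (same i j)) + sum (λ j → c (cross i j))) + sum
        (λ i → sum (λ j → c (cross i j)) + sum (λ j → c (same i j)))
      ≡⟨ cong₂ _+_ (∑-distrib-+ (λ i → sum λ j → c (same i j)) (λ i → sum λ j → c (cross i j)))
          (∑-distrib-+ (λ i → sum λ j → c (cross i j)) (λ i → sum λ j → c (same i j))) ⟩
    (sum (λ i → sum λ j → c (same i j)) + sum (λ i → sum λ j → c (cross i j))) +
        (sum (λ i → sum λ j → c (cross i j)) + sum (λ i → sum λ j → c (same i j)))
      ≡⟨ cong₂ (λ u v → (u + v) + (v + u)) ∑-same ∑-cross ⟩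
    (A + crossSum) + (crossSum + A) ≡⟨ collect A crossSum ⟩
    c 2 * (A + crossSum) ∎
    where
    open ≡-Reasoning
    A = c 2 * (c m * c m)
    collect : ∀ a b → (a + b) + (b + a) ≡ c 2 * (a + b)
    collect = solve-∀ ℚ-ring
    rowT : ∀ i → (sum λ v → c (dist (top i) v)) ≡ sum (λ j → c (same i j)) + sum (λ j → c (cross i j))
    rowT i = trans (∑-↑ n (λ v → c (dist (top i) v))) (cong₂ _+_ (sum-cong-≗ (λ j → cong c (dTT i j)))
        (sum-cong-≗ (λ j → cong c (dTB i j))))
    rowB : ∀ i → (sum λ v → c (dist (bot i) v)) ≡ sum (λ j → c (cross i j)) + sum (λ j → c (same i j))
    rowB i = trans (∑-↑ n (λ v → c (dist (bot i) v))) (cong₂ _+_ (sum-cong-≗ (λ j → cong c (dBT i j)))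
        (sum-cong-≗ (λ j → cong c (dBB i j))))

  wiener-value : c wiener ≡ ((c 5 * (c m * c m) + c 2 * c m) + (c 2 * Z + 1ℚ)) + z₀ * ((c 2 + c 4 * Z) + c 2 * (Z * Z))
  wiener-value = trans (2*-cancel (c wiener) (c 2 * (c m * c m) + crossSum) 2*wiener) (collect (c m) z₀ Z)
    where
    collect : ∀ m z₀ Z → c 2 * (m * m) + (((1ℚ + c 2 * z₀) + c 2 * (m * c 2 + (c 2 * z₀) * Z)) +
        (m * (m * c 3 - c 2) + (c 2 * z₀ * Z + c 2) * Z))
      ≡ ((c 5 * (m * m) + c 2 * m) + (c 2 * Z + 1ℚ)) + z₀ * ((c 2 + c 4 * Z) + c 2 * (Z * Z))
    collect = solve-∀ ℚ-ring

-- The limit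

private c = ℕ→ℚ

-- The denominator of ε serves as q: then ε q is the numerator, which is at least 1.
archimedean : ∀ ε → 0ℚ ℚ.< ε → ∃ λ q → 1ℚ ℚ.≤ ε * c q
archimedean ε@(mkℚ (pos (suc p)) q-1 _) _ = suc q-1 , ℚP.toℚᵘ-cancel-≤ (begin
  ℚ.toℚᵘ 1ℚ                               ≤⟨ ℚᵘ.*≤* (ℤ.+≤+ bound) ⟩
  ℚ.toℚᵘ ε ℚᵘ.* (pos (suc q-1) ℚᵘ./ 1)    ≃⟨ ℚᵘP.*-congˡ {ℚ.toℚᵘ ε} (ℕ→ℚᵘ (suc q-1)) ⟨
  ℚ.toℚᵘ ε ℚᵘ.* ℚ.toℚᵘ (c (suc q-1))      ≃⟨ ℚP.toℚᵘ-homo-* ε (c (suc q-1)) ⟨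
  ℚ.toℚᵘ (ε * c (suc q-1))                ∎)
  where
  open ℚᵘP.≤-Reasoning
  bound : suc q-1 ℕ.* 1 ℕ.+ 0 ℕ.≤ (suc p ℕ.* suc q-1) ℕ.* 1
  bound = ℕP.≤-trans (ℕP.≤-reflexive (ℕP.+-identityʳ (suc q-1 ℕ.* 1))) (ℕP.*-monoˡ-≤ 1 (ℕP.m≤m+n (suc q-1) (p ℕ.* suc q-1)))
archimedean (mkℚ (pos zero) _ _) 0<ε with ℚ.positive 0<ε
... | ()
archimedean (mkℚ (negsuc _) _ _) 0<ε with ℚ.positive 0<ε
... | ()

ℕ→ℚ-minus-≤ : ∀ {a t} b → a ℕ.≤ t → c a - c b ℚ.≤ c t
ℕ→ℚ-minus-≤ {a} {t} b a≤t = subst (c a - c b ℚ.≤_) (ℚP.+-identityʳ (c t))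
  (ℚP.+-mono-≤ (ℕ→ℚ-mono-≤ a≤t) (ℚP.neg-antimono-≤ (ℕ→ℚ-mono-≤ {0} {b} z≤n)))

∣-∣-≤ : ∀ {a b t} → a ℕ.≤ t → b ℕ.≤ t → ℚ.∣ c a - c b ∣ ℚ.≤ c t
∣-∣-≤ {a} {b} {t} a≤t b≤t with ℚP.∣p∣≡p∨∣p∣≡-p (c a - c b)
... | inj₁ eq = subst (ℚ._≤ c t) (sym eq) (ℕ→ℚ-minus-≤ {a} b a≤t)
... | inj₂ eq = subst (ℚ._≤ c t) (sym (trans eq (flip (c a) (c b)))) (ℕ→ℚ-minus-≤ {b} a b≤t)
  where
  flip : ∀ x y → - (x - y) ≡ y - x
  flip = solve-∀ ℚ-ring

-- The squeeze |x| Q = |E - k²| ≤ B k² < ε k³ ≤ ε Q. As E and k² are naturals up to B k², so is the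
-- absolute value of their difference.
∣∣<ε : ∀ x Q E B k ε → x * c Q ≡ c E - c (k ℕ.* k) → E ℕ.≤ B ℕ.* (k ℕ.* k) → k ℕ.* k ℕ.≤ B ℕ.* (k ℕ.* k) →
  k ℕ.* (k ℕ.* k) ℕ.≤ Q → 0 ℕ.< k → 0ℚ ℚ.< ε → c B ℚ.< ε * c k → ℚ.∣ x ∣ ℚ.< ε
∣∣<ε x Q E B k ε xQ≡ E≤ kk≤ k³≤Q 0<k 0<ε B<εk = ℚP.*-cancelʳ-<-nonNeg (c Q) (begin-strict
  ℚ.∣ x ∣ * c Q               ≡⟨ cong (ℚ.∣ x ∣ *_) (ℚP.0≤p⇒∣p∣≡p 0≤Q) ⟨
  ℚ.∣ x ∣ * ℚ.∣ c Q ∣         ≡⟨ ℚP.∣p*q∣≡∣p∣*∣q∣ x (c Q) ⟨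
  ℚ.∣ x * c Q ∣               ≡⟨ cong ℚ.∣_∣ xQ≡ ⟩
  ℚ.∣ c E - c (k ℕ.* k) ∣     ≤⟨ ∣-∣-≤ E≤ kk≤ ⟩
  c (B ℕ.* (k ℕ.* k))         ≡⟨ ℕ→ℚ-* B (k ℕ.* k) ⟩
  c B * c (k ℕ.* k)           <⟨ ℚP.*-monoˡ-<-pos (c (k ℕ.* k)) {{0<kk}} B<εk ⟩
  ε * c k * c (k ℕ.* k)       ≡⟨ ℚP.*-assoc ε (c k) (c (k ℕ.* k)) ⟩
  ε * (c k * c (k ℕ.* k))     ≡⟨ cong (ε *_) (ℕ→ℚ-* k (k ℕ.* k)) ⟨
  ε * c (k ℕ.* (k ℕ.* k))     ≤⟨ ℚP.*-monoˡ-≤-nonNeg ε {{ℚ.nonNegative (ℚP.<⇒≤ 0<ε)}} (ℕ→ℚ-mono-≤ k³≤Q) ⟩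
  ε * c Q                     ∎)
  where
  open ℚP.≤-Reasoning
  0≤Q : 0ℚ ℚ.≤ c Q
  0≤Q = ℕ→ℚ-mono-≤ {0} {Q} z≤n
  instance
    _ = ℚ.nonNegative 0≤Q
  0<kk = ℚ.positive (ℕ→ℚ-mono-< {0} {k ℕ.* k} (ℕP.*-mono-≤ 0<k 0<k))

infixl 6 _⊕_
infixl 7 _⊗_

-- Reified polynomials have two readings: over `ℕ`, where coefficients are compared by monotonicity,
-- and over `ℚ`, where the ring solver proves identities. Monotonicity requires that there be no
-- subtraction; adding k² to 45 C Kf - 24 C W removes the single negative term, its coefficient of
-- k² being 20d - 1.
data Poly₂ : Set where
  # : ℕ → Poly₂
  𝕜 𝕕 : Poly₂
  _⊕_ _⊗_ : Poly₂ → Poly₂ → Poly₂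

module _ (k d : ℕ) where
  ⟦_⟧ : Poly₂ → ℕ
  ⟦ # a ⟧   = a
  ⟦ 𝕜 ⟧     = k
  ⟦ 𝕕 ⟧     = d
  ⟦ p ⊕ q ⟧ = ⟦ p ⟧ ℕ.+ ⟦ q ⟧
  ⟦ p ⊗ q ⟧ = ⟦ p ⟧ ℕ.* ⟦ q ⟧

  ⟦_⟧ℚ : Poly₂ → ℚ
  ⟦ # a ⟧ℚ   = c a
  ⟦ 𝕜 ⟧ℚ     = c k
  ⟦ 𝕕 ⟧ℚ     = c d
  ⟦ p ⊕ q ⟧ℚ = ⟦ p ⟧ℚ + ⟦ q ⟧ℚ
  ⟦ p ⊗ q ⟧ℚ = ⟦ p ⟧ℚ * ⟦ q ⟧ℚ

  ℕ→ℚ-⟦⟧ : ∀ p → c ⟦ p ⟧ ≡ ⟦ p ⟧ℚ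
  ℕ→ℚ-⟦⟧ (# a)   = refl
  ℕ→ℚ-⟦⟧ 𝕜       = refl
  ℕ→ℚ-⟦⟧ 𝕕       = refl
  ℕ→ℚ-⟦⟧ (p ⊕ q) = trans (ℕ→ℚ-+ ⟦ p ⟧ ⟦ q ⟧) (cong₂ _+_ (ℕ→ℚ-⟦⟧ p) (ℕ→ℚ-⟦⟧ q))
  ℕ→ℚ-⟦⟧ (p ⊗ q) = trans (ℕ→ℚ-* ⟦ p ⟧ ⟦ q ⟧) (cong₂ _*_ (ℕ→ℚ-⟦⟧ p) (ℕ→ℚ-⟦⟧ q))

quadratic : Poly₂ → Poly₂ → Poly₂ → Poly₂
quadratic a₂ a₁ a₀ = a₂ ⊗ (𝕜 ⊗ 𝕜) ⊕ a₁ ⊗ 𝕜 ⊕ a₀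

quadratic-≤ : ∀ {k} a₂ a₁ a₀ b₂ b₁ b₀ → 0 ℕ.< k → a₂ ℕ.≤ b₂ → a₁ ℕ.≤ b₁ → a₀ ℕ.≤ b₀ →
  a₂ ℕ.* (k ℕ.* k) ℕ.+ a₁ ℕ.* k ℕ.+ a₀ ℕ.≤ (b₂ ℕ.+ b₁ ℕ.+ b₀) ℕ.* (k ℕ.* k)
quadratic-≤ {k@(suc _)} a₂ a₁ a₀ b₂ b₁ b₀ _ a₂≤ a₁≤ a₀≤ = begin
  a₂ ℕ.* (k ℕ.* k) ℕ.+ a₁ ℕ.* k ℕ.+ a₀
    ≤⟨ ℕP.+-mono-≤ (ℕP.+-mono-≤ (ℕP.*-monoˡ-≤ (k ℕ.* k) a₂≤) (ℕP.*-mono-≤ a₁≤ (ℕP.m≤m*n k k)))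
        (ℕP.≤-trans a₀≤ (ℕP.m≤m*n b₀ (k ℕ.* k))) ⟩
  b₂ ℕ.* (k ℕ.* k) ℕ.+ b₁ ℕ.* (k ℕ.* k) ℕ.+ b₀ ℕ.* (k ℕ.* k)
    ≡⟨ cong (ℕ._+ b₀ ℕ.* (k ℕ.* k)) (ℕP.*-distribʳ-+ (k ℕ.* k) b₂ b₁) ⟨
  (b₂ ℕ.+ b₁) ℕ.* (k ℕ.* k) ℕ.+ b₀ ℕ.* (k ℕ.* k) ≡⟨ ℕP.*-distribʳ-+ (k ℕ.* k) (b₂ ℕ.+ b₁) b₀ ⟨
  (b₂ ℕ.+ b₁ ℕ.+ b₀) ℕ.* (k ℕ.* k) ∎
  where open ℕP.≤-Reasoning

-- Coefficients of 45 C Kf - 24 C W + k² as a polynomial in k; the primed ones are for 11' present.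
coeff₂ coeff₁ coeff₁′ coeff₀ coeff₀′ : Poly₂
coeff₂  = # 20 ⊗ 𝕕
coeff₁  = # 4 ⊗ (𝕕 ⊗ 𝕕) ⊕ # 16 ⊗ 𝕕 ⊕ # 26
coeff₁′ = # 20 ⊗ (𝕕 ⊗ 𝕕) ⊕ # 108 ⊗ 𝕕 ⊕ # 24
coeff₀  = # 45 ⊗ (𝕕 ⊗ 𝕕) ⊕ # 90 ⊗ 𝕕 ⊕ # 45
coeff₀′ = # 105 ⊗ (𝕕 ⊗ 𝕕) ⊕ # 84 ⊗ 𝕕 ⊕ # 21

⟦⟧-mono : ∀ {d r} → d ℕ.≤ r → ∀ p → ⟦_⟧ 0 d p ℕ.≤ ⟦_⟧ 0 r p
⟦⟧-mono d≤r (# a)   = ℕP.≤-refl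
⟦⟧-mono d≤r 𝕜       = ℕP.≤-refl
⟦⟧-mono d≤r 𝕕       = d≤r
⟦⟧-mono d≤r (p ⊕ q) = ℕP.+-mono-≤ (⟦⟧-mono d≤r p) (⟦⟧-mono d≤r q)
⟦⟧-mono d≤r (p ⊗ q) = ℕP.*-mono-≤ (⟦⟧-mono d≤r p) (⟦⟧-mono d≤r q)

-- As d is r or r - 1, the coefficients at d are at most those at r. Adding both versions gives one
-- bound for both cases, so M depends on r and ε alone. The coefficients do not contain `𝕜`, which
-- is evaluated at 0.
bound : ℕ → ℕ
bound r = ⟦_⟧ 0 r coeff₂ ℕ.+ (⟦_⟧ 0 r coeff₁ ℕ.+ ⟦_⟧ 0 r coeff₁′) ℕ.+ (⟦_⟧ 0 r coeff₀ ℕ.+ ⟦_⟧ 0 r coeff₀′)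

0<bound : ∀ r → 0 ℕ.< bound r
0<bound r = ℕP.≤-trans (ℕP.≤-trans (s≤s z≤n) (ℕP.m≤n+m 45 (45 ℕ.* (r ℕ.* r) ℕ.+ 90 ℕ.* r)))
  (ℕP.≤-trans (ℕP.m≤m+n _ (⟦_⟧ 0 r coeff₀′)) (ℕP.m≤n+m _ (⟦_⟧ 0 r coeff₂ ℕ.+ (⟦_⟧ 0 r coeff₁ ℕ.+ ⟦_⟧ 0 r coeff₁′))))

wienerPoly wienerPoly′ : Poly₂
wienerPoly  = (# 5 ⊗ ((𝕜 ⊕ 𝕕) ⊗ (𝕜 ⊕ 𝕕)) ⊕ # 2 ⊗ (𝕜 ⊕ 𝕕)) ⊕ (# 2 ⊗ 𝕕 ⊕ # 1) ⊕ ((# 2 ⊕ # 4 ⊗ 𝕕) ⊕ # 2 ⊗ (𝕕 ⊗ 𝕕))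
wienerPoly′ = (# 5 ⊗ ((𝕜 ⊕ 𝕕) ⊗ (𝕜 ⊕ 𝕕)) ⊕ # 2 ⊗ (𝕜 ⊕ 𝕕)) ⊕ (# 2 ⊗ 𝕕 ⊕ # 1)

k*k≤ : ∀ k d x → k ℕ.* k ℕ.≤ (5 ℕ.* ((k ℕ.+ d) ℕ.* (k ℕ.+ d)) ℕ.+ 2 ℕ.* (k ℕ.+ d)) ℕ.+ x
k*k≤ k d x = begin
  k ℕ.* k                          ≤⟨ ℕP.*-mono-≤ (ℕP.m≤m+n k d) (ℕP.m≤m+n k d) ⟩
  (k ℕ.+ d) ℕ.* (k ℕ.+ d)          ≤⟨ ℕP.m≤n*m _ 5 ⟩
  5 ℕ.* ((k ℕ.+ d) ℕ.* (k ℕ.+ d))  ≤⟨ ℕP.m≤m+n _ (2 ℕ.* (k ℕ.+ d)) ⟩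
  _                                ≤⟨ ℕP.m≤m+n _ x ⟩
  _                                ∎
  where open ℕP.≤-Reasoning

kSq≤W : ∀ k d → k ℕ.* k ℕ.≤ ⟦_⟧ k d wienerPoly
kSq≤W k d = ℕP.≤-trans (k*k≤ k d _) (ℕP.m≤m+n _ _)

kSq≤W′ : ∀ k d → k ℕ.* k ℕ.≤ ⟦_⟧ k d wienerPoly′
kSq≤W′ k d = k*k≤ k d _

k³≤ : ∀ k W x → k ℕ.* k ℕ.≤ W → k ℕ.* (k ℕ.* k) ℕ.≤ 15 ℕ.* W ℕ.* (k ℕ.+ x)
k³≤ k W x kk≤W = begin
  k ℕ.* (k ℕ.* k)          ≡⟨ ℕP.*-comm k (k ℕ.* k) ⟩
  (k ℕ.* k) ℕ.* k          ≤⟨ ℕP.*-mono-≤ (ℕP.≤-trans kk≤W (ℕP.m≤n*m W 15)) (ℕP.m≤m+n k x) ⟩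
  15 ℕ.* W ℕ.* (k ℕ.+ x)   ∎
  where open ℕP.≤-Reasoning

Δ·15wt : ∀ K w t → c w ≢ 0ℚ → (K ÷' c w - c 8 ÷' c 15) * (c 15 * c w * t) ≡ c 15 * K * t - c 8 * c w * t
Δ·15wt K w t w≢0 = begin
  (y - e) * (c 15 * c w * t)                        ≡⟨ expand y e (c w) t ⟩
  c 15 * (y * c w) * t - e * c 15 * c w * t         ≡⟨ cong₂ (λ u v → c 15 * u * t - v * c w * t) (÷'-* K (c w) w≢0)
      (÷'-* (c 8) (c 15) (λ ())) ⟩
  c 15 * K * t - c 8 * c w * t                      ∎
  where
  open ≡-Reasoning
  y = K ÷' c w
  e = c 8 ÷' c 15
  expand : ∀ y e w t → (y - e) * (c 15 * w * t) ≡ c 15 * (y * w) * t - e * c 15 * w * t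
  expand = solve-∀ ℚ-ring

module Ratio {m : ℕ} (x : Bool) (D : Subset m) (h : ∣ x ∷ D ∣ ℕ.≤ m) where
  open Prism (x ∷ D)
  open KfPrism (x ∷ D) h
  open Wiener (x ∷ D) h

  d k : ℕ
  d = ∣ D ∣
  k = m ℕ.∸ d

  m≡k+d : c m ≡ c k + c d
  m≡k+d = trans (cong c (sym (ℕP.m∸n+n≡m (SubP.∣p∣≤n D)))) (ℕ→ℚ-+ k d)

  3S≡k : c 3 * S ≡ c k
  3S≡k = begin
    c 3 * S                                   ≡⟨ 3S≡∑wt ⟩
    sum (wt ∘ dead)                           ≡⟨ cancel (c d) (sum (wt ∘ dead)) ⟩
    (c d + sum (wt ∘ dead)) - c d             ≡⟨ cong (_- c d) (∣∣+∑wt D) ⟩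
    c m - c d                                 ≡⟨ ℕ→ℚ-∸ (SubP.∣p∣≤n D) ⟨
    c k                                       ∎
    where
    open ≡-Reasoning
    cancel : ∀ x y → y ≡ (x + y) - x
    cancel = solve-∀ ℚ-ring

  S≡k/3 : S ≡ (pos 1 / 3) * c k
  S≡k/3 = trans (cancel S) (cong ((pos 1 / 3) *_) 3S≡k)
    where
    cancel : ∀ x → x ≡ (pos 1 / 3) * (c 3 * x)
    cancel = solve-∀ ℚ-ring

  n≡ : c n ≡ 1ℚ + (c k + c d)
  n≡ = trans (ℕ→ℚ-+ 1 m) (cong (1ℚ +_) m≡k+d)

  wiener-in-k-d : c wiener ≡ ((c 5 * ((c k + c d) * (c k + c d)) + c 2 * (c k + c d)) + (c 2 * c d + c 1)) + zt x *
      ((c 2 + c 4 * c d) + c 2 * (c d * c d))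
  wiener-in-k-d = trans wiener-value (cong₂ (λ m Z → ((c 5 * (m * m) + c 2 * m) + (c 2 * Z + 1ℚ)) + zt x *
      ((c 2 + c 4 * Z) + c 2 * (Z * Z))) m≡k+d (∑-zt D))

  -- Common to both cases: t is three times the conductance of 11', that is 0 or 3, so that k + t =
  -- 3C.
  module Estimate (C≢0 : C ≢ 0ℚ) (W E : Poly₂) (t : ℕ)
    (wiener≡ : c wiener ≡ ⟦_⟧ℚ k d W) (t≡ : c k + c t ≡ c 3 * C) (0<k : 0 ℕ.< k) (k²≤W : k ℕ.* k ℕ.≤ ⟦_⟧ k d W)
    (poly : c 15 * (c 3 * KC-value) - c 8 * ⟦_⟧ℚ k d W * (c k + c t) ≡ ⟦_⟧ℚ k d E - c k * c k) where

    K : ℚ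
    K = proj₁ (hasKf-C C≢0)

    hasKf-K : HasKf G K
    hasKf-K = proj₁ (proj₂ (hasKf-C C≢0))

    wiener≢0 : c wiener ≢ 0ℚ
    wiener≢0 eq = pos≢0 (⟦_⟧ k d W) (ℕP.≤-trans (ℕP.*-mono-≤ 0<k 0<k) k²≤W)
      (trans (ℕ→ℚ-⟦⟧ k d W) (trans (sym wiener≡) eq))

    -- This is 45 C W, which clears the denominators of Kf / W - 8/15 and of Kf itself.
    Q : ℕ
    Q = 15 ℕ.* ⟦_⟧ k d W ℕ.* (k ℕ.+ t)

    deviation : ℚ
    deviation = K ÷' c wiener - c 8 ÷' c 15

    deviation*Q : deviation * c Q ≡ c (⟦_⟧ k d E) - c (k ℕ.* k)
    deviation*Q = begin
      deviation * c Q
        ≡⟨ cong (deviation *_) (ℕ→ℚ-⟦⟧ k d (# 15 ⊗ W ⊗ (𝕜 ⊕ # t))) ⟩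
      deviation * (c 15 * ⟦_⟧ℚ k d W * T)           ≡⟨ cong (λ w → deviation * (c 15 * w * T)) wiener≡ ⟨
      deviation * (c 15 * c wiener * T)             ≡⟨ Δ·15wt K wiener T wiener≢0 ⟩
      c 15 * K * T - c 8 * c wiener * T             ≡⟨ cong₂ (λ u v → c 15 * K * u - c 8 * v * T) t≡ wiener≡ ⟩
      c 15 * K * (c 3 * C) - c 8 * ⟦_⟧ℚ k d W * T   ≡⟨ cong (_- c 8 * ⟦_⟧ℚ k d W * T) (regroup K C) ⟩
      c 15 * (c 3 * (K * C)) - c 8 * ⟦_⟧ℚ k d W * T ≡⟨ cong (λ u → c 15 * (c 3 * u) - c 8 * ⟦_⟧ℚ k d W * T)
          (proj₂ (proj₂ (hasKf-C C≢0))) ⟩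
      c 15 * (c 3 * KC-value) - c 8 * ⟦_⟧ℚ k d W * T ≡⟨ poly ⟩
      ⟦_⟧ℚ k d E - c k * c k                        ≡⟨ cong₂ _-_ (ℕ→ℚ-⟦⟧ k d E) (ℕ→ℚ-* k k) ⟨
      c (⟦_⟧ k d E) - c (k ℕ.* k)                   ∎
      where
      open ≡-Reasoning
      T = c k + c t
      regroup : ∀ K C → c 15 * K * (c 3 * C) ≡ c 15 * (c 3 * (K * C))
      regroup = solve-∀ ℚ-ring

    ratio : ∀ B ε → ⟦_⟧ k d E ℕ.≤ B ℕ.* (k ℕ.* k) → 0 ℕ.< B → 0ℚ ℚ.< ε → c B ℚ.< ε * c k →
      ∃₂ λ K w → HasKf G K × HasWiener G w × ℚ.∣ K ÷' c w - c 8 ÷' c 15 ∣ ℚ.< ε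
    ratio B@(suc _) ε E≤ _ 0<ε B<εk = K , wiener , hasKf-K , hasWiener ,
      ∣∣<ε deviation Q (⟦_⟧ k d E) B k ε deviation*Q E≤ (ℕP.m≤n*m (k ℕ.* k) B)
        (k³≤ k (⟦_⟧ k d W) t k²≤W) 0<k 0<ε B<εk

-- At most r leaves are dead, so m ≥ (bound + 1) q + r + 1 leaves k ≥ (bound + 1) q + 1 live ones.
-- Then k > 0, and ε k ≥ (bound + 1) ε q ≥ bound + 1 > bound.
limit-at : ∀ {m r} (D : Subset (suc m)) ε q → 0ℚ ℚ.< ε → 1ℚ ℚ.≤ ε * c q →
  suc (bound r) ℕ.* q ℕ.+ (r ℕ.+ 1) ℕ.≤ m → r ℕ.≤ m → ∣ D ∣ ≡ r →
  ∃₂ λ K w → HasKf (starPrismMinus m D) K × HasWiener (starPrismMinus m D) w × ℚ.∣ K ÷' c w - c 8 ÷' c 15 ∣ ℚ.< ε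
limit-at {m} {r} (x ∷ D) ε q 0<ε 1≤εq M≤m r≤m ∣xD∣≡r = go x ∣xD∣≡r
  where
  d = ∣ D ∣
  k = m ℕ.∸ d

  k-large : d ℕ.≤ r → suc (bound r) ℕ.* q ℕ.+ 1 ℕ.≤ k
  k-large d≤r = ℕP.m+n≤o⇒m≤o∸n (suc (bound r) ℕ.* q ℕ.+ 1) (begin
    suc (bound r) ℕ.* q ℕ.+ 1 ℕ.+ d    ≤⟨ ℕP.+-monoʳ-≤ (suc (bound r) ℕ.* q ℕ.+ 1) d≤r ⟩
    suc (bound r) ℕ.* q ℕ.+ 1 ℕ.+ r    ≡⟨ ℕP.+-assoc (suc (bound r) ℕ.* q) 1 r ⟩
    suc (bound r) ℕ.* q ℕ.+ (1 ℕ.+ r)  ≡⟨ cong (suc (bound r) ℕ.* q ℕ.+_) (ℕP.+-comm 1 r) ⟩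
    suc (bound r) ℕ.* q ℕ.+ (r ℕ.+ 1)  ≤⟨ M≤m ⟩
    m                                  ∎)
    where open ℕP.≤-Reasoning

  0<k : d ℕ.≤ r → 0 ℕ.< k
  0<k d≤r = ℕP.≤-trans (ℕP.m≤n+m 1 (suc (bound r) ℕ.* q)) (k-large d≤r)

  B<εk : d ℕ.≤ r → c (bound r) ℚ.< ε * c k
  B<εk d≤r = begin-strict
    c (bound r)                    <⟨ ℕ→ℚ-mono-< (ℕP.n<1+n (bound r)) ⟩
    c (suc (bound r))              ≡⟨ ℚP.*-identityʳ (c (suc (bound r))) ⟨
    c (suc (bound r)) * 1ℚ         ≤⟨ ℚP.*-monoˡ-≤-nonNeg (c (suc (bound r)))
        {{ℚ.nonNegative (ℕ→ℚ-mono-≤ {0} {suc (bound r)} z≤n)}} 1≤εq ⟩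
    c (suc (bound r)) * (ε * c q)  ≡⟨ swap (c (suc (bound r))) ε (c q) ⟩
    ε * (c (suc (bound r)) * c q)  ≡⟨ cong (ε *_) (ℕ→ℚ-* (suc (bound r)) q) ⟨
    ε * c (suc (bound r) ℕ.* q)    ≤⟨ ℚP.*-monoˡ-≤-nonNeg ε {{ℚ.nonNegative (ℚP.<⇒≤ 0<ε)}}
        (ℕ→ℚ-mono-≤ {suc (bound r) ℕ.* q} {k} (ℕP.m+n≤o⇒m≤o (suc (bound r) ℕ.* q) (k-large d≤r))) ⟩
    ε * c k                        ∎
    where
    open ℚP.≤-Reasoning
    swap : ∀ a b c → a * (b * c) ≡ b * (a * c)
    swap = solve-∀ ℚ-ring

  go : ∀ x → ∣ x ∷ D ∣ ≡ r → ∃₂ λ K w → HasKf (starPrismMinus m (x ∷ D)) K × HasWiener (starPrismMinus m (x ∷ D)) w ×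
      ℚ.∣ K ÷' c w - c 8 ÷' c 15 ∣ ℚ.< ε
  go true 1+d≡r = Estimate.ratio C≢0 wienerPoly (quadratic coeff₂ coeff₁ coeff₀) 0
      (trans wiener-in-k-d (cong (λ t → ((c 5 * ((c k + c d) * (c k + c d)) + c 2 * (c k + c d)) + (c 2 * c d + c 1))
          + t) (ℚP.*-identityˡ _)))
      (trans (ℚP.+-identityʳ (c k)) (trans (sym 3S≡k) (cong (c 3 *_) (sym C≡S))))
      (0<k d≤r) (kSq≤W k d) poly′ (bound r) ε
      (quadratic-≤ _ _ _ (⟦_⟧ 0 r coeff₂) (⟦_⟧ 0 r coeff₁ ℕ.+ ⟦_⟧ 0 r coeff₁′) (⟦_⟧ 0 r coeff₀ ℕ.+ ⟦_⟧ 0 r coeff₀′) (0<k d≤r)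
         (⟦⟧-mono d≤r coeff₂) (ℕP.≤-trans (⟦⟧-mono d≤r coeff₁) (ℕP.m≤m+n (⟦_⟧ 0 r coeff₁) (⟦_⟧ 0 r coeff₁′)))
             (ℕP.≤-trans (⟦⟧-mono d≤r coeff₀) (ℕP.m≤m+n (⟦_⟧ 0 r coeff₀) (⟦_⟧ 0 r coeff₀′))))
      (0<bound r) 0<ε (B<εk d≤r)
    where
    d≤r : d ℕ.≤ r
    -- 11' is itself one of the r deleted rungs, so r = d + 1.
    d≤r = ℕP.≤-trans (ℕP.n≤1+n d) (ℕP.≤-reflexive 1+d≡r)
    h : ∣ true ∷ D ∣ ℕ.≤ m
    h = subst (ℕ._≤ m) (sym 1+d≡r) r≤m
    open Prism (true ∷ D)
    open KfPrism (true ∷ D) h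
    open Absent refl
    open Ratio true D h hiding (d; k)
    poly : ∀ k d → let S = (pos 1 / 3) * k ; m = k + d ; n = 1ℚ + m in
      c 15 * (c 3 * ((c 2 * n * ((n - (pos 4 / 3) * S) + c 2 * S * (m - S)) - n * n) - c 2 * m * S))
        - c 8 * (((c 5 * ((k + d) * (k + d)) + c 2 * (k + d)) + (c 2 * d + c 1)) + ((c 2 + c 4 * d) + c 2 * (d * d)))
            * (k + c 0)
      ≡ ((c 20 * d) * (k * k) + (c 4 * (d * d) + c 16 * d + c 26) * k + (c 45 * (d * d) + c 90 * d + c 45)) - k * k
    poly = solve-∀ ℚ-ring
    poly′ : c 15 * (c 3 * KC-value) - c 8 * ⟦_⟧ℚ k d wienerPoly * (c k + c 0) ≡ ⟦_⟧ℚ k d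
        (quadratic coeff₂ coeff₁ coeff₀) - c k * c k
    poly′ = trans (cong (λ u → c 15 * (c 3 * u) - c 8 * ⟦_⟧ℚ k d wienerPoly * (c k + c 0))
      (trans (cong₂ (λ n m → (c 2 * n * ((n - (pos 4 / 3) * S) + c 2 * C * (m - S)) - n * n) - c 2 * m * C) n≡ m≡k+d)
             (cong₂ (λ C S → (c 2 * (1ℚ + (c k + c d)) *
                 (((1ℚ + (c k + c d)) - (pos 4 / 3) * S) + c 2 * C * ((c k + c d) - S)) - (1ℚ + (c k + c d)) *
                     (1ℚ + (c k + c d))) - c 2 * (c k + c d) * C) (trans C≡S S≡k/3) S≡k/3)))
      (poly (c k) (c d))
  go false d≡r = Estimate.ratio C≢0 wienerPoly′ (quadratic coeff₂ coeff₁′ coeff₀′) 3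
      (trans wiener-in-k-d (zero-term ((c 5 * ((c k + c d) * (c k + c d)) + c 2 * (c k + c d)) + (c 2 * c d + c 1))
          ((c 2 + c 4 * c d) + c 2 * (c d * c d))))
      (trans (cong (_+ c 3) (sym 3S≡k)) (trans (factor S) (cong (c 3 *_) (sym C≡1+S))))
      (0<k d≤r) (kSq≤W′ k d) poly′ (bound r) ε
      (quadratic-≤ _ _ _ (⟦_⟧ 0 r coeff₂) (⟦_⟧ 0 r coeff₁ ℕ.+ ⟦_⟧ 0 r coeff₁′) (⟦_⟧ 0 r coeff₀ ℕ.+ ⟦_⟧ 0 r coeff₀′) (0<k d≤r)
         (⟦⟧-mono d≤r coeff₂) (ℕP.≤-trans (⟦⟧-mono d≤r coeff₁′) (ℕP.m≤n+m (⟦_⟧ 0 r coeff₁′) (⟦_⟧ 0 r coeff₁)))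
             (ℕP.≤-trans (⟦⟧-mono d≤r coeff₀′) (ℕP.m≤n+m (⟦_⟧ 0 r coeff₀′) (⟦_⟧ 0 r coeff₀))))
      (0<bound r) 0<ε (B<εk d≤r)
    where
    d≤r : d ℕ.≤ r
    d≤r = ℕP.≤-reflexive d≡r
    h : ∣ false ∷ D ∣ ℕ.≤ m
    h = subst (ℕ._≤ m) (sym d≡r) r≤m
    open Prism (false ∷ D)
    open KfPrism (false ∷ D) h
    open Present refl
    open Ratio false D h hiding (d; k)
    zero-term : ∀ a b → a + 0ℚ * b ≡ a
    zero-term = solve-∀ ℚ-ring
    factor : ∀ S → c 3 * S + c 3 ≡ c 3 * (1ℚ + S)
    factor = solve-∀ ℚ-ring
    poly : ∀ k d → let S = (pos 1 / 3) * k ; C = 1ℚ + (pos 1 / 3) * k ; m = k + d ; n = 1ℚ + m in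
      c 15 * (c 3 * ((c 2 * n * ((n - (pos 4 / 3) * S) + c 2 * C * (m - S)) - n * n) - c 2 * m * C))
        - c 8 * ((c 5 * ((k + d) * (k + d)) + c 2 * (k + d)) + (c 2 * d + c 1)) * (k + c 3)
      ≡ ((c 20 * d) * (k * k) + (c 20 * (d * d) + c 108 * d + c 24) * k + (c 105 * (d * d) + c 84 * d + c 21)) - k * k
    poly = solve-∀ ℚ-ring
    poly′ : c 15 * (c 3 * KC-value) - c 8 * ⟦_⟧ℚ k d wienerPoly′ * (c k + c 3) ≡ ⟦_⟧ℚ k d
        (quadratic coeff₂ coeff₁′ coeff₀′) - c k * c k
    poly′ = trans (cong (λ u → c 15 * (c 3 * u) - c 8 * ⟦_⟧ℚ k d wienerPoly′ * (c k + c 3))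
      (trans (cong₂ (λ n m → (c 2 * n * ((n - (pos 4 / 3) * S) + c 2 * C * (m - S)) - n * n) - c 2 * m * C) n≡ m≡k+d)
             (cong₂ (λ C S → (c 2 * (1ℚ + (c k + c d)) *
                 (((1ℚ + (c k + c d)) - (pos 4 / 3) * S) + c 2 * C * ((c k + c d) - S)) - (1ℚ + (c k + c d)) *
                     (1ℚ + (c k + c d))) - c 2 * (c k + c d) * C) (trans C≡1+S (cong (1ℚ +_) S≡k/3)) S≡k/3)))
      (poly (c k) (c d))

limit : ∀ (r : ℕ) (ε : ℚ) → 0ℚ ℚ.< ε →
  ∃ λ (M : ℕ) → ∀ (m : ℕ) → M ℕ.≤ m → r ℕ.≤ m → ∀ (D : Subset (suc m)) → ∣ D ∣ ≡ r →
  ∃₂ λ K w → HasKf (starPrismMinus m D) K × HasWiener (starPrismMinus m D) w × ℚ.∣ K ÷' c w - c 8 ÷' c 15 ∣ ℚ.< ε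
limit r ε 0<ε with archimedean ε 0<ε
... | q , 1≤εq = suc (bound r) ℕ.* q ℕ.+ (r ℕ.+ 1) , λ m M≤m r≤m D ∣D∣≡r → limit-at D ε q 0<ε 1≤εq M≤m r≤m ∣D∣≡r

-- Spanning trees

-- Upper rim edge, rung, lower rim edge; here `true` means kept, whereas in `D` it means deleted.
Leaf : Set
Leaf = Bool × Bool × Bool

-- Leaf pairs attached to the centres without joining the centres to one another; those in `Full`
-- join them. The index is the deletion bit of the rung.
data Sparse : Bool → Leaf → Set where
  pendant : Sparse true  (true , false , true)
  no-top  : Sparse false (false , true , true)
  no-rung : Sparse false (true , false , true)
  no-bot  : Sparse false (true , true , false)

data Full : Bool → Leaf → Set where
  full : Full false (true , true , true)

sparse fulls : Bool → List Leaf
sparse true  = (true , false , true) ∷ []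
sparse false = (false , true , true) ∷ (true , false , true) ∷ (true , true , false) ∷ []
fulls true  = []
fulls false = (true , true , true) ∷ []

sparse⁺ : ∀ {d x} → Sparse d x → x ∈ˡ sparse d
sparse⁺ pendant = here refl
sparse⁺ no-top  = here refl
sparse⁺ no-rung = there (here refl)
sparse⁺ no-bot  = there (there (here refl))

sparse⁻ : ∀ {d x} → x ∈ˡ sparse d → Sparse d x
sparse⁻ {true}  (here refl)                 = pendant
sparse⁻ {false} (here refl)                 = no-top
sparse⁻ {false} (there (here refl))         = no-rung
sparse⁻ {false} (there (there (here refl))) = no-bot

fulls⁺ : ∀ {d x} → Full d x → x ∈ˡ fulls d
fulls⁺ full = here refl

fulls⁻ : ∀ {d x} → x ∈ˡ fulls d → Full d x
fulls⁻ {false} (here refl) = full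

sparse-unique : ∀ d → Unique (sparse d)
sparse-unique true  = [] ∷ []
sparse-unique false = ((λ ()) ∷ (λ ()) ∷ []) ∷ ((λ ()) ∷ []) ∷ [] ∷ []

fulls-unique : ∀ d → Unique (fulls d)
fulls-unique true  = []
fulls-unique false = [] ∷ []

-- The index e is the number of full pairs: connectedness fixes the possible shapes of each pair,
-- and the number of edges then fixes e.
data Conf : ∀ {m} → Subset m → ℕ → Vec Leaf m → Set where
  []      : Conf [] 0 []
  sparse∷ : ∀ {m} {D : Subset m} {e ls d x} → Sparse d x → Conf D e ls → Conf (d ∷ D) e (x ∷ ls)
  full∷   : ∀ {m} {D : Subset m} {e ls d x} → Full d x → Conf D e ls → Conf (d ∷ D) (suc e) (x ∷ ls)

confs : ∀ {m} → ℕ → Subset m → List (Vec Leaf m)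
confs zero    []      = [] ∷ []
confs (suc e) []      = []
confs zero    (d ∷ D) = cartesianProductWith _∷_ (sparse d) (confs zero D)
confs (suc e) (d ∷ D) = cartesianProductWith _∷_ (fulls d) (confs e D)
                     ++ cartesianProductWith _∷_ (sparse d) (confs (suc e) D)

confs⁺ : ∀ {m} {D : Subset m} {e ls} → Conf D e ls → ls ∈ˡ confs e D
confs⁺ []                             = here refl
confs⁺ {e = zero}  (sparse∷ s c)      = ∈-cartesianProductWith⁺ _∷_ (sparse⁺ s) (confs⁺ c)
confs⁺ {e = suc e} (sparse∷ {d = d} s c) = ∈-++⁺ʳ (cartesianProductWith _∷_ (fulls d) _)
    (∈-cartesianProductWith⁺ _∷_ (sparse⁺ s) (confs⁺ c))
confs⁺ (full∷ f c)                    = ∈-++⁺ˡ (∈-cartesianProductWith⁺ _∷_ (fulls⁺ f) (confs⁺ c))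

confs⁻ : ∀ {m} {D : Subset m} e {ls} → ls ∈ˡ confs e D → Conf D e ls
confs⁻ {D = []}    zero (here refl) = []
confs⁻ {D = d ∷ D} zero ls∈ with ∈-cartesianProductWith⁻ _∷_ (sparse d) (confs zero D) ls∈
... | _ , _ , x∈ , xs∈ , refl = sparse∷ (sparse⁻ x∈) (confs⁻ zero xs∈)
confs⁻ {D = d ∷ D} (suc e) ls∈ with ∈-++⁻ (cartesianProductWith _∷_ (fulls d) (confs e D)) ls∈
... | inj₁ ls∈ˡ with ∈-cartesianProductWith⁻ _∷_ (fulls d) (confs e D) ls∈ˡ
...   | _ , _ , x∈ , xs∈ , refl = full∷ (fulls⁻ x∈) (confs⁻ e xs∈)
confs⁻ {D = d ∷ D} (suc e) ls∈ | inj₂ ls∈ʳ with ∈-cartesianProductWith⁻ _∷_ (sparse d) (confs (suc e) D) ls∈ʳ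
...   | _ , _ , x∈ , xs∈ , refl = sparse∷ (sparse⁻ x∈) (confs⁻ (suc e) xs∈)

confs-unique : ∀ {m} e (D : Subset m) → Unique (confs e D)
confs-unique zero    []      = [] ∷ []
confs-unique (suc e) []      = []
confs-unique zero    (d ∷ D) = UniqueP.cartesianProductWith⁺ _∷_ VecP.∷-injective (sparse-unique d) (confs-unique zero D)
confs-unique (suc e) (d ∷ D) = UniqueP.++⁺
  (UniqueP.cartesianProductWith⁺ _∷_ VecP.∷-injective (fulls-unique d) (confs-unique e D))
  (UniqueP.cartesianProductWith⁺ _∷_ VecP.∷-injective (sparse-unique d) (confs-unique (suc e) D))
  disjoint
  where
  full-not-sparse : ∀ {d x} → Full d x → Sparse d x → _
  full-not-sparse full ()
  disjoint : ∀ {v} → v ∈ˡ cartesianProductWith _∷_ (fulls d) (confs e D) × v ∈ˡ cartesianProductWith _∷_ (sparse d)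
      (confs (suc e) D) → _
  disjoint (v∈ , v∈′) with ∈-cartesianProductWith⁻ _∷_ (fulls d) (confs e D) v∈ | ∈-cartesianProductWith⁻ _∷_
      (sparse d) (confs (suc e) D) v∈′
  ... | _ , _ , x∈ , _ , refl | _ , _ , x∈′ , _ , refl = full-not-sparse (fulls⁻ x∈) (sparse⁻ x∈′)

length-cartesianProductWith : ∀ {A B C : Set} (f : A → B → C) xs ys →
  length (cartesianProductWith f xs ys) ≡ length xs ℕ.* length ys
length-cartesianProductWith f []       ys = refl
length-cartesianProductWith f (x ∷ xs) ys = trans (ListP.length-++ (List.map (f x) ys))
  (cong₂ ℕ._+_ (ListP.length-map (f x) ys) (length-cartesianProductWith f xs ys))

liveCount : ∀ {m} → Subset m → ℕ
liveCount []          = 0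
liveCount (true ∷ D)  = liveCount D
liveCount (false ∷ D) = suc (liveCount D)

liveCount+∣∣ : ∀ {m} (D : Subset m) → liveCount D ℕ.+ ∣ D ∣ ≡ m
liveCount+∣∣ []          = refl
liveCount+∣∣ (true ∷ D)  = trans (ℕP.+-suc (liveCount D) ∣ D ∣) (cong suc (liveCount+∣∣ D))
liveCount+∣∣ (false ∷ D) = cong suc (liveCount+∣∣ D)

length-confs₀ : ∀ {m} (D : Subset m) → length (confs 0 D) ≡ 3 ^ liveCount D
length-confs₀ []          = refl
length-confs₀ (true ∷ D)  = trans (length-cartesianProductWith _∷_ (sparse true) (confs 0 D))
    (trans (ℕP.+-identityʳ _) (length-confs₀ D))
length-confs₀ (false ∷ D) = trans (length-cartesianProductWith _∷_ (sparse false) (confs 0 D))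
    (cong (3 ℕ.*_) (length-confs₀ D))

-- There are k choices of the full pair and 3 for every other live one, k·3^(k-1) in all. The factor
-- 3 on the left avoids the exponent k - 1 at k = 0.
length-confs₁ : ∀ {m} (D : Subset m) → length (confs 1 D) ℕ.* 3 ≡ liveCount D ℕ.* 3 ^ liveCount D
length-confs₁ []         = refl
length-confs₁ (true ∷ D) = trans (cong (ℕ._* 3) (trans (length-cartesianProductWith _∷_ (sparse true) (confs 1 D))
    (ℕP.+-identityʳ _))) (length-confs₁ D)
length-confs₁ (false ∷ D) = begin
  length (confs 1 (false ∷ D)) ℕ.* 3
    ≡⟨ cong (ℕ._* 3) (ListP.length-++ (cartesianProductWith _∷_ (fulls false) (confs 0 D))) ⟩
  (length (cartesianProductWith _∷_ (fulls false) (confs 0 D)) ℕ.+ length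
      (cartesianProductWith _∷_ (sparse false) (confs 1 D))) ℕ.* 3
    ≡⟨ cong₂ (λ a b → (a ℕ.+ b) ℕ.* 3) (length-cartesianProductWith _∷_ (fulls false) (confs 0 D))
        (length-cartesianProductWith _∷_ (sparse false) (confs 1 D)) ⟩
  (1 ℕ.* length (confs 0 D) ℕ.+ 3 ℕ.* length (confs 1 D)) ℕ.* 3
    ≡⟨ regroup (length (confs 0 D)) (length (confs 1 D)) ⟩
  3 ℕ.* length (confs 0 D) ℕ.+ 3 ℕ.* (length (confs 1 D) ℕ.* 3)
    ≡⟨ cong₂ (λ a b → 3 ℕ.* a ℕ.+ 3 ℕ.* b) (length-confs₀ D) (length-confs₁ D) ⟩
  3 ℕ.* 3 ^ k ℕ.+ 3 ℕ.* (k ℕ.* 3 ^ k) ≡⟨ collect k (3 ^ k) ⟩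
  suc k ℕ.* (3 ℕ.* 3 ^ k) ∎
  where
  open ≡-Reasoning
  k = liveCount D
  regroup : ∀ a b → (1 ℕ.* a ℕ.+ 3 ℕ.* b) ℕ.* 3 ≡ 3 ℕ.* a ℕ.+ 3 ℕ.* (b ℕ.* 3)
  regroup = solveℕ-∀
  collect : ∀ k p → 3 ℕ.* p ℕ.+ 3 ℕ.* (k ℕ.* p) ≡ (1 ℕ.+ k) ℕ.* (3 ℕ.* p)
  collect = solveℕ-∀

⟦_⟧ᵇ : Bool → ℕ
⟦ b ⟧ᵇ = if b then 1 else 0

leafSize : Leaf → ℕ
leafSize (t , v , b) = ⟦ t ⟧ᵇ ℕ.+ (⟦ b ⟧ᵇ ℕ.+ ⟦ v ⟧ᵇ)

size : ∀ {m} → Vec Leaf m → ℕ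
size []       = 0
size (x ∷ ls) = leafSize x ℕ.+ size ls

size-Conf : ∀ {m} {D : Subset m} {e ls} → Conf D e ls → size ls ≡ e ℕ.+ (m ℕ.+ m)
size-Conf [] = refl
size-Conf {suc m} {e = e} (sparse∷ {x = x} s c) = trans (cong₂ ℕ._+_ (leafSize-Sparse s) (size-Conf c)) (shift e m)
  where
  leafSize-Sparse : ∀ {d x} → Sparse d x → leafSize x ≡ 2
  leafSize-Sparse pendant = refl
  leafSize-Sparse no-top  = refl
  leafSize-Sparse no-rung = refl
  leafSize-Sparse no-bot  = refl
  shift : ∀ e m → 2 ℕ.+ (e ℕ.+ (m ℕ.+ m)) ≡ e ℕ.+ ((1 ℕ.+ m) ℕ.+ (1 ℕ.+ m))
  shift = solveℕ-∀
size-Conf {suc m} {e = suc e} (full∷ full c) = trans (cong (3 ℕ.+_) (size-Conf c)) (shift e m)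
  where
  shift : ∀ e m → 3 ℕ.+ (e ℕ.+ (m ℕ.+ m)) ≡ (1 ℕ.+ e) ℕ.+ ((1 ℕ.+ m) ℕ.+ (1 ℕ.+ m))
  shift = solveℕ-∀

Conf⁺ : ∀ {m} (D : Subset m) ls → (∀ j → Sparse (lookup D j) (lookup ls j) ⊎ Full (lookup D j) (lookup ls j)) →
    ∃ λ e → Conf D e ls
Conf⁺ []      []       ok = 0 , []
Conf⁺ (d ∷ D) (x ∷ ls) ok with ok zero | Conf⁺ D ls (ok ∘ suc)
... | inj₁ s | e , c = e , sparse∷ s c
... | inj₂ f | e , c = suc e , full∷ f c

Conf⁻ : ∀ {m} {D : Subset m} {e ls} → Conf D e ls → ∀ j → Sparse (lookup D j) (lookup ls j) ⊎ Full (lookup D j) (lookup ls j)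
Conf⁻ (sparse∷ s c) zero    = inj₁ s
Conf⁻ (sparse∷ s c) (suc j) = Conf⁻ c j
Conf⁻ (full∷ f c)   zero    = inj₂ f
Conf⁻ (full∷ f c)   (suc j) = Conf⁻ c j

Conf-full : ∀ {m} {D : Subset m} {e ls} → Conf D (suc e) ls → ∃ λ j → Full (lookup D j) (lookup ls j)
Conf-full (sparse∷ s c) with Conf-full c
... | j , f = suc j , f
Conf-full (full∷ f c) = zero , f

withCentre : ∀ {m} → Bool → List (Vec Leaf m) → List (Bool × Vec Leaf m)
withCentre v₀ = List.map (v₀ ,_)

ℕ→ℚ-injective : ∀ {a b} → ℕ→ℚ a ≡ ℕ→ℚ b → a ≡ b
ℕ→ℚ-injective {a} {b} eq with ℕP.<-cmp a b
... | tri< a<b _ _ = ⊥-elim (ℚP.<-irrefl eq (ℕ→ℚ-mono-< a<b))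
... | tri≈ _ a≡b _ = a≡b
... | tri> _ _ b<a = ⊥-elim (ℚP.<-irrefl (sym eq) (ℕ→ℚ-mono-< b<a))

lookup-injective : ∀ {A : Set} {xs : List A} → Unique xs → ∀ i j → List.lookup xs i ≡ List.lookup xs j → i ≡ j
lookup-injective (_ ∷ u)    zero    zero    _  = refl
lookup-injective (x∉ ∷ _)   zero    (suc j) eq = ⊥-elim (All.lookup x∉ (∈-lookup j) eq)
lookup-injective (x∉ ∷ _)   (suc i) zero    eq = ⊥-elim (All.lookup x∉ (∈-lookup i) (sym eq))
lookup-injective (_ ∷ u)    (suc i) (suc j) eq = cong suc (lookup-injective u i j eq)

concatMap-unique : ∀ {A B : Set} (f : A → List B) → (∀ a → Unique (f a)) →
  (∀ {a b p} → p ∈ˡ f a → p ∈ˡ f b → a ≡ b) → ∀ {xs} → Unique xs → Unique (concatMap f xs)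
concatMap-unique f f-unique f-disjoint []             = []
concatMap-unique f f-unique f-disjoint {x ∷ xs} (x∉ ∷ u) =
  UniqueP.++⁺ (f-unique x) (concatMap-unique f f-unique f-disjoint u) disjoint
  where
  disjoint : ∀ {p} → p ∈ˡ f x × p ∈ˡ concatMap f xs → ⊥
  disjoint (p∈fx , p∈) with find (∈-concatMap⁻ f {xs = xs} p∈)
  ... | y , y∈xs , p∈fy = All.lookup x∉ y∈xs (f-disjoint p∈fx p∈fy)

∣tabulate-lookup∣ : ∀ {A : Set} (f : A → Bool) xs →
  ∣ tabulate (f ∘ List.lookup xs) ∣ ≡ List.foldr (λ p acc → ⟦ f p ⟧ᵇ ℕ.+ acc) 0 xs
∣tabulate-lookup∣ f []       = refl
∣tabulate-lookup∣ f (x ∷ xs) with f x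
... | true  = cong suc (∣tabulate-lookup∣ f xs)
... | false = ∣tabulate-lookup∣ f xs

reach-invariant : ∀ {A : Set} {R : A → A → Set} (P : A → Bool) → (∀ {u v} → R u v → P u ≡ P v) →
  ∀ {u v ℓ} → Walk R u v ℓ → P u ≡ P v
reach-invariant P inv here       = refl
reach-invariant P inv (step e p) = trans (inv e) (reach-invariant P inv p)

-- Edge subsets as configurations of kept edges

module Trees {m : ℕ} (x : Bool) (D′ : Subset m) where
  D : Subset (suc m)
  D = x ∷ D′
  open Prism D hiding (D₀)
  open Edges D

  topᵇ rungᵇ botᵇ : Leaf → Bool
  topᵇ  (t , _ , _) = t
  rungᵇ (_ , v , _) = v
  botᵇ  (_ , _ , b) = b

  Config : Set
  Config = Bool × Vec Leaf m

  rungBit : Config → Fin n → Bool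
  rungBit (v₀ , _)  zero    = v₀
  rungBit (_  , ls) (suc j) = rungᵇ (lookup ls j)

  onLeaf : (Leaf → Bool) → Config → Fin n → Bool
  onLeaf f _        zero    = false
  onLeaf f (_ , ls) (suc j) = f (lookup ls j)

  -- The bit of an edge is found from its two ends: a rim edge is determined by its outer end, the
  -- second one, and a rung by its index.
  module χ (c : Config) = Blocks (λ _ → onLeaf topᵇ c) (λ i _ → rungBit c i) (λ _ _ → false) (λ _ → onLeaf botᵇ c)

  chosen : Config → V × V → Bool
  chosen c (u , w) = χ.block c u w

  encode : Config → Subset (∣E∣ G)
  encode c = tabulate (chosen c ∘ edge G)

  -- A tag with the values 0, 3 and 1 on the three segments of the edge list, which separates them.
  open Blocks {A = ℕ} (λ _ _ → 0) (λ _ _ → 1) (λ _ _ → 2) (λ _ _ → 3)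
    renaming (block to kind; block-TT to kind-TT; block-TB to kind-TB; block-BB to kind-BB) using ()

  top-injective : ∀ {i j} → top i ≡ top j → i ≡ j
  top-injective = FinP.↑ˡ-injective n _ _

  bot-injective : ∀ {i j} → bot i ≡ bot j → i ≡ j
  bot-injective = FinP.↑ʳ-injective n _ _

  ∈-rung : ∀ {i p} → p ∈ˡ rung i → p ≡ (top i , bot i)
  ∈-rung {i} p∈ with lookup D i
  ∈-rung (here eq) | false = eq

  rung-unique : ∀ i → Unique (rung i)
  rung-unique i with lookup D i
  ... | true  = []
  ... | false = [] ∷ []

  -- A subset is indexed by list positions. Distinctness makes the position of an edge unique, so
  -- that decoding and encoding are inverse.
  edges-unique : Unique (edges G)
  edges-unique = UniqueP.++⁺
    (concatMap-unique rimT (λ _ → [] ∷ []) (λ { (here p≡) (here q≡) →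
        FinP.suc-injective (top-injective (cong proj₂ (trans (sym p≡) q≡))) }) (UniqueP.allFin⁺ m))
    (UniqueP.++⁺
      (concatMap-unique rimB (λ _ → [] ∷ []) (λ { (here p≡) (here q≡) →
          FinP.suc-injective (bot-injective (cong proj₂ (trans (sym p≡) q≡))) }) (UniqueP.allFin⁺ m))
      (concatMap-unique rung rung-unique (λ p∈ q∈ → top-injective (cong proj₁ (trans (sym (∈-rung p∈)) (∈-rung q∈))))
          (UniqueP.allFin⁺ n))
      (λ (p∈ , p∈′) → 3≢1 (trans (sym (All.lookup kind₂ p∈)) (All.lookup kind₃ p∈′))))
    (λ (p∈ , p∈′) → apart (All.lookup kind₁ p∈) (∈-++⁻ es₂ p∈′))
    where
    Kind : ℕ → V × V → Set
    Kind k (u , w) = kind u w ≡ k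
    3≢1 : 3 ≢ 1
    3≢1 ()
    kind₁ : All (Kind 0) es₁
    kind₁ = all-concatMap rimT (λ j → kind-TT zero (suc j) ∷ []) (allFin m)
    kind₂ : All (Kind 3) es₂
    kind₂ = all-concatMap rimB (λ j → kind-BB zero (suc j) ∷ []) (allFin m)
    kind₃ : All (Kind 1) es₃
    kind₃ = all-concatMap rung (λ i → All.tabulate λ { p∈ → subst (Kind 1) (sym (∈-rung p∈)) (kind-TB i i) }) (allFin n)
    apart : ∀ {p} → Kind 0 p → p ∈ˡ es₂ ⊎ p ∈ˡ es₃ → ⊥
    apart k (inj₁ p∈) with trans (sym k) (All.lookup kind₂ p∈)
    ... | ()
    apart k (inj₂ p∈) with trans (sym k) (All.lookup kind₃ p∈)
    ... | ()

  ix : ∀ {p} → IsEdge p → Fin (∣E∣ G)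
  ix e = index (edges-complete e)

  edge-ix : ∀ {p} (e : IsEdge p) → edge G (ix e) ≡ p
  edge-ix e = sym (AnyP.lookup-index (edges-complete e))

  ix-unique : ∀ {p} (e : IsEdge p) i → edge G i ≡ p → ix e ≡ i
  ix-unique e i eq = lookup-injective edges-unique (ix e) i (trans (edge-ix e) (sym eq))

  lookup-encode : ∀ c i → lookup (encode c) i ≡ chosen c (edge G i)
  lookup-encode c = VecP.lookup∘tabulate (chosen c ∘ edge G)

  -- A configuration has a rung bit even where the rung is deleted; such a bit must be false, since
  -- `encode` loses it.
  Canonical : Config → Set
  Canonical c = ∀ i → rungBit c i ≡ true → lookup D i ≡ false

  -- The equation is a separate argument so that matching on d yields the proof of survival that
  -- `rungᵉ` asks for. A deleted rung gets the default `false`, which makes decoded configurations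
  -- canonical.
  decodeRung : Subset (∣E∣ G) → ∀ i {d} → lookup D i ≡ d → Bool
  decodeRung S i {true}  _  = false
  decodeRung S i {false} Dᵢ = lookup S (ix (rungᵉ i Dᵢ))

  decodeLeaf : Subset (∣E∣ G) → Fin m → Leaf
  decodeLeaf S j = lookup S (ix (rimᵗ j)) , decodeRung S (suc j) refl , lookup S (ix (rimᵇ j))

  decode : Subset (∣E∣ G) → Config
  decode S = decodeRung S zero refl , tabulate (decodeLeaf S)

  rungBit-decode : ∀ S i → rungBit (decode S) i ≡ decodeRung S i refl
  rungBit-decode S zero    = refl
  rungBit-decode S (suc j) = cong rungᵇ (VecP.lookup∘tabulate (decodeLeaf S) j)

  decode-canonical : ∀ S → Canonical (decode S)
  decode-canonical S i eq = go refl (trans (sym (rungBit-decode S i)) eq)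
    where
    go : ∀ {d} (Dᵢ : lookup D i ≡ d) → decodeRung S i Dᵢ ≡ true → lookup D i ≡ false
    go {false} Dᵢ _ = Dᵢ

  decodeRung-live : ∀ S i {d} (Dᵢ : lookup D i ≡ d) (Dᵢ′ : lookup D i ≡ false) →
    decodeRung S i Dᵢ ≡ lookup S (ix (rungᵉ i Dᵢ′))
  decodeRung-live S i {true}  Dᵢ Dᵢ′ with trans (sym Dᵢ) Dᵢ′
  ... | ()
  decodeRung-live S i {false} Dᵢ Dᵢ′ = cong (lookup S) (ix-unique (rungᵉ i Dᵢ) (ix (rungᵉ i Dᵢ′)) (edge-ix (rungᵉ i Dᵢ′)))

  chosen-decode : ∀ S {p} (e : IsEdge p) → chosen (decode S) p ≡ lookup S (ix e)
  chosen-decode S (rimᵗ j) = trans (χ.block-TT (decode S) zero (suc j)) (cong topᵇ (VecP.lookup∘tabulate (decodeLeaf S) j))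
  chosen-decode S (rimᵇ j) = trans (χ.block-BB (decode S) zero (suc j)) (cong botᵇ (VecP.lookup∘tabulate (decodeLeaf S) j))
  chosen-decode S (rungᵉ i Dᵢ) = trans (χ.block-TB (decode S) i i) (trans (rungBit-decode S i) (decodeRung-live S i refl Dᵢ))

  encode-decode : ∀ S → encode (decode S) ≡ S
  encode-decode S = trans (VecP.tabulate-cong λ i →
    trans (chosen-decode S (edge-sound i)) (cong (lookup S) (ix-unique (edge-sound i) i refl)))
    (VecP.tabulate∘lookup S)

  lookup-encode-ix : ∀ c {p} (e : IsEdge p) → lookup (encode c) (ix e) ≡ chosen c p
  lookup-encode-ix c e = trans (lookup-encode c (ix e)) (cong (chosen c) (edge-ix e))

  decodeRung-encode : ∀ c → Canonical c → ∀ i {d} (Dᵢ : lookup D i ≡ d) → decodeRung (encode c) i Dᵢ ≡ rungBit c i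
  decodeRung-encode c canon i {false} Dᵢ = trans (lookup-encode-ix c (rungᵉ i Dᵢ)) (χ.block-TB c i i)
  decodeRung-encode c canon i {true}  Dᵢ with rungBit c i in eq
  ... | false = refl
  ... | true with trans (sym Dᵢ) (canon i eq)
  ...   | ()

  decode-encode : ∀ c → Canonical c → decode (encode c) ≡ c
  decode-encode c@(v₀ , ls) canon = cong₂ _,_ (decodeRung-encode c canon zero refl)
    (trans (VecP.tabulate-cong leaf) (VecP.tabulate∘lookup ls))
    where
    leaf : ∀ j → decodeLeaf (encode c) j ≡ lookup ls j
    leaf j = cong₂ _,_ (trans (lookup-encode-ix c (rimᵗ j)) (χ.block-TT c zero (suc j)))
            (cong₂ _,_ (decodeRung-encode c canon (suc j) refl)
                       (trans (lookup-encode-ix c (rimᵇ j)) (χ.block-BB c zero (suc j))))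

  adjIn : ∀ c {u v} → IsEdge (u , v) → chosen c (u , v) ≡ true → AdjIn G (encode c) u v
  adjIn c e eq = ix e , VecP.lookup⇒[]= (ix e) (encode c) (trans (lookup-encode-ix c e) eq) , inj₁ (edge-ix e)

  AdjIn-sym : ∀ {S u v} → AdjIn G S u v → AdjIn G S v u
  AdjIn-sym (e , e∈ , inj₁ eq) = e , e∈ , inj₂ eq
  AdjIn-sym (e , e∈ , inj₂ eq) = e , e∈ , inj₁ eq

  adjIn-invariant : ∀ c (P : V → Bool) → (∀ {u v} → IsEdge (u , v) → chosen c (u , v) ≡ true → P u ≡ P v) →
    ∀ {u v} → AdjIn G (encode c) u v → P u ≡ P v
  adjIn-invariant c P inv (e , e∈ , eq) = go eq
    where
    is-chosen : chosen c (edge G e) ≡ true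
    is-chosen = trans (sym (lookup-encode c e)) (VecP.[]=⇒lookup e∈)
    go : ∀ {u v} → edge G e ≡ (u , v) ⊎ edge G e ≡ (v , u) → P u ≡ P v
    go (inj₁ eq) = inv (subst IsEdge eq (edge-sound e)) (trans (cong (chosen c) (sym eq)) is-chosen)
    go (inj₂ eq) = sym (inv (subst IsEdge eq (edge-sound e)) (trans (cong (chosen c) (sym eq)) is-chosen))

  Connected : Config → Set
  Connected c = ∀ u v → ∃ λ ℓ → Walk (AdjIn G (encode c)) u v ℓ

  -- The marked part of the j-th leaf pair is closed under chosen edges and misses the centres.
  cut : ∀ v₀ ls → Connected (v₀ , ls) → ∀ j fT fB →
    (fT ≡ true → topᵇ (lookup ls j) ≡ false) → (fB ≡ true → botᵇ (lookup ls j) ≡ false) →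
    (rungᵇ (lookup ls j) ≡ true → fT ≡ fB) → fT ≡ false × fB ≡ false
  cut v₀ ls conn j fT fB t-out b-out v-in =
    trans (sym (P-top-j)) (trans (reach (top (suc j))) P-top-0) , trans (sym P-bot-j) (trans (reach (bot (suc j))) P-top-0)
    where
    cfg : Config
    cfg = v₀ , ls
    mark : Bool → Fin n → Bool
    mark f i = f ∧ does (i FinP.≟ suc j)
    P : V → Bool
    P = ⟨ mark fT ∣ mark fB ⟩
    at-j : ∀ f → mark f (suc j) ≡ f
    at-j f = trans (cong (f ∧_) (dec-true (suc j FinP.≟ suc j) refl)) (BoolP.∧-identityʳ f)
    off-j : ∀ f {i} → i ≢ suc j → mark f i ≡ false
    off-j f {i} i≢ = trans (cong (f ∧_) (dec-false (i FinP.≟ suc j) i≢)) (BoolP.∧-zeroʳ f)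
    P-top-j : P (top (suc j)) ≡ fT
    P-top-j = trans (at-top (mark fT) (mark fB) (suc j)) (at-j fT)
    P-bot-j : P (bot (suc j)) ≡ fB
    P-bot-j = trans (at-bot (mark fT) (mark fB) (suc j)) (at-j fB)
    P-top-0 : P (top zero) ≡ false
    P-top-0 = trans (at-top (mark fT) (mark fB) zero) (off-j fT {zero} λ ())
    P-bot-0 : P (bot zero) ≡ false
    P-bot-0 = trans (at-bot (mark fT) (mark fB) zero) (off-j fB {zero} λ ())
    out : ∀ {f b} → (f ≡ true → b ≡ false) → b ≡ true → f ≡ false
    out {false} _ _ = refl
    out {true} f⇒ b≡ with trans (sym b≡) (f⇒ refl)
    ... | ()
    rim : ∀ f (bit : Leaf → Bool) → (f ≡ true → bit (lookup ls j) ≡ false) → ∀ k → bit (lookup ls k) ≡ true →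
        mark f (suc k) ≡ false
    rim f bit f-out k k-in with k FinP.≟ j
    ... | yes refl = trans (BoolP.∧-identityʳ f) (out f-out k-in)
    ... | no k≢j   = BoolP.∧-zeroʳ f
    inv : ∀ {u v} → IsEdge (u , v) → chosen cfg (u , v) ≡ true → P u ≡ P v
    inv (rimᵗ k) in-S = trans P-top-0 (sym (trans (at-top (mark fT) (mark fB) (suc k))
      (rim fT topᵇ t-out k (trans (sym (χ.block-TT cfg zero (suc k))) in-S))))
    inv (rimᵇ k) in-S = trans P-bot-0 (sym (trans (at-bot (mark fT) (mark fB) (suc k))
      (rim fB botᵇ b-out k (trans (sym (χ.block-BB cfg zero (suc k))) in-S))))
    inv (rungᵉ i _) in-S = trans (at-top (mark fT) (mark fB) i)
        (trans (mark-eq (i FinP.≟ suc j)) (sym (at-bot (mark fT) (mark fB) i)))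
      where
      mark-eq : Dec (i ≡ suc j) → mark fT i ≡ mark fB i
      mark-eq (yes refl) = cong (λ f → mark f i) (v-in (trans (sym (χ.block-TB cfg i i)) in-S))
      mark-eq (no i≢)    = trans (off-j fT i≢) (sym (off-j fB i≢))
    -- P is constant along chosen edges, so connectedness carries its value `false` at the centre 1
    -- to both leaves of the pair.
    reach : ∀ u → P u ≡ P (top zero)
    reach u = reach-invariant P (adjIn-invariant cfg P inv) (proj₂ (conn u (top zero)))

  -- Without both rim edges the pair is cut off; without the rung and one rim edge a single leaf is.
  -- The marks given to `cut` select exactly the part cut off. The other patterns keep at least two
  -- edges, and canonicity excludes a rung bit at a dead leaf.
  connected⇒ok : ∀ v₀ ls → Canonical (v₀ , ls) → Connected (v₀ , ls) →
    ∀ j → Sparse (lookup D′ j) (lookup ls j) ⊎ Full (lookup D′ j) (lookup ls j)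
  connected⇒ok v₀ ls canon conn j = go (lookup D′ j) (lookup ls j) (canon (suc j)) (cut v₀ ls conn j)
    where
    go : ∀ d l → (rungᵇ l ≡ true → d ≡ false) →
      (∀ fT fB → (fT ≡ true → topᵇ l ≡ false) → (fB ≡ true → botᵇ l ≡ false) → (rungᵇ l ≡ true → fT ≡ fB) →
          fT ≡ false × fB ≡ false) →
      Sparse d l ⊎ Full d l
    go d (false , v , false) _ cut with cut true true (λ _ → refl) (λ _ → refl) (λ _ → refl)
    ... | () , _
    go d (false , false , true) _ cut with cut true false (λ _ → refl) (λ ()) (λ ())
    ... | () , _
    go d (true , false , false) _ cut with cut false true (λ ()) (λ _ → refl) (λ ())
    ... | _ , ()
    go false (false , true , true)  _ _ = inj₁ no-top
    go false (true , false , true)  _ _ = inj₁ no-rung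
    go false (true , true , false)  _ _ = inj₁ no-bot
    go false (true , true , true)   _ _ = inj₂ full
    go true  (true , false , true)  _ _ = inj₁ pendant
    go true  (false , true , true) canon _ with canon refl
    ... | ()
    go true  (true , true , false) canon _ with canon refl
    ... | ()
    go true  (true , true , true) canon _ with canon refl
    ... | ()

  Good : Config → Set
  Good (v₀ , ls) = (v₀ ≡ false × Conf D′ 1 ls) ⊎ (v₀ ≡ true × x ≡ false × Conf D′ 0 ls)

  Conf-canonical : ∀ {e ls} → Conf D′ e ls → ∀ j → rungᵇ (lookup ls j) ≡ true → lookup D′ j ≡ false
  Conf-canonical {ls = ls} c j eq with lookup D′ j | lookup ls j | Conf⁻ c j
  ... | .false | _ | inj₁ no-top  = refl
  ... | .false | _ | inj₁ no-rung = refl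
  ... | .false | _ | inj₁ no-bot  = refl
  ... | .false | _ | inj₂ full    = refl
  Conf-canonical c j () | .true | _ | inj₁ pendant

  Good-canonical : ∀ c → Good c → Canonical c
  Good-canonical (v₀ , ls) (inj₁ (refl , _))      zero    ()
  Good-canonical (v₀ , ls) (inj₂ (_ , x≡ , _))    zero    _ = x≡
  Good-canonical (v₀ , ls) (inj₁ (_ , conf))      (suc j) = Conf-canonical conf j
  Good-canonical (v₀ , ls) (inj₂ (_ , _ , conf))  (suc j) = Conf-canonical conf j

  -- The count is made in `ℚ`, where `lsum-edges` regroups the edge list by leaf pair, and brought
  -- back by injectivity of `ℕ→ℚ`. Canonicity ensures that no bit of a deleted rung is counted.
  size-encode : ∀ v₀ ls → Canonical (v₀ , ls) → ∣ encode (v₀ , ls) ∣ ≡ ⟦ v₀ ⟧ᵇ ℕ.+ size ls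
  size-encode v₀ ls canon = ℕ→ℚ-injective (begin
    ℕ→ℚ ∣ encode cfg ∣            ≡⟨ cong ℕ→ℚ (∣tabulate-lookup∣ (chosen cfg) (edges G)) ⟩
    ℕ→ℚ (List.foldr (λ p acc → ⟦ chosen cfg p ⟧ᵇ ℕ.+ acc) 0 (edges G))
      ≡⟨ ℕ→ℚ-foldr (λ p → ⟦ chosen cfg p ⟧ᵇ) φ (λ _ → refl) (edges G) ⟩
    lsum φ (edges G)            ≡⟨ lsum-edges φ ⟩
    _                           ≡⟨ cong₂ _+_ (rung-term zero)
        (sum-cong-≗ λ j → cong₂ _+_ (cong w (χ.block-TT cfg zero (suc j)))
            (cong₂ _+_ (cong w (χ.block-BB cfg zero (suc j))) (rung-term (suc j)))) ⟩
    w v₀ + sum (λ j → w (topᵇ (lookup ls j)) + (w (botᵇ (lookup ls j)) + w (rungᵇ (lookup ls j))))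
      ≡⟨ cong (w v₀ +_) (∑-size ls) ⟩
    w v₀ + ℕ→ℚ (size ls)        ≡⟨ ℕ→ℚ-+ ⟦ v₀ ⟧ᵇ (size ls) ⟨
    ℕ→ℚ (⟦ v₀ ⟧ᵇ ℕ.+ size ls)   ∎)
    where
    open ≡-Reasoning
    cfg : Config
    cfg = v₀ , ls
    w : Bool → ℚ
    w b = ℕ→ℚ ⟦ b ⟧ᵇ
    φ : V × V → ℚ
    φ p = w (chosen cfg p)
    rung-term : ∀ i → (if lookup D i then 0ℚ else φ (top i , bot i)) ≡ w (rungBit cfg i)
    rung-term i with lookup D i in Dᵢ
    ... | false = cong w (χ.block-TB cfg i i)
    ... | true with rungBit cfg i in eq
    ...   | false = refl
    ...   | true with trans (sym Dᵢ) (canon i eq)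
    ...     | ()
    ∑-size : ∀ {k} (ls : Vec Leaf k) → sum (λ j → w (topᵇ (lookup ls j)) +
        (w (botᵇ (lookup ls j)) + w (rungᵇ (lookup ls j)))) ≡ ℕ→ℚ (size ls)
    ∑-size [] = refl
    ∑-size ((t , v , b) ∷ ls) = trans (cong₂ _+_ (leaf t v b) (∑-size ls)) (sym (ℕ→ℚ-+ (leafSize (t , v , b)) (size ls)))
      where
      leaf : ∀ t v b → w t + (w b + w v) ≡ ℕ→ℚ (leafSize (t , v , b))
      leaf t v b = trans (cong (w t +_) (sym (ℕ→ℚ-+ ⟦ b ⟧ᵇ ⟦ v ⟧ᵇ))) (sym (ℕ→ℚ-+ ⟦ t ⟧ᵇ (⟦ b ⟧ᵇ ℕ.+ ⟦ v ⟧ᵇ)))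

  N∸1 : N G ℕ.∸ 1 ≡ 1 ℕ.+ (m ℕ.+ m)
  N∸1 = ℕP.+-suc m m

  tree⇒Good : ∀ c → Canonical c → IsSpanningTree G (encode c) → Good c
  tree⇒Good (v₀ , ls) canon (∣S∣≡ , conn) with Conf⁺ D′ ls (connected⇒ok v₀ ls canon conn)
  -- A spanning tree on 2m + 2 vertices has 2m + 1 edges; the configuration has v₀ + e + 2m, hence
  -- v₀ + e = 1.
  ... | e , conf = go v₀ e conf refl (ℕP.+-cancelʳ-≡ (m ℕ.+ m) (⟦ v₀ ⟧ᵇ ℕ.+ e) 1 (begin
    (⟦ v₀ ⟧ᵇ ℕ.+ e) ℕ.+ (m ℕ.+ m)  ≡⟨ ℕP.+-assoc ⟦ v₀ ⟧ᵇ e (m ℕ.+ m) ⟩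
    ⟦ v₀ ⟧ᵇ ℕ.+ (e ℕ.+ (m ℕ.+ m))  ≡⟨ cong (⟦ v₀ ⟧ᵇ ℕ.+_) (size-Conf conf) ⟨
    ⟦ v₀ ⟧ᵇ ℕ.+ size ls            ≡⟨ size-encode v₀ ls canon ⟨
    ∣ encode (v₀ , ls) ∣           ≡⟨ trans ∣S∣≡ N∸1 ⟩
    1 ℕ.+ (m ℕ.+ m)                ∎))
    where
    open ≡-Reasoning
    go : ∀ b e → Conf D′ e ls → v₀ ≡ b → ⟦ b ⟧ᵇ ℕ.+ e ≡ 1 → Good (v₀ , ls)
    go false .1 conf v₀≡ refl = inj₁ (v₀≡ , conf)
    go true  .0 conf v₀≡ refl = inj₂ (v₀≡ , canon zero v₀≡ , conf)

  Good⇒tree : ∀ c → Good c → IsSpanningTree G (encode c)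
  Good⇒tree c@(v₀ , ls) good = trans (size-encode v₀ ls (Good-canonical c good)) (trans (total good) (sym N∸1)) ,
    λ u v → join (to-root u) (to-root v)
    where
    total : Good c → ⟦ v₀ ⟧ᵇ ℕ.+ size ls ≡ 1 ℕ.+ (m ℕ.+ m)
    total (inj₁ (refl , conf))     = size-Conf conf
    total (inj₂ (refl , _ , conf)) = cong suc (size-Conf conf)

    R = AdjIn G (encode c)
    Reach : V → V → Set
    Reach u v = ∃ λ ℓ → Walk R u v ℓ

    join : ∀ {u v o} → Reach u o → Reach v o → Reach u v
    join (_ , p) (_ , q) = _ , (p ▷ reverse AdjIn-sym q)

    infixr 5 _◁_
    _◁_ : ∀ {u v w} → R u v → Reach v w → Reach u w
    e ◁ (_ , p) = _ , step e p

    stop : ∀ {u} → Reach u u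
    stop = 0 , here

    up : ∀ j → topᵇ (lookup ls j) ≡ true → R (top zero) (top (suc j))
    up j eq = adjIn c (rimᵗ j) (trans (χ.block-TT c zero (suc j)) eq)
    down : ∀ j → botᵇ (lookup ls j) ≡ true → R (bot zero) (bot (suc j))
    down j eq = adjIn c (rimᵇ j) (trans (χ.block-BB c zero (suc j)) eq)
    across : ∀ i → rungBit c i ≡ true → R (top i) (bot i)
    across i eq = adjIn c (rungᵉ i (Good-canonical c good i eq)) (trans (χ.block-TB c i i) eq)

    -- The one link between the centres, 11' or the path through the full pair. Given it, every leaf
    -- reaches the centre 1 by starting along its own rim edge or through its twin.
    centres : Reach (bot zero) (top zero)
    centres = go good
      where
      go : Good c → Reach (bot zero) (top zero)
      go (inj₂ (refl , _ , _)) = AdjIn-sym (across zero refl) ◁ stop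
      go (inj₁ (_ , conf)) with Conf-full conf
      ... | j , f = down j (bits f .proj₂ .proj₂) ◁ AdjIn-sym (across (suc j) (bits f .proj₂ .proj₁)) ◁ AdjIn-sym
          (up j (bits f .proj₁)) ◁ stop
        where
        bits : ∀ {d l} → Full d l → topᵇ l ≡ true × rungᵇ l ≡ true × botᵇ l ≡ true
        bits full = refl , refl , refl

    ok : ∀ j → Sparse (lookup D′ j) (lookup ls j) ⊎ Full (lookup D′ j) (lookup ls j)
    ok = go good
      where
      go : Good c → ∀ j → Sparse (lookup D′ j) (lookup ls j) ⊎ Full (lookup D′ j) (lookup ls j)
      go (inj₁ (_ , conf))     = Conf⁻ conf
      go (inj₂ (_ , _ , conf)) = Conf⁻ conf

    top-or : ∀ {d l} → Sparse d l ⊎ Full d l → topᵇ l ≡ true ⊎ (rungᵇ l ≡ true × botᵇ l ≡ true)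
    top-or (inj₁ pendant) = inj₁ refl
    top-or (inj₁ no-top)  = inj₂ (refl , refl)
    top-or (inj₁ no-rung) = inj₁ refl
    top-or (inj₁ no-bot)  = inj₁ refl
    top-or (inj₂ full)    = inj₁ refl

    bot-or : ∀ {d l} → Sparse d l ⊎ Full d l → botᵇ l ≡ true ⊎ (rungᵇ l ≡ true × topᵇ l ≡ true)
    bot-or (inj₁ pendant) = inj₁ refl
    bot-or (inj₁ no-top)  = inj₁ refl
    bot-or (inj₁ no-rung) = inj₁ refl
    bot-or (inj₁ no-bot)  = inj₂ (refl , refl)
    bot-or (inj₂ full)    = inj₁ refl

    to-root : ∀ u → Reach u (top zero)
    to-root = vertex-elim _ from-top from-bot
      where
      from-top : ∀ i → Reach (top i) (top zero)
      from-top zero = stop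
      from-top (suc j) with top-or (ok j)
      ... | inj₁ t       = AdjIn-sym (up j t) ◁ stop
      ... | inj₂ (v , b) = across (suc j) v ◁ AdjIn-sym (down j b) ◁ centres
      from-bot : ∀ i → Reach (bot i) (top zero)
      from-bot zero = centres
      from-bot (suc j) with bot-or (ok j)
      ... | inj₁ b       = AdjIn-sym (down j b) ◁ centres
      ... | inj₂ (v , t) = AdjIn-sym (across (suc j) v) ◁ AdjIn-sym (up j t) ◁ stop

  configs : List Config
  configs = withCentre false (confs 1 D′) ++ (if x then [] else withCentre true (confs 0 D′))

  configs⁺ : ∀ {c} → Good c → c ∈ˡ configs
  configs⁺ (inj₁ (refl , conf))        = ∈-++⁺ˡ (∈-map⁺ (false ,_) (confs⁺ conf))
  configs⁺ (inj₂ (refl , refl , conf)) = ∈-++⁺ʳ (withCentre false (confs 1 D′)) (∈-map⁺ (true ,_) (confs⁺ conf))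

  configs⁻ : ∀ {c} → c ∈ˡ configs → Good c
  configs⁻ c∈ with ∈-++⁻ (withCentre false (confs 1 D′)) c∈
  ... | inj₁ c∈₁ with ∈-map⁻ (false ,_) c∈₁
  ...   | _ , ls∈ , refl = inj₁ (refl , confs⁻ 1 ls∈)
  configs⁻ c∈ | inj₂ c∈₂ = go x refl c∈₂
    where
    go : ∀ {c} b → x ≡ b → c ∈ˡ (if b then [] else withCentre true (confs 0 D′)) → Good c
    go false x≡ c∈ with ∈-map⁻ (true ,_) c∈
    ... | _ , ls∈ , refl = inj₂ (refl , x≡ , confs⁻ 0 ls∈)

  configs-unique : Unique configs
  configs-unique = UniqueP.++⁺ (UniqueP.map⁺ (cong proj₂) (confs-unique 1 D′)) (second x) (λ (p , q) → disjoint x p q)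
    where
    second : ∀ b → Unique (if b then [] else withCentre true (confs 0 D′))
    second true  = []
    second false = UniqueP.map⁺ (cong proj₂) (confs-unique 0 D′)
    disjoint : ∀ b {c} → c ∈ˡ withCentre false (confs 1 D′) → c ∈ˡ (if b then [] else withCentre true (confs 0 D′)) → ⊥
    disjoint false p q with ∈-map⁻ (false ,_) p | ∈-map⁻ (true ,_) q
    ... | _ , _ , refl | _ , _ , ()

  spanningTreeCount : SpanningTreeCount G (length configs)
  spanningTreeCount = List.map encode configs , unique , (λ S → mk⇔ (sound S) (complete S)) , ListP.length-map encode configs
    where
    unique : Unique (List.map encode configs)
    -- `decode` takes the list back to `configs`, whose entries are distinct, so the encoded subsets
    -- are distinct.
    unique = UniqueP.map⁻ {f = decode} (subst Unique (sym (trans (sym (ListP.map-∘ configs))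
      (ListP.map-id-local (All.tabulate λ {c} c∈ → decode-encode c (Good-canonical c (configs⁻ c∈)))))) configs-unique)
    sound : ∀ S → S ∈ˡ List.map encode configs → IsSpanningTree G S
    sound S S∈ with ∈-map⁻ encode S∈
    ... | c , c∈ , refl = Good⇒tree c (configs⁻ c∈)
    complete : ∀ S → IsSpanningTree G S → S ∈ˡ List.map encode configs
    complete S tree = subst (_∈ˡ List.map encode configs) (encode-decode S)
      (∈-map⁺ encode (configs⁺ (tree⇒Good (decode S) (decode-canonical S)
          (subst (IsSpanningTree G) (sym (encode-decode S)) tree))))

liveCount≡∸ : ∀ {m} (D : Subset m) → liveCount D ≡ m ∸ ∣ D ∣
liveCount≡∸ {m} D = trans (sym (ℕP.m+n∸n≡m (liveCount D) ∣ D ∣)) (cong (_∸ ∣ D ∣) (liveCount+∣∣ D))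

-- `D` ranges over the leaves and 11' is deleted as well, so r = ∣D∣ + 1 and n - r = m - ∣D∣ is the
-- number of live leaves. The hypothesis makes it positive, so that the factor 3 can be cancelled.
treeCount-absent : ∀ {m} (D : Subset m) → suc ∣ D ∣ ≤ m →
  length (Trees.configs true D) ≡ (m ∸ ∣ D ∣) ℕ.* 3 ^ (m ∸ suc ∣ D ∣)
treeCount-absent {m} D d<m = begin
  length (Trees.configs true D) ≡⟨ cong length (ListP.++-identityʳ (withCentre false (confs 1 D))) ⟩
  length (withCentre false (confs 1 D)) ≡⟨ ListP.length-map _ (confs 1 D) ⟩
  length (confs 1 D) ≡⟨ ℕP.*-cancelʳ-≡ _ _ 3 (begin
    length (confs 1 D) ℕ.* 3          ≡⟨ length-confs₁ D ⟩
    liveCount D ℕ.* 3 ^ liveCount D    ≡⟨ cong (λ k → k ℕ.* 3 ^ k) (trans (liveCount≡∸ D) m∸d) ⟩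
    suc k ℕ.* (3 ℕ.* 3 ^ k)            ≡⟨ regroup (suc k) (3 ^ k) ⟩
    suc k ℕ.* 3 ^ k ℕ.* 3              ∎) ⟩
  suc k ℕ.* 3 ^ k                      ≡⟨ cong (ℕ._* 3 ^ k) m∸d ⟨
  (m ∸ ∣ D ∣) ℕ.* 3 ^ k               ∎
  where
  open ≡-Reasoning
  k = m ∸ suc ∣ D ∣
  m∸d : m ∸ ∣ D ∣ ≡ suc k
  m∸d = ℕP.+-∸-assoc 1 d<m
  regroup : ∀ a b → a ℕ.* (3 ℕ.* b) ≡ a ℕ.* b ℕ.* 3
  regroup = solveℕ-∀

-- With k live leaves, the trees without and with 11' number k·3^(k-1) + 3^k = (k + 3)·3^(k-1),
-- where k + 1 = n - r. The factor 9 avoids the exponent n - r - 2, which is -1 for k = 0.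
treeCount-present : ∀ {m} (D : Subset m) →
  length (Trees.configs false D) ℕ.* 9 ≡ (suc m ∸ ∣ D ∣ ℕ.+ 2) ℕ.* 3 ^ (suc m ∸ ∣ D ∣)
treeCount-present {m} D = begin
  length (Trees.configs false D) ℕ.* 9
    ≡⟨ cong (ℕ._* 9) (trans (ListP.length-++ (withCentre false (confs 1 D)))
         (cong₂ ℕ._+_ (ListP.length-map _ (confs 1 D)) (trans (ListP.length-map _ (confs 0 D)) (length-confs₀ D)))) ⟩
  (length (confs 1 D) ℕ.+ 3 ^ k) ℕ.* 9 ≡⟨ regroup (length (confs 1 D)) (3 ^ k) ⟩
  3 ℕ.* (length (confs 1 D) ℕ.* 3) ℕ.+ 9 ℕ.* 3 ^ k ≡⟨ cong (λ t → 3 ℕ.* t ℕ.+ 9 ℕ.* 3 ^ k) (length-confs₁ D) ⟩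
  3 ℕ.* (k ℕ.* 3 ^ k) ℕ.+ 9 ℕ.* 3 ^ k  ≡⟨ collect k (3 ^ k) ⟩
  (suc k ℕ.+ 2) ℕ.* 3 ^ suc k           ≡⟨ cong (λ j → (j ℕ.+ 2) ℕ.* 3 ^ j) 1+k ⟩
  (suc m ∸ ∣ D ∣ ℕ.+ 2) ℕ.* 3 ^ (suc m ∸ ∣ D ∣) ∎
  where
  open ≡-Reasoning
  k = liveCount D
  1+k : suc k ≡ suc m ∸ ∣ D ∣
  1+k = trans (sym (ℕP.m+n∸n≡m (suc k) ∣ D ∣)) (cong (λ t → suc t ∸ ∣ D ∣) (liveCount+∣∣ D))
  regroup : ∀ a b → (a ℕ.+ b) ℕ.* 9 ≡ 3 ℕ.* (a ℕ.* 3) ℕ.+ 9 ℕ.* b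
  regroup = solveℕ-∀
  collect : ∀ k p → 3 ℕ.* (k ℕ.* p) ℕ.+ 9 ℕ.* p ≡ ((1 ℕ.+ k) ℕ.+ 2) ℕ.* (3 ℕ.* p)
  collect = solveℕ-∀

theorem4p1 :
    (∀ (m r : ℕ) (D : Subset (suc m)) → r ≤ m → ∣ D ∣ ≡ r →
      let G = starPrismMinus m D
          n = ℕ→ℚ (suc m)
          ρ = ℕ→ℚ r
          c = ℕ→ℚ
      in
      -- 11' ∉ E(S_{n,r}^2)
      (Fin.zero ∈ D →
        HasKf G (((c 8 * (n * n * n) - (c 4 * ρ + c 17) * (n * n))
                   - ((c 4 * (ρ * ρ) - c 26 * ρ) - c 6) * n - c 6 * ρ)
                 ÷' (c 3 * (n - ρ)))
        × SpanningTreeCount G ((suc m ∸ r) ℕ.* 3 ^ (m ∸ r)))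
      ×
      -- 11' ∈ E(S_{n,r}^2)
      (Fin.zero ∉ D →
        HasKf G (((((c 8 * (n * n * n) - (c 4 * ρ - c 3) * (n * n))
                   - ((c 4 * (ρ * ρ) - c 30 * ρ) + c 14) * n) + c 12) - c 6 * ρ)
                 ÷' (c 3 * ((n - ρ) + c 2)))
        × ∃ λ t → SpanningTreeCount G t
                  × c t ≡ c ((suc m ∸ r ℕ.+ 2) ℕ.* 3 ^ (suc m ∸ r)) ÷' c 9))
    ×
    (∀ (r : ℕ) (ε : ℚ) → 0ℚ < ε →
      ∃ λ (M : ℕ) → ∀ (m : ℕ) → M ≤ m → r ≤ m →
        ∀ (D : Subset (suc m)) → ∣ D ∣ ≡ r →
          ∃₂ λ k w → HasKf (starPrismMinus m D) k
                     × HasWiener (starPrismMinus m D) w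
                     × ℚ.∣ (k ÷' ℕ→ℚ w) - (ℕ→ℚ 8 ÷' ℕ→ℚ 15) ∣ < ε)
theorem4p1 = (λ
  { m _ (true ∷ D) r≤m refl →
      (λ _ → KfPrism.Absent.hasKf (true ∷ D) r≤m refl ,
             subst (SpanningTreeCount (starPrismMinus m (true ∷ D))) (treeCount-absent D r≤m)
                   (Trees.spanningTreeCount true D)) ,
      (λ 0∉D → ⊥-elim (0∉D here))
  ; m _ (false ∷ D) r≤m refl →
      (λ ()) ,
      (λ _ → KfPrism.Present.hasKf (false ∷ D) r≤m refl ,
             length (Trees.configs false D) , Trees.spanningTreeCount false D ,
             ÷'-unique _ _ (ℕ→ℚ 9) (λ ())
               (trans (sym (ℕ→ℚ-* (length (Trees.configs false D)) 9)) (cong ℕ→ℚ (treeCount-present D))))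
  }) , limit
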